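{- Let $k\ge3$ and $m\ge1$. Then: (a) $\mathsf D(k,m)$ is a polytopal complex, and $\mathsf D_+(k,m)$ and $\mathsf D_+^t(k,m)$ are simplicial complexes. Moreover, $\mathsf D(k,m)$ arises as a linear section of $\mathsf D_+(k,m)$ and of $\mathsf D_+^t(k,m)$. (b) $\mathsf T(k,m)$ is the simplicial complex induced on the set of transversal $(m-2)$-dimensional faces of $\mathsf D_+(k,m)$. (c) The flip graph $D(k,m)$ is the $1$-skeleton of $\mathsf D(k,m)$.
   Context: Let $N=m(k-2)+2$ and consider a convex $N$-gon. $\delta(k,m)$ is the set of $k$-allowable diagonals: those that can appear in a dissection of the $N$-gon (by non-crossing diagonals) into $m$ convex $k$-gons. $I(k,m)$ is the graph on vertex set $\delta(k,m)$ in which two distinct diagonals are joined by an edge if their relative interiors do not intersect. $\mathsf T(k,m)$ is the simplicial complex on $\delta(k,m)$ whose simplices are the sets of pairwise non-crossing diagonals. The flip graph $D(k,m)$ has as vertices the dissections of the $N$-gon into $m$ convex $k$-gons (equivalently, the sets of $m-1$ pairwise non-crossing $k$-allowable diagonals), two being adjacent if they differ in the placement of exactly one diagonal. For a graph $H$ with $V(H)=[h]$ and $g\ge 0$: $\mathrm{Hom}(K_g,H)$ is the polytopal complex of all cells $\times_{i\in[g]}\sigma_i$ with $\emptyset\ne\sigma_i\subset V(H)$ such that for $i\ne j$ every $(u,v)\in\sigma_i\times\sigma_j$ is an edge of $H$. $\mathrm{Hom}_+(K_g,H)$ is the simplicial complex of all simplices $\star_{i\in[g]}\sigma_i$, $\sigma_i\subset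 V(H)$ possibly empty, with the same condition for all $i\ne j$ with $\sigma_i,\sigma_j$ both nonempty. A simplex $\star_i\sigma_i$ (and its projection) is transversal if all $\sigma_i$ are nonempty; $\mathrm{Hom}_+^t(K_g,H)$ is the subcomplex of $\mathrm{Hom}_+(K_g,H)$ consisting of all faces of transversal simplices. Subsets of $V(H)$ are identified with faces of $\Delta_{V(H)}=\mathrm{conv}\{e_1,\dots,e_h\}\subset\mathbb R^h$. Realize $\star_i\sigma_i$ as $\mathrm{conv}\bigcup_i\mu_i(\sigma_i)\times e_i\subset\mathbb R^{gh}\times\mathbb R^g$ and $\times_i\sigma_i$ as $\frac1g(\mu_1(\sigma_1)\times\dots\times\mu_g(\sigma_g))\times\frac{\mathbf 1}{g}$, where $\mu_i:\mathbb R^h\to(\mathbb R^h)^g$ is the $i$-th block inclusion and $\frac{\mathbf 1}{g}=(\frac1g,\dots,\frac1g)$. Let $\pi_\Box(x_1,\dots,x_g,y)=(x_1+\dots+x_g,y)\in\mathbb R^h\times\mathbb R^g$, let $\pi_\Delta:\mathbb R^h\times\mathbb R^g\to\mathbb R^h$ be the projection to the first factor, and $\pi=\pi_\Delta\pi_\Box$. Applying $\pi$ to a complex means taking the family of images of its cells, so $\pi(\times_i\sigma_i)=\frac1g(\sigma_1+\dots+\sigma_g)$ and $\pi(\star_i\sigma_i)=\mathrm{conv}\bigcup_i\sigma_i$. Set $$\mathsf D(k,m)=\pi\mathrm{Hom}(K_{m-1},I(k,m)),\quad \mathsf D_+(k,m)=\pi\mathrm{Hom}_+(K_{m-1},I(k,m)),\quad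 \mathsf D_+^t(k,m)=\pi\mathrm{Hom}_+^t(K_{m-1},I(k,m)).$$ "Linear section" is meant in the sense of the polyhedral Cayley trick: with $g=m-1$, $H=I(k,m)$, the family $\mathsf D(k,m)\times\frac{\mathbf 1}{g}$ is obtained by intersecting the cells of $\pi_\Box\mathrm{Hom}_+(K_g,H)$ (respectively $\pi_\Box\mathrm{Hom}_+^t(K_g,H)$), the lifts to $\mathbb R^h\times\mathbb R^g$ of $\mathsf D_+(k,m)$ (respectively $\mathsf D_+^t(k,m)$), with the affine subspace $\mathbb R^h\times\frac{\mathbf 1}{g}$, discarding empty intersections. The $1$-skeleton in (c) is taken as an abstract graph, the vertex $\pi(\{d_1\}\times\dots\times\{d_{m-1}\})$ of $\mathsf D(k,m)$ corresponding to the dissection $\{d_1,\dots,d_{m-1}\}$.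
   Formalization: The linear-section claims in (a) are stated for m ≥ 2 only: for m = 1, g = 0, so 1/g is undefined (and the section would be empty while D(k,1) is a point). Everything is proved over an arbitrary ordered field with decidable order, of which the reals are classically an instance. -}

module Defs where

open import Algebra.Bundles using (CommutativeRing)
import Algebra.Definitions.RawMonoid as RawMonoidDefinitions
open import Data.Bool.Base using (if_then_else_)
open import Data.Fin.Base as Fin using (Fin; zero; suc)
import Data.Fin.Properties as Fin
import Data.Fin.Subset as Subset
open Subset using (Subset; ⁅_⁆)
open import Data.Integer.Base using (ℤ; _⊖_; 0ℤ; 1ℤ)
open import Data.List.Base using (List; []; _∷_; [_]; _++_; allFin; length)
import Data.List.Membership.Propositional as List
open import Data.List.Relation.Unary.All using (All)
open import Data.Nat.Base as ℕ using (ℕ; _∸_)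
open import Data.Product.Base using (Σ; Σ-syntax; ∃; ∃-syntax; _×_; _,_; proj₁)
open import Data.Sum.Base using (_⊎_; inj₁; inj₂; [_,_]′)
open import Function.Base using (_∘_)
open import Function.Bundles using (_⇔_)
open import Function.Definitions using (Injective)
open import Level using (Level; _⊔_) renaming (suc to lsuc)
open import Relation.Binary.Core using (Rel)
open import Relation.Binary.PropositionalEquality.Core using (_≡_; _≢_)
open import Relation.Binary.Structures using (IsDecTotalOrder)
open import Relation.Nullary.Decidable.Core using (⌊_⌋)
open import Relation.Nullary.Negation.Core using (¬_)
open import Relation.Unary using (Pred; _∈_; _⊆_; _∩_; _≐_; Satisfiable)

------------------------------------------------------------------------
-- Ordered fields

-- The library has no real numbers, so everything below is over an
-- arbitrary ordered field 𝕂 (with decidable order); classically, ℝ is one.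
-- The inverse is total, with an unspecified value at 0#.

record OrderedField c ℓ₁ ℓ₂ : Set (lsuc (c ⊔ ℓ₁ ⊔ ℓ₂)) where
  infix  8 _⁻¹
  infix  4 _≤_ _<_
  field
    commutativeRing : CommutativeRing c ℓ₁
  open CommutativeRing commutativeRing public renaming (zero to *-zero)
  field
    _≤_             : Rel Carrier ℓ₂
    isDecTotalOrder : IsDecTotalOrder _≈_ _≤_
    +-monoˡ-≤       : ∀ z {x y} → x ≤ y → x + z ≤ y + z
    *-nonNegative   : ∀ {x y} → 0# ≤ x → 0# ≤ y → 0# ≤ x * y
    0≉1             : ¬ 0# ≈ 1#
    _⁻¹             : Carrier → Carrier
    ⁻¹-cong         : ∀ {x y} → x ≈ y → x ⁻¹ ≈ y ⁻¹
    *-inverseʳ      : ∀ x → ¬ x ≈ 0# → x * x ⁻¹ ≈ 1#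

  _<_ : Rel Carrier (ℓ₁ ⊔ ℓ₂)
  x < y = x ≤ y × ¬ x ≈ y

  open RawMonoidDefinitions +-rawMonoid public using (sum) renaming (_×_ to _·_)

------------------------------------------------------------------------
-- Dissections of polygons

-- The segment joining the i-th and the j-th vertex of an N-gon.  The chords
-- produced by `Dissects` below, started at `allFin N`, are diagonals of the
-- N-gon and satisfy i < j, so that each diagonal is represented only once.

Chord : ℕ → Set
Chord N = Fin N × Fin N

-- `Dissects Q ds Qs`: cutting the polygon whose vertices are Q, in cyclic
-- order, along the diagonals ds leaves the polygons Qs.

data Dissects {N : ℕ} : List (Fin N) → List (Chord N) → List (List (Fin N)) → Set where
  whole : ∀ Q → Dissects Q [] [ Q ]
  cut   : ∀ xs a ys b zs {ds ds′ Qs Qs′} →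
          ys ≢ [] → xs ++ zs ≢ [] →
          Dissects (a ∷ ys ++ [ b ]) ds Qs →
          Dissects (xs ++ a ∷ b ∷ zs) ds′ Qs′ →
          Dissects (xs ++ a ∷ ys ++ b ∷ zs) ((a , b) ∷ ds ++ ds′) (Qs ++ Qs′)

------------------------------------------------------------------------
-- Graphs

record Graph (v e a : Level) : Set (lsuc (v ⊔ e ⊔ a)) where
  field
    Vertex   : Set v
    Equal    : Rel Vertex e
    Adjacent : Rel Vertex a

record IsIsomorphism {v e a v′ e′ a′ r} (G : Graph v e a) (G′ : Graph v′ e′ a′)
                     (R : Graph.Vertex G → Graph.Vertex G′ → Set r)
                     : Set (v ⊔ e ⊔ a ⊔ v′ ⊔ e′ ⊔ a′ ⊔ r) where
  private
    module G  = Graph G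
    module G′ = Graph G′
  field
    total      : ∀ x → ∃[ y ] R x y
    surjective : ∀ y → ∃[ x ] R x y
    equal      : ∀ {x x′ y y′} → R x y → R x′ y′ → G.Equal x x′ ⇔ G′.Equal y y′
    adjacent   : ∀ {x x′ y y′} → R x y → R x′ y′ → G.Adjacent x x′ ⇔ G′.Adjacent y y′

module Geometry {c ℓ₁ ℓ₂} (𝕂 : OrderedField c ℓ₁ ℓ₂) where

  open OrderedField 𝕂

  ℓ : Level
  ℓ = c ⊔ ℓ₁ ⊔ ℓ₂

  ----------------------------------------------------------------------
  -- Affine and convex geometry in 𝕂^I

  Point : Set → Set c
  Point I = I → Carrier

  Region : Set → Set (lsuc ℓ)
  Region I = Pred (Point I) ℓ

  Family : Set → (l : Level) → Set (lsuc ℓ ⊔ lsuc l)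
  Family I l = Pred (Region I) l

  infix 4 _≋_
  _≋_ : ∀ {I} → Rel (Point I) ℓ₁
  x ≋ y = ∀ i → x i ≈ y i

  combination : ∀ {I n} → (Fin n → Carrier) → (Fin n → Point I) → Point I
  combination t v i = sum (λ j → t j * v j i)

  conv : ∀ {I a} → Pred (Point I) a → Pred (Point I) (ℓ ⊔ a)
  conv A x = ∃[ n ] Σ[ v ∈ (Fin n → Point _) ] Σ[ t ∈ (Fin n → Carrier) ]
    (∀ j → v j ∈ A) × (∀ j → 0# ≤ t j) × sum t ≈ 1# × x ≋ combination t v

  range : ∀ {I n} → (Fin n → Point I) → Pred (Point I) ℓ₁
  range v x = ∃[ j ] x ≋ v j

  AffinelyIndependent : ∀ {I n} → (Fin n → Point I) → Set (c ⊔ ℓ₁)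
  AffinelyIndependent v = ∀ t → sum t ≈ 0# → combination t v ≋ (λ _ → 0#) → ∀ j → t j ≈ 0#

  IsPolytope : ∀ {I} → Pred (Region I) ℓ
  IsPolytope C = ∃[ n ] Σ[ v ∈ (Fin n → Point _) ] C ≐ conv (range v)

  -- The empty set is the simplex of dimension -1.
  IsSimplex : ∀ {I} → ℤ → Pred (Region I) ℓ
  IsSimplex d C = ∃[ n ] Σ[ v ∈ (Fin n → Point _) ]
    d ≡ n ⊖ 1 × AffinelyIndependent v × C ≐ conv (range v)

  infix 8 _∙_
  _∙_ : ∀ {n} → (Fin n → Carrier) → Point (Fin n) → Carrier
  u ∙ x = sum (λ i → u i * x i)

  -- The empty set is a face of every polytope, and so is the polytope itself.
  IsFace : ∀ {n} → Region (Fin n) → Region (Fin n) → Set ℓ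
  IsFace F C = ∃[ u ] Σ[ b ∈ Carrier ]
    (∀ {x} → x ∈ C → u ∙ x ≤ b) × F ≐ (C ∩ λ x → u ∙ x ≈ b)

  -- A complex may, but need not, list the empty polytope among its cells.
  record IsPolytopalComplex {n l} (𝓒 : Family (Fin n) l) : Set (lsuc ℓ ⊔ l) where
    field
      finite    : ∃[ s ] Σ[ B ∈ (Fin s → Region (Fin n)) ] (∀ {C} → C ∈ 𝓒 → ∃[ i ] C ≐ B i)
      polytopes : ∀ {C} → C ∈ 𝓒 → IsPolytope C
      faces     : ∀ {C F} → C ∈ 𝓒 → IsFace F C → Satisfiable F → F ∈ 𝓒
      meets     : ∀ {C C′} → C ∈ 𝓒 → C′ ∈ 𝓒 → IsFace (C ∩ C′) C × IsFace (C ∩ C′) C′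

  record IsSimplicialComplex {n l} (𝓒 : Family (Fin n) l) : Set (lsuc ℓ ⊔ l) where
    field
      isPolytopalComplex : IsPolytopalComplex 𝓒
      simplices          : ∀ {C} → C ∈ 𝓒 → ∃[ d ] IsSimplex d C

  image : ∀ {I J} → (Point I → Point J) → Region I → Region J
  image f C y = ∃[ x ] x ∈ C × f x ≋ y

  images : ∀ {I J l} → (Point I → Point J) → Family I l → Family J (lsuc ℓ ⊔ l)
  images f 𝓒 D = ∃[ C ] C ∈ 𝓒 × D ≐ image f C

  section : ∀ {I a l} → Pred (Point I) a → Family I l → Family I (lsuc ℓ ⊔ a ⊔ l)
  section L 𝓒 D = ∃[ C ] C ∈ 𝓒 × D ≐ (C ∩ L) × Satisfiable D

  -- The simplicial complex whose simplices are all faces of the given ones.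
  induced : ∀ {n l} → Family (Fin n) l → Family (Fin n) (lsuc ℓ ⊔ l)
  induced 𝓒 F = ∃[ C ] C ∈ 𝓒 × IsFace F C

  -- The vertices and edges are the cells of dimension 0 and 1, which are
  -- necessarily simplices.
  1-skeleton : ∀ {n l} → Family (Fin n) l → Graph (lsuc ℓ ⊔ l) ℓ (lsuc ℓ ⊔ l)
  1-skeleton 𝓒 = record
    { Vertex   = ∃[ C ] C ∈ 𝓒 × IsSimplex 0ℤ C
    ; Equal    = λ (C , _) (C′ , _) → C ≐ C′
    ; Adjacent = λ (C , _) (C′ , _) → ¬ C ≐ C′ ×
        ∃[ E ] E ∈ 𝓒 × IsSimplex 1ℤ E × IsFace C E × IsFace C′ E
    }

  ----------------------------------------------------------------------
  -- The complexes Hom(K_g , H) and Hom₊(K_g , H)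

  basis : ∀ {h} → Fin h → Point (Fin h)
  basis v w = if ⌊ v Fin.≟ w ⌋ then 1# else 0#

  simplex : ∀ {h} → Subset h → Region (Fin h)
  simplex σ = conv (λ x → ∃[ v ] v Subset.∈ σ × x ≋ basis v)

  -- 𝕂^{gh} × 𝕂^g and 𝕂^h × 𝕂^g are represented by the following index types.
  Big Small : ℕ → ℕ → Set
  Big   g h = (Fin g × Fin h) ⊎ Fin g
  Small g h = Fin h ⊎ Fin g

  -- 1/g; for g = 0 the value is unspecified, but then it occurs as a coordinate
  -- of no point below.
  1/_ : ℕ → Carrier
  1/ g = (g · 1#) ⁻¹

  μ : ∀ {g h} → Fin g → Point (Fin h) → Point (Fin g × Fin h)
  μ i x (j , v) = if ⌊ i Fin.≟ j ⌋ then x v else 0#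

  ⨉ : ∀ {g h} → (Fin g → Subset h) → Region (Big g h)
  ⨉ {g} {h} σ z = Σ[ x ∈ (Fin g → Point (Fin h)) ] (∀ i → x i ∈ simplex (σ i)) ×
    z ≋ [ (λ iv → 1/ g * sum (λ i → μ i (x i) iv)) , (λ _ → 1/ g) ]′

  ⋆ : ∀ {g h} → (Fin g → Subset h) → Region (Big g h)
  ⋆ σ = conv (λ z → ∃[ i ] Σ[ x ∈ Point (Fin _) ] x ∈ simplex (σ i) × z ≋ [ μ i x , basis i ]′)

  Transversal : ∀ {g h} → (Fin g → Subset h) → Set
  Transversal σ = ∀ i → Subset.Nonempty (σ i)

  module _ {h a} (_~_ : Rel (Fin h) a) (g : ℕ) where

    Compatible : (Fin g → Subset h) → Set a
    Compatible σ = ∀ {i j} → i ≢ j → ∀ {u v} → u Subset.∈ σ i → v Subset.∈ σ j → u ~ v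

    Hom : Family (Big g h) (ℓ ⊔ a)
    Hom C = ∃[ σ ] Transversal σ × Compatible σ × C ≐ ⨉ σ

    Hom₊ : Family (Big g h) (ℓ ⊔ a)
    Hom₊ C = ∃[ σ ] Compatible σ × C ≐ ⋆ σ

    TransversalSimplices : Family (Big g h) (ℓ ⊔ a)
    TransversalSimplices C = ∃[ σ ] Transversal σ × Compatible σ × C ≐ ⋆ σ

    -- The faces of ⋆ σ are the ⋆ τ with τ i ⊆ σ i for all i.
    Hom₊ᵗ : Family (Big g h) (ℓ ⊔ a)
    Hom₊ᵗ C = ∃[ τ ] ∃[ σ ] Transversal σ × Compatible σ ×
      (∀ i → τ i Subset.⊆ σ i) × C ≐ ⋆ τ

  π□ : ∀ {g h} → Point (Big g h) → Point (Small g h)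
  π□ z = [ (λ v → sum (λ i → z (inj₁ (i , v)))) , z ∘ inj₂ ]′

  πΔ : ∀ {g h} → Point (Small g h) → Point (Fin h)
  πΔ z = z ∘ inj₁

  π : ∀ {g h} → Point (Big g h) → Point (Fin h)
  π {g} = πΔ {g} ∘ π□

  -- The affine subspace 𝕂^h × 𝟏/g.
  Slice : ∀ g h → Pred (Point (Small g h)) ℓ₁
  Slice g h z = ∀ i → z (inj₂ i) ≈ 1/ g

  -- The family of all C × 𝟏/g.
  _×𝟏/_ : ∀ {h l} → Family (Fin h) l → ∀ g → Family (Small g h) (lsuc ℓ ⊔ l)
  (𝓒 ×𝟏/ g) D = ∃[ C ] C ∈ 𝓒 × D ≐ (λ z → ∃[ x ] x ∈ C × z ≋ [ x , (λ _ → 1/ g) ]′)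

  ----------------------------------------------------------------------
  -- Convex polygons

  Plane : Set c
  Plane = Point (Fin 2)

  -- Twice the signed area of the triangle p q r.
  orientation : Plane → Plane → Plane → Carrier
  orientation p q r = (q x - p x) * (r y - p y) - (q y - p y) * (r x - p x)
    where x = zero ; y = suc zero

  -- The vertices are numbered counterclockwise, no three being collinear.
  record ConvexPolygon (N : ℕ) : Set (c ⊔ ℓ₁ ⊔ ℓ₂) where
    field
      vertex : Fin N → Plane
      convex : ∀ {i j l} → i Fin.< j → j Fin.< l →
               0# < orientation (vertex i) (vertex j) (vertex l)

  relativeInterior : Plane → Plane → Region (Fin 2)
  relativeInterior p q x = ∃[ s ] 0# < s × s < 1# × x ≋ λ i → (1# - s) * p i + s * q i

  module Polygon {N : ℕ} (P : ConvexPolygon N) where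

    open ConvexPolygon P

    interior : Chord N → Region (Fin 2)
    interior (i , j) = relativeInterior (vertex i) (vertex j)

    Crossing : Rel (Chord N) ℓ
    Crossing d d′ = Satisfiable (interior d ∩ interior d′)

    IsDissection : (k m : ℕ) → List (Chord N) → Set ℓ
    IsDissection k m ds =
      (∀ {d d′} → d List.∈ ds → d′ List.∈ ds → d ≢ d′ → ¬ Crossing d d′) ×
      ∃[ Qs ] Dissects (allFin N) ds Qs × length Qs ≡ m × All (λ Q → length Q ≡ k) Qs

    Allowable : (k m : ℕ) → Pred (Chord N) ℓ
    Allowable k m d = ∃[ ds ] IsDissection k m ds × d List.∈ ds

  size : (k m : ℕ) → ℕ
  size k m = m ℕ.* (k ∸ 2) ℕ.+ 2

  -- A bijection of [h] with δ(k , m), by which the two are identified.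
  record Enumeration k m (P : ConvexPolygon (size k m)) (h : ℕ) : Set ℓ where
    open Polygon P
    field
      diagonal  : Fin h → Chord (size k m)
      injective : Injective _≡_ _≡_ diagonal
      allowable : ∀ v → Allowable k m (diagonal v)
      complete  : ∀ {d} → Allowable k m d → ∃[ v ] diagonal v ≡ d

  module Complexes {k m} (P : ConvexPolygon (size k m)) {h} (δ : Enumeration k m P h) where

    open Polygon P
    open Enumeration δ

    I : Rel (Fin h) ℓ
    I u v = u ≢ v × ¬ Crossing (diagonal u) (diagonal v)

    g : ℕ
    g = m ∸ 1

    𝖣 𝖣₊ 𝖣₊ᵗ : Family (Fin h) (lsuc ℓ)
    𝖣   = images π (Hom I g)
    𝖣₊  = images π (Hom₊ I g)
    𝖣₊ᵗ = images π (Hom₊ᵗ I g)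

    π□Hom₊ π□Hom₊ᵗ : Family (Small g h) (lsuc ℓ)
    π□Hom₊  = images π□ (Hom₊ I g)
    π□Hom₊ᵗ = images π□ (Hom₊ᵗ I g)

    𝖳 : Family (Fin h) ℓ
    𝖳 C = ∃[ τ ] (∀ {u v} → u Subset.∈ τ → v Subset.∈ τ → u ≢ v → I u v) × C ≐ simplex τ

    TransversalFaces : ℤ → Family (Fin h) (lsuc ℓ)
    TransversalFaces d = images π (TransversalSimplices I g) ∩ IsSimplex d

    flipGraph : Graph ℓ _ _
    flipGraph = record
      { Vertex   = Σ[ S ∈ Subset h ] ∃[ ds ] IsDissection k m ds ×
                     (∀ d → (∃[ v ] v Subset.∈ S × diagonal v ≡ d) ⇔ d List.∈ ds)
      ; Equal    = λ (S , _) (S′ , _) → S ≡ S′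
      ; Adjacent = λ (S , _) (S′ , _) → ∃[ v ] ∃[ v′ ]
          v Subset.∈ S × v′ Subset.∈ S′ × v ≢ v′ × S Subset.- v ≡ S′ Subset.- v′
      }

    -- {d₁ , … , d_g} corresponds to the vertex π({d₁} × … × {d_g}).
    Corresponds : Graph.Vertex flipGraph → Graph.Vertex (1-skeleton 𝖣) → Set ℓ
    Corresponds (S , _) (C , _) = Σ[ d ∈ (Fin g → Fin h) ]
      (∀ v → v Subset.∈ S ⇔ (∃[ i ] d i ≡ v)) × C ≐ image π (⨉ (λ i → ⁅ d i ⁆))

{-# OPTIONS --safe #-}

-- In a convex polygon two diagonals cross exactly if their ends interleave, and a
-- diagonal is k-allowable only if its ends differ by 1 modulo k - 2.  Cutting
-- along given non-crossing diagonals of this kind, and cutting off k-gons when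
-- none is left, extends them to a dissection.  Hence every clique of I(k,m)
-- lies in one with m - 1 elements, and the cliques of this size are the
-- dissections.
--
-- As σ₁ , … , σ_g with g = m - 1 are disjoint, π (⋆ σ) is the simplex on their
-- union, and π (⨉ σ) consists of the points x ≥ 0 supported on it with mass 1/g on
-- every σᵢ.  Two elements of the same σᵢ cannot be adjacent, since they would form
-- a clique of size g + 1 together with one element of every other σⱼ; so the
-- partition of ⋃ σᵢ is determined by non-adjacency, and the common points of two
-- cells are those points of one of them that are supported on the other one.
-- This is a face.  The faces of ⨉ σ and their vertices are read off from
-- supports: a point whose support is minimal occurs among any finite set of
-- points that spans the cell, which yields the cells of dimension 0 and 1.

module Submission where

open import Defs

-- The polygon enters the polyhedral argument only through four properties of `I`: it is symmetric
-- and irreflexive, no clique has more than g elements, and every clique lies in one with g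
-- elements. `CliqueComplexes` is therefore about an arbitrary graph of this kind. The congruence
-- modulo k - 2 comes from counting: a diagonal with q k-gons on one side has q (k - 2) vertices
-- strictly between its ends there. It is preserved by cutting, so both pieces again have a number
-- of vertices that k-gons can fill, and the recursion never gets stuck. Cells are defined as hulls
-- and images, where it is hard to refute membership. Each kind is first rewritten by equations and
-- inequalities in coordinates; a face is then found by comparing a functional with its maximum on
-- every block. `IsSimplex` shows a dimension only as a number of spanning points.

module Combinatorics where

  open import Data.Empty using (⊥-elim)
  open import Data.Fin.Base as Fin using (Fin; zero; suc; toℕ; _<_; _≤_)
  import Data.Fin.Properties as Fin
  open import Data.List.Base using (List; []; _∷_; [_]; _++_; allFin; length; tabulate)
  open import Data.List.Properties using (length-++)
  open import Data.List.Membership.Propositional using (_∈_; find; lose)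
  open import Data.List.Membership.Propositional.Properties
    using (∈-++⁺ˡ; ∈-++⁺ʳ; ∈-++⁻; ∈-∃++)
  open import Data.List.Relation.Unary.All as All using (All; []; _∷_)
  import Data.List.Relation.Unary.All.Properties as All
  open import Data.List.Relation.Unary.AllPairs using (AllPairs; []; _∷_)
  import Data.List.Relation.Unary.AllPairs.Properties as AllPairs
  open import Data.List.Relation.Unary.Any as Any using (here; there)
  open import Data.List.Relation.Unary.Linked as Linked using (Linked; []; [-]; _∷_)
  import Data.List.Relation.Unary.Linked.Properties as Linked
  open import Data.Nat.Base as ℕ using (ℕ; zero; suc; _+_; _*_; _∸_)
  open import Data.Nat.Divisibility using (divides; ∣m+n∣m⇒∣n; _∣_; n∣m*n)
  open import Data.Nat.Properties as ℕ using ()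
  open import Data.Nat.Solver using (module +-*-Solver)
  open import Data.Product.Base using (∃-syntax; _×_; _,_; proj₁; proj₂)
  open import Data.Product.Properties using (≡-dec)
  open import Data.Sum.Base using (_⊎_; inj₁; inj₂)
  open import Function.Base using (_∘_; case_of_)
  open import Induction.WellFounded using (Acc; acc)
  open import Relation.Binary.PropositionalEquality hiding ([_])
  open import Relation.Nullary using (¬_; Dec; yes; no)
  open import Relation.Nullary.Decidable using (_×-dec_; _⊎-dec_)

  module _ {a ℓ} {A : Set a} {R : A → A → Set ℓ} where

    linked-split : ∀ xs {y zs} → Linked R (xs ++ y ∷ zs) → Linked R (xs ++ [ y ]) × Linked R (y ∷ zs)
    linked-split []           l       = [-] , l
    linked-split (x ∷ [])     (r ∷ l) = r ∷ [-] , l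
    linked-split (x ∷ x′ ∷ xs) (r ∷ l) with linked-split (x′ ∷ xs) l
    ... | l₁ , l₂ = r ∷ l₁ , l₂

    linked-glue : ∀ xs {y zs} → Linked R (xs ++ [ y ]) → Linked R (y ∷ zs) → Linked R (xs ++ y ∷ zs)
    linked-glue []            _       l = l
    linked-glue (x ∷ [])      (r ∷ _) l = r ∷ l
    linked-glue (x ∷ x′ ∷ xs) (r ∷ k) l = r ∷ linked-glue (x′ ∷ xs) k l

  -- Diagonals of a polygon with sorted vertices, and cutting along one of them

  module _ {N : ℕ} where

    Interleaved : Chord N → Chord N → Set
    Interleaved (a , b) (c , d) = a < c × c < b × b < d

    Apart : Chord N → Chord N → Set
    Apart d e = ¬ Interleaved d e × ¬ Interleaved e d

    apart-sym : ∀ {d e} → Apart d e → Apart e d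
    apart-sym (p , q) = q , p

    apart-refl : ∀ {d} → Apart d d
    apart-refl = (λ (p , _) → ℕ.<-irrefl refl p) , (λ (p , _) → ℕ.<-irrefl refl p)

    -- The witnesses `inner` and `outer` exclude the sides of the polygon: consecutive vertices fail
    -- `inner`, and the side joining the last vertex to the first fails `outer`.
    record Diagonal (Q : List (Fin N)) (d : Chord N) : Set where
      constructor diag
      field
        source  : proj₁ d ∈ Q
        target  : proj₂ d ∈ Q
        ordered : proj₁ d < proj₂ d
        inner   : ∃[ e ] e ∈ Q × proj₁ d < e × e < proj₂ d
        outer   : ∃[ e ] e ∈ Q × (e < proj₁ d ⊎ proj₂ d < e)
    open Diagonal public

    diagonal-mono : ∀ {Q Q′ d} → (∀ {x} → x ∈ Q → x ∈ Q′) → Diagonal Q d → Diagonal Q′ d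
    diagonal-mono f (diag s t o (e , i , p) (e′ , i′ , p′)) =
      diag (f s) (f t) o (e , f i , p) (e′ , f i′ , p′)

    diagonal? : ∀ Q d → Dec (Diagonal Q d)
    diagonal? Q (a , b) with (a ∈? Q) ×-dec (b ∈? Q) ×-dec (a Fin.<? b)
        ×-dec Fin.any? (λ e → (e ∈? Q) ×-dec (a Fin.<? e) ×-dec (e Fin.<? b))
        ×-dec Fin.any? (λ e → (e ∈? Q) ×-dec ((e Fin.<? a) ⊎-dec (b Fin.<? e)))
      where open import Data.List.Membership.DecPropositional (Fin._≟_ {N}) using (_∈?_)
    ... | yes (s , t , o , i , u) = yes (diag s t o i u)
    ... | no ¬p = no λ (diag s t o i u) → ¬p (s , t , o , i , u)

    _≟ᶜ_ : (d e : Chord N) → Dec (d ≡ e)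
    _≟ᶜ_ = ≡-dec Fin._≟_ Fin._≟_

    Sorted : List (Fin N) → Set
    Sorted = AllPairs Fin._<_

    module Cut {xs : List (Fin N)} {a ys b zs} (sorted : Sorted (xs ++ a ∷ ys ++ b ∷ zs)) where

      whole-polygon inside outside : List (Fin N)
      whole-polygon = xs ++ a ∷ ys ++ b ∷ zs
      inside  = a ∷ ys ++ [ b ]
      outside = xs ++ a ∷ b ∷ zs

      private
        split : ∀ (us : List (Fin N)) {v ws} → Sorted (us ++ v ∷ ws) →
                All (_< v) us × All (v <_) ws × Sorted (v ∷ ws)
        split []       (p ∷ s) = [] , p , p ∷ s
        split (u ∷ us) (p ∷ s) with split us s
        ... | l , r , s′ = All.head (All.++⁻ʳ us p) ∷ l , r , s′

        at-a = split xs sorted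
        at-b : All (_< b) ys × All (b <_) zs × Sorted (b ∷ zs)
        at-b with proj₂ (proj₂ at-a)
        ... | _ ∷ s = split ys s

      before : ∀ {x} → x ∈ xs → x < a
      before = All.lookup (proj₁ at-a)

      a<b : a < b
      a<b = All.lookup (proj₁ (proj₂ at-a)) (∈-++⁺ʳ ys (here refl))

      between : ∀ {x} → x ∈ ys → a < x × x < b
      between i = All.lookup (proj₁ (proj₂ at-a)) (∈-++⁺ˡ i) , All.lookup (proj₁ at-b) i

      after : ∀ {x} → x ∈ zs → b < x
      after = All.lookup (proj₁ (proj₂ at-b))

      data Position (x : Fin N) : Set where
        in-xs : x ∈ xs → Position x
        at-a′ : x ≡ a → Position x
        in-ys : x ∈ ys → Position x
        at-b′ : x ≡ b → Position x
        in-zs : x ∈ zs → Position x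

      position : ∀ {x} → x ∈ whole-polygon → Position x
      position i with ∈-++⁻ xs i
      ... | inj₁ p = in-xs p
      ... | inj₂ (here p) = at-a′ p
      ... | inj₂ (there j) with ∈-++⁻ ys j
      ... | inj₁ p = in-ys p
      ... | inj₂ (here p) = at-b′ p
      ... | inj₂ (there p) = in-zs p

      -- Here and in the next three lemmas membership in a piece is traded for comparisons with a
      -- and b, so that later arguments concern the order of the vertices only.
      inside⇒ : ∀ {x} → x ∈ inside → x ∈ whole-polygon × a ≤ x × x ≤ b
      inside⇒ (here refl) = ∈-++⁺ʳ xs (here refl) , ℕ.≤-refl , ℕ.<⇒≤ a<b
      inside⇒ (there i) with ∈-++⁻ ys i
      ... | inj₁ j = ∈-++⁺ʳ xs (there (∈-++⁺ˡ j)) , ℕ.<⇒≤ (proj₁ (between j)) , ℕ.<⇒≤ (proj₂ (between j))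
      ... | inj₂ (here refl) = ∈-++⁺ʳ xs (there (∈-++⁺ʳ ys (here refl))) , ℕ.<⇒≤ a<b , ℕ.≤-refl

      outside⇒ : ∀ {x} → x ∈ outside → x ∈ whole-polygon × (x ≤ a ⊎ b ≤ x)
      outside⇒ i with ∈-++⁻ xs i
      ... | inj₁ j = ∈-++⁺ˡ j , inj₁ (ℕ.<⇒≤ (before j))
      ... | inj₂ (here refl) = ∈-++⁺ʳ xs (here refl) , inj₁ ℕ.≤-refl
      ... | inj₂ (there (here refl)) = ∈-++⁺ʳ xs (there (∈-++⁺ʳ ys (here refl))) , inj₂ ℕ.≤-refl
      ... | inj₂ (there (there j)) = ∈-++⁺ʳ xs (there (∈-++⁺ʳ ys (there j))) , inj₂ (ℕ.<⇒≤ (after j))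

      ⇒inside : ∀ {x} → x ∈ whole-polygon → a ≤ x → x ≤ b → x ∈ inside
      ⇒inside i p q with position i
      ... | in-xs j    = ⊥-elim (ℕ.<⇒≱ (before j) p)
      ... | at-a′ refl = here refl
      ... | in-ys j    = there (∈-++⁺ˡ j)
      ... | at-b′ refl = there (∈-++⁺ʳ ys (here refl))
      ... | in-zs j    = ⊥-elim (ℕ.<⇒≱ (after j) q)

      ⇒outside : ∀ {x} → x ∈ whole-polygon → x ≤ a ⊎ b ≤ x → x ∈ outside
      ⇒outside i p with position i
      ... | in-xs j    = ∈-++⁺ˡ j
      ... | at-a′ refl = ∈-++⁺ʳ xs (here refl)
      ⇒outside i (inj₁ p) | in-ys j = ⊥-elim (ℕ.<⇒≱ (proj₁ (between j)) p)
      ⇒outside i (inj₂ p) | in-ys j = ⊥-elim (ℕ.<⇒≱ (proj₂ (between j)) p)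
      ... | at-b′ refl = ∈-++⁺ʳ xs (there (here refl))
      ... | in-zs j    = ∈-++⁺ʳ xs (there (there j))

      a∈inside : a ∈ inside
      a∈inside = here refl

      b∈inside : b ∈ inside
      b∈inside = there (∈-++⁺ʳ ys (here refl))

      a∈outside : a ∈ outside
      a∈outside = ∈-++⁺ʳ xs (here refl)

      b∈outside : b ∈ outside
      b∈outside = ∈-++⁺ʳ xs (there (here refl))

      cut-diagonal : ys ≢ [] → xs ++ zs ≢ [] → Diagonal whole-polygon (a , b)
      cut-diagonal ys≢[] xszs≢[] =
        diag (proj₁ (inside⇒ a∈inside)) (proj₁ (inside⇒ b∈inside)) a<b (middle ys≢[] refl) (rest refl refl)
        where
        middle : ys ≢ [] → ∀ {us} → us ≡ ys → ∃[ e ] e ∈ whole-polygon × a < e × e < b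
        middle ≢[] {[]}     eq = ⊥-elim (≢[] (sym eq))
        middle ≢[] {u ∷ us} eq with between (subst (u ∈_) eq (here refl))
        ... | p , q = u , ∈-++⁺ʳ xs (there (∈-++⁺ˡ (subst (u ∈_) eq (here refl)))) , p , q
        rest : ∀ {us ws} → us ≡ xs → ws ≡ zs → ∃[ e ] e ∈ whole-polygon × (e < a ⊎ b < e)
        rest {[]} {[]} eq eq′ = ⊥-elim (xszs≢[] (sym (cong₂ _++_ eq eq′)))
        rest {[]} {w ∷ ws} _ eq with subst (w ∈_) eq (here refl)
        ... | i = w , ∈-++⁺ʳ xs (there (∈-++⁺ʳ ys (there i))) , inj₂ (after i)
        rest {u ∷ us} eq _ with subst (u ∈_) eq (here refl)
        ... | i = u , ∈-++⁺ˡ i , inj₁ (before i)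

      -- The cut is a side of both pieces: it joins the extreme vertices of `inside`, where `outer`
      -- fails, and neighbours in `outside`, where `inner` fails.
      diagonal-inside⇒ : ∀ {d} → Diagonal inside d → d ≢ (a , b)
      diagonal-inside⇒ (diag _ _ _ _ (e , i , inj₁ p)) refl = ℕ.<⇒≱ p (proj₁ (proj₂ (inside⇒ i)))
      diagonal-inside⇒ (diag _ _ _ _ (e , i , inj₂ p)) refl = ℕ.<⇒≱ p (proj₂ (proj₂ (inside⇒ i)))

      diagonal-outside⇒ : ∀ {d} → Diagonal outside d → d ≢ (a , b)
      diagonal-outside⇒ (diag _ _ _ (e , i , p , q) _) refl with proj₂ (outside⇒ i)
      ... | inj₁ p′ = ℕ.<⇒≱ p p′
      ... | inj₂ p′ = ℕ.<⇒≱ q p′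

      apart-inside : ∀ {d} → Diagonal inside d → Apart (a , b) d
      apart-inside (diag s t o _ _) with inside⇒ s | inside⇒ t
      ... | _ , a≤c , _ | _ , _ , d≤b =
        (λ (_ , _ , b<d) → ℕ.<⇒≱ b<d d≤b) , (λ (c<a , _ , _) → ℕ.<⇒≱ c<a a≤c)

      apart-outside : ∀ {d} → Diagonal outside d → Apart (a , b) d
      apart-outside (diag s t o _ _) with proj₂ (outside⇒ s) | proj₂ (outside⇒ t)
      ... | c∉ | d∉ = (λ (a<c , c<b , _) → avoid c∉ a<c c<b) , (λ (_ , a<d , d<b) → avoid d∉ a<d d<b)
        where
        avoid : ∀ {x} → x ≤ a ⊎ b ≤ x → a < x → x < b → _
        avoid (inj₁ p) q _ = ℕ.<⇒≱ q p
        avoid (inj₂ p) _ q = ℕ.<⇒≱ q p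

      -- The ends of d lie in the closed interval from a to b and those of e avoid its interior,
      -- which leaves no room for interleaving. A common chord could only be the cut itself, which
      -- is not a diagonal of `inside`.
      apart-across : ∀ {d e} → Diagonal inside d → Diagonal outside e → Apart d e × d ≢ e
      apart-across {c , d} {c′ , d′} D E with inside⇒ (source D) | inside⇒ (target D)
                           | proj₂ (outside⇒ (source E)) | proj₂ (outside⇒ (target E))
      ... | _ , a≤c , _ | _ , _ , d≤b | c′∉ | d′∉ = (first c′∉ , second d′∉) , (λ { refl → equal c′∉ d′∉ })
        where
        first : c′ ≤ a ⊎ b ≤ c′ → ¬ Interleaved (c , d) (c′ , d′)
        first (inj₁ p) (q , _ , _) = ℕ.<⇒≱ (ℕ.<-≤-trans q p) a≤c
        first (inj₂ p) (_ , q , _) = ℕ.<⇒≱ q (ℕ.≤-trans d≤b p)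
        second : d′ ≤ a ⊎ b ≤ d′ → ¬ Interleaved (c′ , d′) (c , d)
        second (inj₁ p) (_ , q , _) = ℕ.<⇒≱ q (ℕ.≤-trans p a≤c)
        second (inj₂ p) (_ , _ , q) = ℕ.<⇒≱ (ℕ.≤-<-trans p q) d≤b
        equal : c ≤ a ⊎ b ≤ c → d ≤ a ⊎ b ≤ d → _
        equal (inj₂ p) _ = ℕ.<⇒≱ (ordered D) (ℕ.≤-trans d≤b p)
        equal (inj₁ p) (inj₁ q) = ℕ.<⇒≱ (ordered D) (ℕ.≤-trans q a≤c)
        equal (inj₁ p) (inj₂ q) = diagonal-inside⇒ D
          (cong₂ _,_ (Fin.≤-antisym p a≤c) (Fin.≤-antisym d≤b q))

      -- Being apart from the cut puts both ends into one piece. The old witnesses of `inner` and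
      -- `outer` may belong to the other piece; then a or b takes their place, which works because
      -- the chord is not the cut itself.
      distribute : ∀ {d} → Diagonal whole-polygon d → Apart (a , b) d → d ≢ (a , b) →
                   Diagonal inside d ⊎ Diagonal outside d
      distribute {c , d} (diag s t o (e , e∈ , c<e , e<d) (f , f∈ , f∉)) (¬i , ¬i′) d≢ =
        go (a Fin.≤? c) (d Fin.≤? b)
        where
        out : c ≤ a ⊎ b ≤ c → d ≤ a ⊎ b ≤ d → Diagonal outside (c , d)
        out c∉ d∉ = diag (⇒outside s c∉) (⇒outside t d∉) o (inner′ c∉ d∉) outer′
          where
          enclosing : c ≤ a → b ≤ d →
                      ∃[ e ] e ∈ outside × c < e × e < d
          enclosing p q with c Fin.≟ a | b Fin.≟ d
          ... | no c≢a | _ = a , a∈outside , Fin.≤∧≢⇒< p c≢a , ℕ.<-≤-trans a<b q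
          ... | yes refl | no b≢d = b , b∈outside , a<b , Fin.≤∧≢⇒< q b≢d
          ... | yes refl | yes refl = ⊥-elim (d≢ refl)
          e-outside : e ≤ a ⊎ b ≤ e → ∃[ e ] e ∈ outside × c < e × e < d
          e-outside e∉ = e , ⇒outside e∈ e∉ , c<e , e<d
          inner′ : c ≤ a ⊎ b ≤ c → d ≤ a ⊎ b ≤ d →
                ∃[ e ] e ∈ outside × c < e × e < d
          inner′ (inj₁ p) (inj₂ q) = enclosing p q
          inner′ (inj₁ p) (inj₁ q) = e-outside (inj₁ (ℕ.≤-trans (ℕ.<⇒≤ e<d) q))
          inner′ (inj₂ p) _        = e-outside (inj₂ (ℕ.≤-trans p (ℕ.<⇒≤ c<e)))
          f-outside : f ≤ a ⊎ b ≤ f → ∃[ e ] e ∈ outside × (e < c ⊎ d < e)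
          f-outside p = f , ⇒outside f∈ p , f∉
          outer′ : ∃[ e ] e ∈ outside × (e < c ⊎ d < e)
          outer′ with a Fin.<? f | f Fin.<? b
          ... | no ¬p | _ = f-outside (inj₁ (ℕ.≮⇒≥ ¬p))
          ... | yes _ | no ¬p = f-outside (inj₂ (ℕ.≮⇒≥ ¬p))
          ... | yes a<f | yes f<b = case f∉ of λ where
            (inj₁ f<c) → a , a∈outside , inj₁ (ℕ.<-trans a<f f<c)
            (inj₂ d<f) → b , b∈outside , inj₂ (ℕ.<-trans d<f f<b)
        outer-inside : a ≤ c → d ≤ b → ∃[ e ] e ∈ inside × (e < c ⊎ d < e)
        outer-inside p q with a Fin.≟ c | d Fin.≟ b
        ... | no a≢c | _ = a , a∈inside , inj₁ (Fin.≤∧≢⇒< p a≢c)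
        ... | yes _ | no d≢b = b , b∈inside , inj₂ (Fin.≤∧≢⇒< q d≢b)
        ... | yes refl | yes refl = ⊥-elim (d≢ refl)
        go : Dec (a ≤ c) → Dec (d ≤ b) → Diagonal inside (c , d) ⊎ Diagonal outside (c , d)
        go (yes a≤c) (yes d≤b) = inj₁ (diag
          (⇒inside s a≤c (ℕ.≤-trans (ℕ.<⇒≤ o) d≤b))
          (⇒inside t (ℕ.≤-trans a≤c (ℕ.<⇒≤ o)) d≤b) o
          (e , ⇒inside e∈ (ℕ.≤-trans a≤c (ℕ.<⇒≤ c<e)) (ℕ.≤-trans (ℕ.<⇒≤ e<d) d≤b) , c<e , e<d)
          (outer-inside a≤c d≤b))
        go (no a≰c) (no d≰b) = inj₂ (out (inj₁ (ℕ.≰⇒≥ a≰c)) (inj₂ (ℕ.≰⇒≥ d≰b)))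
        go (no a≰c) (yes d≤b) with d Fin.≤? a | d Fin.≟ b
        ... | yes d≤a | _ = inj₂ (out (inj₁ (ℕ.≰⇒≥ a≰c)) (inj₁ d≤a))
        ... | no d≰a | no d≢b = ⊥-elim (¬i′ (ℕ.≰⇒> a≰c , ℕ.≰⇒> d≰a , Fin.≤∧≢⇒< d≤b d≢b))
        ... | no d≰a | yes refl = inj₂ (out (inj₁ (ℕ.≰⇒≥ a≰c)) (inj₂ ℕ.≤-refl))
        go (yes a≤c) (no d≰b) with b Fin.≤? c | a Fin.≟ c
        ... | yes b≤c | _ = inj₂ (out (inj₂ b≤c) (inj₂ (ℕ.≰⇒≥ d≰b)))
        ... | no b≰c | no a≢c = ⊥-elim (¬i (Fin.≤∧≢⇒< a≤c a≢c , ℕ.≰⇒> b≰c , ℕ.≰⇒> d≰b))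
        ... | no b≰c | yes refl = inj₂ (out (inj₁ ℕ.≤-refl) (inj₂ (ℕ.≰⇒≥ d≰b)))

    -- Sortedness places b in the part of the list after a; the witnesses of `inner` and `outer`
    -- provide the two side conditions of `cut`.
    diagonal-decomposition : ∀ {Q a b} → Sorted Q → Diagonal Q (a , b) →
      ∃[ xs ] ∃[ ys ] ∃[ zs ] Q ≡ xs ++ a ∷ ys ++ b ∷ zs × ys ≢ [] × xs ++ zs ≢ []
    diagonal-decomposition {Q} {a} {b} sorted (diag s t o (e , e∈ , a<e , e<b) (f , f∈ , f∉)) =
      xs , ys , zs , eq , ys≢[] , xszs≢[]
      where
      later : ∀ us {vs} → Sorted (us ++ a ∷ vs) → b ∈ us ++ a ∷ vs → b ∈ vs
      later []       (p ∷ _) (here refl) = ⊥-elim (ℕ.<-irrefl refl o)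
      later []       (p ∷ _) (there i)   = i
      later (u ∷ us) (p ∷ q) (here refl) = ⊥-elim (ℕ.<-asym o (All.lookup p (∈-++⁺ʳ us (here refl))))
      later (u ∷ us) (p ∷ q) (there i)   = later us q i
      pieces : ∃[ xs ] ∃[ ys ] ∃[ zs ] Q ≡ xs ++ a ∷ ys ++ b ∷ zs
      pieces with ∈-∃++ s
      ... | xs , vs , refl with ∈-∃++ (later xs sorted t)
      ... | ys , zs , refl = xs , ys , zs , refl
      xs = proj₁ pieces
      ys = proj₁ (proj₂ pieces)
      zs = proj₁ (proj₂ (proj₂ pieces))
      eq = proj₂ (proj₂ (proj₂ pieces))
      open Cut {xs} {a} {ys} {b} {zs} (subst Sorted eq sorted)
      ys≢[] : ys ≢ []
      ys≢[] ≡[] with position (subst (e ∈_) eq e∈)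
      ... | in-xs i = ℕ.<-asym a<e (before i)
      ... | at-a′ refl = ℕ.<-irrefl refl a<e
      ... | in-ys i = case subst (e ∈_) ≡[] i of λ ()
      ... | at-b′ refl = ℕ.<-irrefl refl e<b
      ... | in-zs i = ℕ.<-asym e<b (after i)
      nothing : f < a ⊎ b < f → Position f → xs ≡ [] → zs ≡ [] → _
      nothing _ (in-xs i) ≡[] _ = case subst (f ∈_) ≡[] i of λ ()
      nothing _ (in-zs i) _ ≡[] = case subst (f ∈_) ≡[] i of λ ()
      nothing (inj₁ p) (at-a′ refl) _ _ = ℕ.<-irrefl refl p
      nothing (inj₁ p) (in-ys i) _ _ = ℕ.<-asym p (proj₁ (between i))
      nothing (inj₁ p) (at-b′ refl) _ _ = ℕ.<-asym p a<b
      nothing (inj₂ p) (at-a′ refl) _ _ = ℕ.<-asym p a<b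
      nothing (inj₂ p) (in-ys i) _ _ = ℕ.<-asym p (proj₂ (between i))
      nothing (inj₂ p) (at-b′ refl) _ _ = ℕ.<-irrefl refl p
      xszs≢[] : xs ++ zs ≢ []
      xszs≢[] ≡[] = nothing f∉ (position (subst (f ∈_) eq f∈)) (++-[]ˡ xs ≡[]) (++-[]ʳ xs ≡[])
        where
        ++-[]ˡ : ∀ us {vs : List (Fin N)} → us ++ vs ≡ [] → us ≡ []
        ++-[]ˡ [] _ = refl
        ++-[]ʳ : ∀ us {vs : List (Fin N)} → us ++ vs ≡ [] → vs ≡ []
        ++-[]ʳ [] p = p

    -- Dissections into k-gons and their extension

    module Dissection (r : ℕ) where

      Small : List (Fin N) → Set
      Small Q = length Q ≡ 2 + suc r

      -- k - 2 = suc r.  Consecutive vertices of all polygons that are cut off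
      -- differ by 1 modulo k - 2, and so do the ends of every k-allowable diagonal.
      Step : Fin N → Fin N → Set
      Step a b = ∃[ c ] toℕ b ≡ toℕ a + suc (c * suc r)

      Path : List (Fin N) → Set
      Path = Linked Step

      step⇒< : ∀ {a b} → Step a b → a < b
      step⇒< {a} (c , eq) = subst (toℕ a ℕ.<_) (sym eq) (ℕ.m<m+n (toℕ a) ℕ.z<s)

      sorted : ∀ {Q} → Path Q → Sorted Q
      sorted p = Linked.Linked⇒AllPairs ℕ.<-trans (Linked.map step⇒< p)

      path-inside : ∀ xs {a} ys {b zs} → Path (xs ++ a ∷ ys ++ b ∷ zs) → Path (a ∷ ys ++ [ b ])
      path-inside xs ys p = proj₁ (linked-split (_ ∷ ys) (proj₂ (linked-split xs p)))

      path-outside : ∀ xs {a} ys {b zs} → Path (xs ++ a ∷ ys ++ b ∷ zs) → Step a b → Path (xs ++ a ∷ b ∷ zs)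
      path-outside xs ys p s with linked-split xs p
      ... | p₁ , p₂ = linked-glue xs p₁ (s ∷ proj₂ (linked-split (_ ∷ ys) p₂))

      -- Each step contributes 1 modulo k - 2, and a path has one step more than it has inner
      -- vertices.
      gap : ∀ {a b} ys → Path (a ∷ ys ++ [ b ]) → ∃[ c ] toℕ b ≡ toℕ a + suc (length ys + c * suc r)
      gap []       ((c , eq) ∷ _) = c , eq
      gap {a} (y ∷ ys) ((c , eq) ∷ p) with gap ys p
      ... | c′ , eq′ = c + c′ , trans eq′ (trans (cong (_+ _) eq)
        (solve 5 (λ x c l c′ r → x :+ (con 1 :+ c :* r) :+ (con 1 :+ (l :+ c′ :* r))
                              := x :+ (con 1 :+ (con 1 :+ l :+ (c :+ c′) :* r))) refl (toℕ a) c (length ys) c′ (suc r)))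
        where open +-*-Solver

      -- The path and the direct step both express b - a; comparing them leaves the number of inner
      -- vertices as a multiple of k - 2. The next lemma reads the comparison backwards.
      step⇒divides : ∀ {a b} ys → Path (a ∷ ys ++ [ b ]) → Step a b → suc r ∣ length ys
      step⇒divides {a} ys p (c , eq) with gap ys p
      ... | c′ , eq′ = ∣m+n∣m⇒∣n (divides c (trans (ℕ.+-comm (c′ * suc r) (length ys)) (ℕ.suc-injective (ℕ.+-cancelˡ-≡ (toℕ a) _ _ (trans (sym eq′) eq)))))
                         (n∣m*n c′)

      divides⇒step : ∀ {a b} ys → Path (a ∷ ys ++ [ b ]) → suc r ∣ length ys → Step a b
      divides⇒step {a} ys p (divides q eq) with gap ys p
      ... | c , eq′ = q + c , trans eq′ (cong (λ l → toℕ a + suc l)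
        (trans (cong (_+ c * suc r) eq) (sym (ℕ.*-distribʳ-+ (suc r) q c))))

      length-inside : ∀ (a : Fin N) ys b → length (a ∷ ys ++ [ b ]) ≡ length ys + 2
      length-inside a ys b = trans (cong suc (length-++ ys)) (sym (ℕ.+-suc (length ys) 1))

      length-outside : ∀ xs (a : Fin N) ys b zs →
        length (xs ++ a ∷ ys ++ b ∷ zs) ≡ length ys + length (xs ++ a ∷ b ∷ zs)
      length-outside xs a ys b zs = begin
        length (xs ++ a ∷ ys ++ b ∷ zs) ≡⟨ length-++ xs ⟩
        length xs + suc (length (ys ++ b ∷ zs)) ≡⟨ cong (λ l → length xs + suc l) (length-++ ys) ⟩
        length xs + suc (length ys + suc (length zs)) ≡⟨ solve 3 (λ x y z → x :+ (con 1 :+ (y :+ (con 1 :+ z))) := y :+ (x :+ (con 2 :+ z))) refl (length xs) (length ys) (length zs) ⟩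
        length ys + (length xs + suc (suc (length zs))) ≡⟨ cong (length ys +_) (length-++ xs) ⟨
        length ys + length (xs ++ a ∷ b ∷ zs) ∎
        where
        open ≡-Reasoning
        open +-*-Solver

      -- The two pieces of a cut share a and b, so the number of vertices minus 2 is additive, and
      -- every k-gon contributes k - 2.
      length-dissected : ∀ {Q ds Qs} → Dissects Q ds Qs → All Small Qs → length Q ≡ length Qs * suc r + 2
      length-dissected (whole Q) (p ∷ []) = trans p
        (solve 1 (λ r → con 2 :+ r := con 1 :* r :+ con 2) refl (suc r))
        where open +-*-Solver
      length-dissected (cut xs a ys b zs {Qs = Qs} {Qs′} _ _ D D′) p with All.++⁻ Qs p
      ... | p₁ , p₂ = begin
        length (xs ++ a ∷ ys ++ b ∷ zs) ≡⟨ length-outside xs a ys b zs ⟩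
        length ys + length (xs ++ a ∷ b ∷ zs) ≡⟨ cong₂ _+_ {length ys} (ℕ.+-cancelʳ-≡ 2 _ _ (trans (sym (length-inside a ys b)) (length-dissected D p₁)))
                                                                         (length-dissected D′ p₂) ⟩
        length Qs * suc r + (length Qs′ * suc r + 2) ≡⟨ solve 3 (λ x y r → x :* r :+ (y :* r :+ con 2) := (x :+ y) :* r :+ con 2) refl (length Qs) (length Qs′) (suc r) ⟩
        (length Qs + length Qs′) * suc r + 2 ≡⟨ cong (λ l → l * suc r + 2) (length-++ Qs) ⟨
        length (Qs ++ Qs′) * suc r + 2 ∎
        where
        open ≡-Reasoning
        open +-*-Solver

      count : ∀ {Q ds Qs} → Dissects {N} Q ds Qs → length Qs ≡ suc (length ds)
      count (whole Q) = refl
      count (cut xs a ys b zs {ds} {ds′} {Qs} {Qs′} _ _ D D′) = begin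
        length (Qs ++ Qs′) ≡⟨ length-++ Qs ⟩
        length Qs + length Qs′ ≡⟨ cong₂ _+_ (count D) (count D′) ⟩
        suc (length ds) + suc (length ds′) ≡⟨ ℕ.+-suc (suc (length ds)) (length ds′) ⟩
        suc (suc (length ds + length ds′)) ≡⟨ cong (λ n → suc (suc n)) (length-++ ds) ⟨
        suc (suc (length (ds ++ ds′)))   ∎
        where open ≡-Reasoning

      Admissible : List (Fin N) → Chord N → Set
      Admissible Q d = Diagonal Q d × Step (proj₁ d) (proj₂ d)

      dissects⇒admissible : ∀ {Q ds Qs} → Path Q → Dissects Q ds Qs → All Small Qs →
        All (Admissible Q) ds × AllPairs (λ d e → Apart d e × d ≢ e) ds
      dissects⇒admissible p (whole Q) _ = [] , []
      dissects⇒admissible p (cut xs a ys b zs {ds} {ds′} {Qs} ys≢[] xszs≢[] D D′) small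
        with All.++⁻ Qs small
      ... | small₁ , small₂ =
            ((cut-diagonal ys≢[] xszs≢[] , step) ∷ All.++⁺
              (All.map (λ (δ , s) → diagonal-mono (proj₁ ∘ inside⇒) δ , s) adm₁)
              (All.map (λ (δ , s) → diagonal-mono (proj₁ ∘ outside⇒) δ , s) adm₂))
          , (All.++⁺ (All.map (λ (δ , _) → apart-inside δ , diagonal-inside⇒ δ ∘ sym) adm₁)
                     (All.map (λ (δ , _) → apart-outside δ , diagonal-outside⇒ δ ∘ sym) adm₂)
             ∷ AllPairs.++⁺ ap₁ ap₂ (All.map (λ (δ , _) → All.map (λ (ε , _) → apart-across δ ε) adm₂) adm₁))
        where
        open Cut {xs} {a} {ys} {b} {zs} (sorted p)
        -- The `length Qs` polygons on the inner side account for `length Qs` times k - 2 vertices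
        -- between a and b. This has to be known before the recursion, since it makes the outer
        -- piece a path again.
        step : Step a b
        step = divides⇒step ys (path-inside xs ys p)
          (divides (length Qs) (ℕ.+-cancelʳ-≡ 2 _ _ (trans (sym (length-inside a ys b)) (length-dissected D small₁))))
        rec₁ = dissects⇒admissible (path-inside xs ys p) D small₁
        rec₂ = dissects⇒admissible (path-outside xs ys p step) D′ small₂
        adm₁ = proj₁ rec₁
        ap₁ = proj₂ rec₁
        adm₂ = proj₁ rec₂
        ap₂ = proj₂ rec₂

      module Extension (τ : List (Chord N))
                       (steps : ∀ {d} → d ∈ τ → Step (proj₁ d) (proj₂ d))
                       (apart : ∀ {d e} → d ∈ τ → e ∈ τ → Apart d e) where

        Extends : List (Fin N) → Set
        Extends Q = ∃[ ds ] ∃[ Qs ] Dissects Q ds Qs × All Small Qs × (∀ {d} → d ∈ τ → Diagonal Q d → d ∈ ds)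

        -- Cut along a chord of τ if one is left, and cut off a k-gon otherwise.
        extend : ∀ m → Acc ℕ._<_ m → ∀ Q → Path Q → length Q ≡ suc m * suc r + 2 → Extends Q
        extend m (acc rec) Q p len with Any.any? (diagonal? Q) τ
        ... | yes found with find found
        ... | (a , b) , ab∈ , δ with diagonal-decomposition (sorted p) δ
        ... | xs , ys , zs , refl , ys≢[] , xszs≢[] with step⇒divides ys (path-inside xs ys p) (steps ab∈)
        ... | divides zero eq = ⊥-elim (ys≢[] (length-0 ys eq))
          where
          length-0 : ∀ (us : List (Fin N)) → length us ≡ 0 → us ≡ []
          length-0 [] _ = refl
        -- Of the m + 1 k-gons, q + 1 belong to the inner piece and m - q to the outer one; the
        -- latter number is positive because a vertex lies outside a and b.
        ... | divides (suc q) eq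
            with extend q (rec q<m) (a ∷ ys ++ [ b ]) (path-inside xs ys p)
                   (trans (length-inside a ys b) (cong (_+ 2) eq))
               | extend (m ∸ suc q) (rec (ℕ.∸-monoʳ-< ℕ.z<s q<m)) (xs ++ a ∷ b ∷ zs)
                   (path-outside xs ys p (steps ab∈)) len₂
          where
          total : length (xs ++ zs) + suc q * suc r ≡ suc m * suc r
          total = ℕ.+-cancelʳ-≡ 2 _ _ (begin
            length (xs ++ zs) + suc q * suc r + 2 ≡⟨ cong₂ (λ u v → u + v + 2) (length-++ xs) (sym eq) ⟩
            length xs + length zs + length ys + 2 ≡⟨ solve 3 (λ x y z → x :+ z :+ y :+ con 2 := y :+ (x :+ (con 2 :+ z))) refl (length xs) (length ys) (length zs) ⟩
            length ys + (length xs + suc (suc (length zs))) ≡⟨ cong (length ys +_) (length-++ xs) ⟨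
            length ys + length (xs ++ a ∷ b ∷ zs) ≡⟨ length-outside xs a ys b zs ⟨
            length (xs ++ a ∷ ys ++ b ∷ zs) ≡⟨ len ⟩
            suc m * suc r + 2 ∎)
            where
            open ≡-Reasoning
            open +-*-Solver
          positive : ∀ (us : List (Fin N)) → us ≢ [] → 0 ℕ.< length us
          positive []       ≢[] = ⊥-elim (≢[] refl)
          positive (u ∷ us) _   = ℕ.z<s
          q<m : q ℕ.< m
          q<m = ℕ.≤-pred (ℕ.*-cancelʳ-< (suc r) (suc q) (suc m)
            (subst (suc q * suc r ℕ.<_) total (ℕ.m<n+m _ (positive (xs ++ zs) xszs≢[]))))
          len₂ : length (xs ++ a ∷ b ∷ zs) ≡ suc (m ∸ suc q) * suc r + 2
          len₂ = ℕ.+-cancelˡ-≡ (suc q * suc r) _ _ (begin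
            suc q * suc r + length (xs ++ a ∷ b ∷ zs) ≡⟨ cong (_+ _) (sym eq) ⟩
            length ys + length (xs ++ a ∷ b ∷ zs) ≡⟨ length-outside xs a ys b zs ⟨
            length (xs ++ a ∷ ys ++ b ∷ zs) ≡⟨ len ⟩
            suc m * suc r + 2 ≡⟨ cong (λ n → suc n * suc r + 2) (ℕ.m+[n∸m]≡n q<m) ⟨
            suc (suc q + (m ∸ suc q)) * suc r + 2 ≡⟨ solve 3 (λ q n r → (con 1 :+ (q :+ n)) :* r :+ con 2 := q :* r :+ ((con 1 :+ n) :* r :+ con 2)) refl (suc q) (m ∸ suc q) (suc r) ⟩
            suc q * suc r + (suc (m ∸ suc q) * suc r + 2) ∎)
            where
            open ≡-Reasoning
            open +-*-Solver
        ... | ds₁ , Qs₁ , D₁ , small₁ , all₁ | ds₂ , Qs₂ , D₂ , small₂ , all₂ =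
          _ , _ , cut xs a ys b zs ys≢[] xszs≢[] D₁ D₂ , All.++⁺ small₁ small₂ , contains
          where
          open Cut {xs} {a} {ys} {b} {zs} (sorted p)
          contains : ∀ {d} → d ∈ τ → Diagonal (xs ++ a ∷ ys ++ b ∷ zs) d → d ∈ (a , b) ∷ ds₁ ++ ds₂
          contains {d} d∈ δ with d ≟ᶜ (a , b)
          ... | yes refl = here refl
          ... | no d≢ with distribute δ (apart ab∈ d∈) d≢
          ... | inj₁ δ₁ = there (∈-++⁺ˡ (all₁ d∈ δ₁))
          ... | inj₂ δ₂ = there (∈-++⁺ʳ ds₁ (all₂ d∈ δ₂))
        extend zero _ Q p len | no none =
          [] , [ Q ] , whole Q , trans len (solve 1 (λ r → con 1 :* r :+ con 2 := con 2 :+ r) refl (suc r)) ∷ [] ,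
          λ d∈ δ → ⊥-elim (none (lose d∈ δ))
          where open +-*-Solver
        -- The ear is spanned by the first k vertices, from a to b. A vertex z follows b because m +
        -- 1 further k-gons have to be filled. As no chord of τ is a diagonal of Q, nothing is left
        -- to be preserved.
        extend (suc m) (acc rec) Q p len | no none with ear
          where
          take-exactly : ∀ n us {l} → length {A = Fin N} us ≡ n + l → ∃[ vs ] ∃[ ws ] us ≡ vs ++ ws × length vs ≡ n × length ws ≡ l
          take-exactly zero    us eq = [] , us , refl , refl , eq
          take-exactly (suc n) (u ∷ us) eq with take-exactly n us (ℕ.suc-injective eq)
          ... | vs , ws , refl , eq₁ , eq₂ = u ∷ vs , ws , refl , cong suc eq₁ , eq₂
          split-length : suc (suc m) * suc r + 2 ≡ suc (suc r) + (1 + suc m * suc r)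
          split-length = solve 2 (λ m r → (con 1 :+ m) :* r :+ con 2 := con 1 :+ r :+ (con 1 :+ m :* r)) refl (suc m) (suc r)
            where open +-*-Solver
          ear : ∃[ a ] ∃[ ys ] ∃[ b ] ∃[ z ] ∃[ zs ] Q ≡ a ∷ ys ++ b ∷ z ∷ zs × length ys ≡ suc r
                  × length (z ∷ zs) ≡ suc m * suc r
          ear with take-exactly (suc (suc r)) Q (trans len split-length)
          ... | a ∷ ys , b ∷ z ∷ zs , eq , eq₁ , eq₂ =
            a , ys , b , z , zs , eq , ℕ.suc-injective eq₁ , ℕ.suc-injective eq₂
        ... | a , ys , b , z , zs , refl , eq₁ , eq₂ with extend m (rec ℕ.≤-refl) (a ∷ b ∷ z ∷ zs)
                (path-outside [] ys p step) (trans (cong (2 +_) eq₂) (ℕ.+-comm 2 _))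
          where
          step : Step a b
          step = divides⇒step ys (path-inside [] ys p) (divides 1 (trans eq₁ (sym (ℕ.*-identityˡ (suc r)))))
        ... | ds , Qs , D , small , _ =
          _ , _ , cut [] a ys b (z ∷ zs) (λ { refl → case eq₁ of λ () }) (λ ()) (whole _) D ,
          trans (length-inside a ys b) (trans (cong (_+ 2) eq₁) (ℕ.+-comm (suc r) 2)) ∷ small ,
          λ d∈ δ → ⊥-elim (none (lose d∈ δ))

  module _ {N r : ℕ} where

    open Dissection {N} r

    tabulate-path : ∀ n o (f : Fin n → Fin N) → (∀ i → toℕ (f i) ≡ o + toℕ i) → Path (tabulate f)
    tabulate-path zero          o f eq = []
    tabulate-path (suc zero)    o f eq = [-]
    tabulate-path (suc (suc n)) o f eq =
      (0 , trans (eq (suc zero)) (trans (cong (_+ 1) (sym (ℕ.+-identityʳ o))) (cong (_+ 1) (sym (eq zero))))) ∷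
      tabulate-path (suc n) (suc o) (f ∘ suc) (λ i → trans (eq (suc i)) (ℕ.+-suc o (toℕ i)))

    allFin-path : Path (allFin N)
    allFin-path = tabulate-path N 0 (λ i → i) (λ _ → refl)

open Combinatorics
open import Algebra.Bundles using (RawRing)
import Algebra.Properties.Ring as RingProperties
import Algebra.Properties.Semiring.Mult as SemiringMult
import Algebra.Properties.Semiring.Sum as SemiringSum
import Algebra.Solver.Ring as RingSolver
import Algebra.Solver.Ring.AlmostCommutativeRing as ACR
open import Data.Bool.Base using (if_then_else_)
open import Data.Empty using (⊥; ⊥-elim)
open import Data.Fin.Base as Fin using (Fin; zero; suc; toℕ)
import Data.Fin.Properties as Fin
import Data.Fin.Subset as Subset
open Subset using (Subset; ⁅_⁆) renaming (_∈_ to _∈ˢ_; _∉_ to _∉ˢ_; _⊆_ to _⊆ˢ_)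
open import Data.Fin.Subset.Properties as Subset using () renaming (_∈?_ to _∈?ˢ_)
open import Data.Integer.Base using (ℤ; _⊖_; 0ℤ; 1ℤ)
import Data.Integer.Properties as ℤ
open import Data.List.Base using (List; allFin; length; lookup; map; filter)
open import Data.List.Properties using (length-tabulate)
import Data.List.Membership.Propositional as List
open import Data.List.Membership.Propositional.Properties
  using (∈-allFin; ∈-AllPairs₂; ∈-lookup; ∈-map⁺; ∈-map⁻; ∈-filter⁺; ∈-filter⁻)
import Data.List.Relation.Unary.All as All
open import Data.List.Relation.Unary.AllPairs using (AllPairs; _∷_)
import Data.List.Relation.Unary.Any as Any
import Data.List.Relation.Unary.Any.Properties as Any
open import Data.Maybe.Base using (Maybe; just; nothing)
open import Data.Nat.Base as ℕ using (ℕ; zero; suc; s≤s; s≤s⁻¹)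
open import Data.Nat.Induction using (<-wellFounded)
import Data.Nat.Properties as ℕ
open import Data.Product.Base using (Σ-syntax; ∃; ∃-syntax; _×_; _,_; proj₁; proj₂)
open import Data.Sum.Base using (_⊎_; inj₁; inj₂; [_,_]′)
open import Data.Vec.Base as Vec using ([]; _∷_; here; there)
import Data.Vec.Properties as Vec
open import Data.Vec.Functional using (updateAt) renaming (_∷_ to _◂_)
open import Data.Vec.Functional.Properties using (updateAt-updates; updateAt-minimal)
open import Function.Base using (_∘_; case_of_)
open import Function.Bundles using (_⇔_; mk⇔; Equivalence)
open import Function.Definitions using (Injective)
open import Level using (_⊔_) renaming (suc to lsuc)
open import Relation.Binary.Core using (Rel)
open import Relation.Binary.Definitions using (tri<; tri≈; tri>)
open import Relation.Binary.PropositionalEquality as ≡ using (_≡_; _≢_)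
import Relation.Binary.Reasoning.Setoid as SetoidReasoning
open import Relation.Binary.Structures using (IsDecTotalOrder)
open import Relation.Nullary using (¬_; Dec; yes; no)
open import Relation.Nullary.Decidable using (decidable-stable; does; dec-true; _×-dec_)
open import Relation.Unary using (Pred; Decidable; _∈_; _⊆_; _∩_; _≐_; Satisfiable)
open import Relation.Unary.Properties using (≐-sym; ≐-trans; ≐-refl)

-- Arithmetic in ordered fields and finite sums

module OrderedFieldProperties {c ℓ₁ ℓ₂} (𝕂 : OrderedField c ℓ₁ ℓ₂) where

  open OrderedField 𝕂 public
  open IsDecTotalOrder isDecTotalOrder public
    using (total; _≟_; antisym)
    renaming (trans to ≤-trans; refl to ≤-refl; reflexive to ≤-reflexive; ≤-respˡ-≈ to ≤-respˡ; ≤-respʳ-≈ to ≤-respʳ)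
  open RingProperties ring public using (-‿distribˡ-*; -‿distribʳ-*; -‿involutive; -0#≈0#; -‿+-comm)
  open SemiringSum semiring public hiding (sum)
  open SemiringMult semiring public using (×-homo-+; ×1-homo-*)
  open SetoidReasoning setoid

  -- Formal differences of natural numbers serve as coefficients because the
  -- zero test of the solver has to compute.
  module Solver where

    private
      infixl 6 _−_
      _−_ : ℕ → ℕ → Carrier
      m − n = m · 1# + - (n · 1#)

      differences : RawRing _ _
      differences = record
        { Carrier = ℕ × ℕ
        ; _≈_     = _≡_
        ; _+_     = λ (a , b) (c , d) → a ℕ.+ c , b ℕ.+ d
        ; _*_     = λ (a , b) (c , d) → a ℕ.* c ℕ.+ b ℕ.* d , a ℕ.* d ℕ.+ b ℕ.* c
        ; -_      = λ (a , b) → b , a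
        ; 0#      = 0 , 0
        ; 1#      = 1 , 0
        }

      interchange : ∀ a b c d → (a + b) + (c + d) ≈ (a + c) + (b + d)
      interchange a b c d = begin
        (a + b) + (c + d) ≈⟨ +-assoc a b (c + d) ⟩
        a + (b + (c + d)) ≈⟨ +-congˡ (trans (sym (+-assoc b c d)) (trans (+-congʳ (+-comm b c)) (+-assoc c b d))) ⟩
        a + (c + (b + d)) ≈⟨ +-assoc a c (b + d) ⟨
        (a + c) + (b + d) ∎

      +-homo : ∀ a b c d → (a ℕ.+ c) − (b ℕ.+ d) ≈ (a − b) + (c − d)
      +-homo a b c d = begin
        (a ℕ.+ c) · 1# + - ((b ℕ.+ d) · 1#)
          ≈⟨ +-cong (×-homo-+ 1# a c) (trans (-‿cong (×-homo-+ 1# b d)) (sym (-‿+-comm _ _))) ⟩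
        (a · 1# + c · 1#) + (- (b · 1#) + - (d · 1#)) ≈⟨ interchange _ _ _ _ ⟩
        (a − b) + (c − d) ∎

      *-difference : ∀ a b c d → (a + - b) * (c + - d) ≈ (a * c + b * d) + - (a * d + b * c)
      *-difference a b c d = begin
        (a + - b) * (c + - d) ≈⟨ distribʳ _ _ _ ⟩
        a * (c + - d) + - b * (c + - d) ≈⟨ +-cong (distribˡ _ _ _) (distribˡ _ _ _) ⟩
        (a * c + a * - d) + (- b * c + - b * - d) ≈⟨ +-congˡ (+-comm _ _) ⟩
        (a * c + a * - d) + (- b * - d + - b * c) ≈⟨ interchange _ _ _ _ ⟩
        (a * c + - b * - d) + (a * - d + - b * c) ≈⟨ +-cong (+-congˡ twice) (+-cong (sym (-‿distribʳ-* a d)) (sym (-‿distribˡ-* b c))) ⟩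
        (a * c + b * d) + (- (a * d) + - (b * c)) ≈⟨ +-congˡ (-‿+-comm _ _) ⟩
        (a * c + b * d) + - (a * d + b * c) ∎
        where
        twice : - b * - d ≈ b * d
        twice = trans (sym (-‿distribˡ-* b (- d))) (trans (-‿cong (sym (-‿distribʳ-* b d))) (-‿involutive _))

      ·-+-* : ∀ a b c d → (a ℕ.* b ℕ.+ c ℕ.* d) · 1# ≈ (a · 1#) * (b · 1#) + (c · 1#) * (d · 1#)
      ·-+-* a b c d = trans (×-homo-+ 1# (a ℕ.* b) (c ℕ.* d)) (+-cong (×1-homo-* a b) (×1-homo-* c d))

      *-homo : ∀ a b c d → (a ℕ.* c ℕ.+ b ℕ.* d) − (a ℕ.* d ℕ.+ b ℕ.* c) ≈ (a − b) * (c − d)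
      *-homo a b c d = trans (+-cong (·-+-* a c b d) (-‿cong (·-+-* a d b c))) (sym (*-difference _ _ _ _))

      -‿homo : ∀ a b → b − a ≈ - (a − b)
      -‿homo a b = begin
        b · 1# + - (a · 1#) ≈⟨ +-comm _ _ ⟩
        - (a · 1#) + b · 1# ≈⟨ +-congˡ (-‿involutive _) ⟨
        - (a · 1#) + - - (b · 1#) ≈⟨ -‿+-comm _ _ ⟩
        - (a − b) ∎

      -- Definitionally 0# and 1# at the two coefficients that occur in goals.
      ⟦_⟧ : ℕ × ℕ → Carrier
      ⟦ 0 , 0 ⟧ = 0#
      ⟦ 1 , 0 ⟧ = 1#
      ⟦ a , b ⟧ = a − b

      ⟦⟧-− : ∀ p → ⟦ p ⟧ ≈ proj₁ p − proj₂ p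
      ⟦⟧-− (0 , 0)           = sym (-‿inverseʳ 0#)
      ⟦⟧-− (0 , suc _)       = refl
      ⟦⟧-− (1 , 0)           = sym (trans (+-cong (+-identityʳ 1#) -0#≈0#) (+-identityʳ 1#))
      ⟦⟧-− (1 , suc _)       = refl
      ⟦⟧-− (suc (suc _) , _) = refl

      morphism : differences ACR.-Raw-AlmostCommutative⟶ ACR.fromCommutativeRing commutativeRing
      morphism = record
        { ⟦_⟧    = ⟦_⟧
        ; +-homo = λ p@(a , b) q@(c , d) → trans (⟦⟧-− (a ℕ.+ c , b ℕ.+ d))
            (trans (+-homo a b c d) (sym (+-cong (⟦⟧-− p) (⟦⟧-− q))))
        ; *-homo = λ p@(a , b) q@(c , d) → trans (⟦⟧-− (a ℕ.* c ℕ.+ b ℕ.* d , a ℕ.* d ℕ.+ b ℕ.* c))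
            (trans (*-homo a b c d) (sym (*-cong (⟦⟧-− p) (⟦⟧-− q))))
        ; -‿homo = λ p@(a , b) → trans (⟦⟧-− (b , a)) (trans (-‿homo a b) (sym (-‿cong (⟦⟧-− p))))
        ; 0-homo = refl
        ; 1-homo = refl
        }

      same? : ∀ p q → Maybe (⟦ p ⟧ ≈ ⟦ q ⟧)
      same? p@(a , b) q@(c , d) with a ℕ.+ d ℕ.≟ c ℕ.+ b
      ... | no  _ = nothing
      ... | yes e = just (trans (⟦⟧-− p) (trans (begin
        A + - B ≈⟨ +-identityʳ _ ⟨
        (A + - B) + 0# ≈⟨ +-congˡ (-‿inverseʳ D) ⟨
        (A + - B) + (D + - D) ≈⟨ interchange _ _ _ _ ⟩
        (A + D) + (- B + - D) ≈⟨ +-congʳ (trans (sym (×-homo-+ 1# a d)) (trans (reflexive (≡.cong (_· 1#) e)) (×-homo-+ 1# c b))) ⟩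
        (C + B) + (- B + - D) ≈⟨ trans (+-congˡ (+-comm _ _)) (interchange _ _ _ _) ⟩
        (C + - D) + (B + - B) ≈⟨ +-congˡ (-‿inverseʳ B) ⟩
        (C + - D) + 0# ≈⟨ +-identityʳ _ ⟩
        C + - D ∎) (sym (⟦⟧-− q))))
        where
        A = a · 1#
        B = b · 1#
        C = c · 1#
        D = d · 1#

    open RingSolver differences (ACR.fromCommutativeRing commutativeRing) morphism same? public
      using (solve; _:=_; _:+_; _:*_; _:-_; :-_; con; Polynomial)

    :0 :1 : ∀ {n} → Polynomial n
    :0 = con (0 , 0)
    :1 = con (1 , 0)

  open Solver

  +-mono-≤ : ∀ {w x y z} → w ≤ x → y ≤ z → w + y ≤ x + z
  +-mono-≤ {w} {x} {y} {z} p q =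
    ≤-trans (+-monoˡ-≤ y p) (≤-respˡ (+-comm y x) (≤-respʳ (+-comm z x) (+-monoˡ-≤ x q)))

  x≤y⇒0≤y-x : ∀ {x y} → x ≤ y → 0# ≤ y - x
  x≤y⇒0≤y-x {x} p = ≤-respˡ (-‿inverseʳ x) (+-monoˡ-≤ (- x) p)

  0≤y-x⇒x≤y : ∀ {x y} → 0# ≤ y - x → x ≤ y
  0≤y-x⇒x≤y {x} {y} p = ≤-respˡ (+-identityˡ x)
    (≤-respʳ (solve 2 (λ x y → y :- x :+ x := y) refl x y) (+-monoˡ-≤ x p))

  x≤0⇒0≤-x : ∀ {x} → x ≤ 0# → 0# ≤ - x
  x≤0⇒0≤-x {x} p = ≤-respʳ (+-identityˡ (- x)) (x≤y⇒0≤y-x p)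

  x-y≈0⇒x≈y : ∀ {x y} → x - y ≈ 0# → x ≈ y
  x-y≈0⇒x≈y {x} {y} p = begin
    x ≈⟨ solve 2 (λ x y → x := x :- y :+ y) refl x y ⟩
    x - y + y ≈⟨ +-congʳ p ⟩
    0# + y ≈⟨ +-identityˡ y ⟩
    y ∎

  +-nonNegative : ∀ {x y} → 0# ≤ x → 0# ≤ y → 0# ≤ x + y
  +-nonNegative p q = ≤-respˡ (+-identityˡ 0#) (+-mono-≤ p q)

  +≈0⇒ˡ : ∀ {x y} → 0# ≤ x → 0# ≤ y → x + y ≈ 0# → x ≈ 0#
  +≈0⇒ˡ {x} {y} p q e = antisym
    (≤-respˡ (+-identityʳ x) (≤-respʳ e (+-mono-≤ ≤-refl q))) p

  +≈0⇒ʳ : ∀ {x y} → 0# ≤ x → 0# ≤ y → x + y ≈ 0# → y ≈ 0#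
  +≈0⇒ʳ p q e = +≈0⇒ˡ q p (trans (+-comm _ _) e)

  +-positive : ∀ {x y} → 0# < x → 0# ≤ y → 0# < x + y
  +-positive (p , p′) q = +-nonNegative p q , λ e → p′ (sym (+≈0⇒ˡ p q (sym e)))

  ⁻¹-cancelˡ : ∀ {x} y → ¬ x ≈ 0# → x ⁻¹ * (x * y) ≈ y
  ⁻¹-cancelˡ {x} y p = begin
    x ⁻¹ * (x * y) ≈⟨ solve 3 (λ i x y → i :* (x :* y) := (x :* i) :* y) refl (x ⁻¹) x y ⟩
    (x * x ⁻¹) * y ≈⟨ *-congʳ (*-inverseʳ x p) ⟩
    1# * y ≈⟨ *-identityˡ y ⟩
    y ∎

  *≈0⇒ : ∀ {x y} → ¬ x ≈ 0# → x * y ≈ 0# → y ≈ 0#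
  *≈0⇒ {x} {y} p e = trans (sym (⁻¹-cancelˡ y p)) (trans (*-congˡ e) (zeroʳ _))

  *-positive : ∀ {x y} → 0# < x → 0# < y → 0# < x * y
  *-positive (p , p′) (q , q′) = *-nonNegative p q , λ e → q′ (sym (*≈0⇒ (p′ ∘ sym) (sym e)))

  square-nonNegative : ∀ x → 0# ≤ x * x
  square-nonNegative x with total 0# x
  ... | inj₁ p = *-nonNegative p p
  ... | inj₂ p = ≤-respʳ (solve 1 (λ x → (:- x) :* (:- x) := x :* x) refl x)
                   (*-nonNegative (x≤0⇒0≤-x p) (x≤0⇒0≤-x p))

  0<1 : 0# < 1#
  0<1 = ≤-respʳ (*-identityˡ 1#) (square-nonNegative 1#) , 0≉1

  <⇒≉ : ∀ {x} → 0# < x → ¬ x ≈ 0#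
  <⇒≉ (_ , p) e = p (sym e)

  -- The inverse equals x times its own square, a product of non-negative factors.
  ⁻¹-positive : ∀ {x} → 0# < x → 0# < x ⁻¹
  ⁻¹-positive {x} pos@(p , _) = ≤-respʳ square (*-nonNegative p (square-nonNegative (x ⁻¹))) ,
    λ e → 0≉1 (trans (sym (zeroʳ x)) (trans (*-congˡ e) (*-inverseʳ x (<⇒≉ pos))))
    where
    square : x * (x ⁻¹ * x ⁻¹) ≈ x ⁻¹
    square = trans (sym (*-assoc _ _ _)) (trans (*-congʳ (*-inverseʳ x (<⇒≉ pos))) (*-identityˡ _))

  <-respʳ : ∀ {x y} → x ≈ y → 0# < x → 0# < y
  <-respʳ e (p , p′) = ≤-respʳ e p , λ e′ → p′ (trans e′ (sym e))

  x<y⇒0<y-x : ∀ {x y} → x < y → 0# < y - x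
  x<y⇒0<y-x (p , p′) = x≤y⇒0≤y-x p , λ e → p′ (sym (x-y≈0⇒x≈y (sym e)))

  0<y-x⇒x<y : ∀ {x y} → 0# < y - x → x < y
  0<y-x⇒x<y (p , p′) = 0≤y-x⇒x≤y p , λ e → p′ (trans (sym (-‿inverseʳ _)) (+-congˡ (-‿cong (sym e))))

  ·1-positive : ∀ n → 0# < suc n · 1#
  ·1-positive zero    = <-respʳ (sym (+-identityʳ 1#)) 0<1
  ·1-positive (suc n) = +-positive 0<1 (proj₁ (·1-positive n))

  ·1-nonNegative : ∀ n → 0# ≤ n · 1#
  ·1-nonNegative zero    = ≤-refl
  ·1-nonNegative (suc n) = proj₁ (·1-positive n)

  sum-nonNegative : ∀ {n} {f : Fin n → Carrier} → (∀ i → 0# ≤ f i) → 0# ≤ sum f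
  sum-nonNegative {zero}  p = ≤-refl
  sum-nonNegative {suc n} p = +-nonNegative (p zero) (sum-nonNegative (p ∘ suc))

  sum≈0⇒ : ∀ {n} {f : Fin n → Carrier} → (∀ i → 0# ≤ f i) → sum f ≈ 0# → ∀ i → f i ≈ 0#
  sum≈0⇒ p e zero    = +≈0⇒ˡ (p zero) (sum-nonNegative (p ∘ suc)) e
  sum≈0⇒ p e (suc i) = sum≈0⇒ (p ∘ suc) (+≈0⇒ʳ (p zero) (sum-nonNegative (p ∘ suc)) e) i

  sum-zero : ∀ {n} {f : Fin n → Carrier} → (∀ i → f i ≈ 0#) → sum f ≈ 0#
  sum-zero {zero}  p = refl
  sum-zero {suc n} p = trans (+-cong (p zero) (sum-zero (p ∘ suc))) (+-identityˡ 0#)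

  sum-cong : ∀ {n} {f h : Fin n → Carrier} → (∀ i → f i ≈ h i) → sum f ≈ sum h
  sum-cong {zero}  p = refl
  sum-cong {suc n} p = +-cong (p zero) (sum-cong (p ∘ suc))

  sum-single : ∀ {n} {f : Fin n → Carrier} i → (∀ j → j ≢ i → f j ≈ 0#) → sum f ≈ f i
  sum-single {suc n} zero    p = trans (+-congˡ (sum-zero (λ j → p (suc j) λ ()))) (+-identityʳ _)
  sum-single {suc n} (suc i) p = trans (+-cong (p zero λ ()) (sum-single i (λ j j≢i → p (suc j) (j≢i ∘ Fin.suc-injective)))) (+-identityˡ _)

  sum≉0⇒ : ∀ {n} (f : Fin n → Carrier) → ¬ sum f ≈ 0# → ∃[ i ] ¬ f i ≈ 0#
  sum≉0⇒ {n} f p with Fin.all? (λ i → f i ≟ 0#)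
  ... | yes q = ⊥-elim (p (sum-zero q))
  ... | no ¬q = Fin.¬∀⟶∃¬ n _ (λ i → f i ≟ 0#) ¬q

-- Geometric crossing and interleaving of ends

module CrossingChords {c ℓ₁ ℓ₂} (𝕂 : OrderedField c ℓ₁ ℓ₂) {N : ℕ}
                      (P : Geometry.ConvexPolygon 𝕂 N) where

  open Geometry 𝕂
  open OrderedFieldProperties 𝕂
  open Solver
  open ConvexPolygon P
  open Polygon P
  open SetoidReasoning setoid

  private
    area : ∀ {n} → (pₓ pᵧ qₓ qᵧ rₓ rᵧ : Polynomial n) → Polynomial n
    area pₓ pᵧ qₓ qᵧ rₓ rᵧ = (qₓ :- pₓ) :* (rᵧ :- pᵧ) :- (qᵧ :- pᵧ) :* (rₓ :- pₓ)

  o : Fin N → Fin N → Fin N → Carrier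
  o i j l = orientation (vertex i) (vertex j) (vertex l)

  orientation-cong : ∀ p q r r′ → r ≋ r′ → orientation p q r ≈ orientation p q r′
  orientation-cong p q r r′ e = +-cong (*-congˡ (+-congʳ (e (suc zero)))) (-‿cong (*-congˡ (+-congʳ (e zero))))

  orientation-affine : ∀ p q s r r′ →
    orientation p q (λ i → (1# - s) * r i + s * r′ i) ≈ (1# - s) * orientation p q r + s * orientation p q r′
  orientation-affine p q s r r′ =
    solve 9 (λ pₓ pᵧ qₓ qᵧ rₓ rᵧ rₓ′ rᵧ′ s →
      area pₓ pᵧ qₓ qᵧ ((:1 :- s) :* rₓ :+ s :* rₓ′) ((:1 :- s) :* rᵧ :+ s :* rᵧ′)
      := (:1 :- s) :* area pₓ pᵧ qₓ qᵧ rₓ rᵧ :+ s :* area pₓ pᵧ qₓ qᵧ rₓ′ rᵧ′)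
      refl (p zero) (p (suc zero)) (q zero) (q (suc zero)) (r zero) (r (suc zero)) (r′ zero) (r′ (suc zero)) s

  orientation-rotate : ∀ p q r → orientation p q r ≈ orientation r p q
  orientation-rotate p q r =
    solve 6 (λ a b c d e f → area a b c d e f := area e f a b c d) refl
      (p zero) (p (suc zero)) (q zero) (q (suc zero)) (r zero) (r (suc zero))

  orientation-swap : ∀ p q r → orientation p q r ≈ - orientation p r q
  orientation-swap p q r =
    solve 6 (λ a b c d e f → area a b c d e f := :- area a b e f c d) refl
      (p zero) (p (suc zero)) (q zero) (q (suc zero)) (r zero) (r (suc zero))

  orientation-source : ∀ p q → orientation p q p ≈ 0#
  orientation-source p q = solve 4 (λ a b c d → area a b c d a b := :0) refl
      (p zero) (p (suc zero)) (q zero) (q (suc zero))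

  orientation-target : ∀ p q → orientation p q q ≈ 0#
  orientation-target p q = solve 4 (λ a b c d → area a b c d c d := :0) refl
      (p zero) (p (suc zero)) (q zero) (q (suc zero))

  -- Both sides are twice the signed area of the quadrilateral a c b d, cut along c d on the left
  -- and along a b on the right.
  quadrilateral : ∀ a b c d → orientation c b d + orientation a c d ≈ orientation a b d + orientation a c b
  quadrilateral a b c d =
    solve 8 (λ a a′ b b′ c c′ d d′ → area c c′ b b′ d d′ :+ area a a′ c c′ d d′ := area a a′ b b′ d d′ :+ area a a′ c c′ b b′)
      refl (a zero) (a (suc zero)) (b zero) (b (suc zero)) (c zero) (c (suc zero)) (d zero) (d (suc zero))

  -- The affine dependence of four points in the plane: the coefficient of each point is, up to
  -- sign, the signed area of the triangle formed by the other three.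
  intersection : ∀ a b c d i → orientation c b d * a i + orientation a c d * b i
                             ≈ orientation a b d * c i + orientation a c b * d i
  intersection a b c d zero =
    solve 8 (λ a a′ b b′ c c′ d d′ → area c c′ b b′ d d′ :* a :+ area a a′ c c′ d d′ :* b
                                  := area a a′ b b′ d d′ :* c :+ area a a′ c c′ b b′ :* d)
      refl (a zero) (a (suc zero)) (b zero) (b (suc zero)) (c zero) (c (suc zero)) (d zero) (d (suc zero))
  intersection a b c d (suc zero) =
    solve 8 (λ a a′ b b′ c c′ d d′ → area c c′ b b′ d d′ :* a′ :+ area a a′ c c′ d d′ :* b′
                                  := area a a′ b b′ d d′ :* c′ :+ area a a′ c c′ b b′ :* d′)
      refl (a zero) (a (suc zero)) (b zero) (b (suc zero)) (c zero) (c (suc zero)) (d zero) (d (suc zero))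

  -- Convexity makes all four coefficients of `intersection` positive, so that its two sides are
  -- multiples of points in the two relative interiors.
  interleaved⇒crossing : ∀ {a b c d} → Interleaved (a , b) (c , d) → Crossing (a , b) (c , d)
  interleaved⇒crossing {a} {b} {c} {d} (a<c , c<b , b<d) =
    x , (s , 0<s , s<1 , λ _ → refl) , (s′ , 0<s′ , s′<1 , other)
    where
    A = o c b d
    B = o a c d
    C = o a b d
    D = o a c b
    0<A : 0# < A
    0<A = convex c<b b<d
    0<B : 0# < B
    0<B = convex a<c (ℕ.<-trans c<b b<d)
    0<C : 0# < C
    0<C = convex (ℕ.<-trans a<c c<b) b<d
    0<D : 0# < D
    0<D = convex a<c c<b
    -- By `quadrilateral` this is also C + D, so dividing by it normalises both sides of
    -- `intersection` at once.
    T = A + B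
    T⁻¹ = T ⁻¹
    0<T : 0# < T
    0<T = +-positive 0<A (proj₁ 0<B)
    0<T⁻¹ : 0# < T⁻¹
    0<T⁻¹ = ⁻¹-positive 0<T
    T*T⁻¹ : T * T⁻¹ ≈ 1#
    T*T⁻¹ = *-inverseʳ T (<⇒≉ 0<T)
    s  = B * T⁻¹
    s′ = D * T⁻¹
    1-s : 1# - s ≈ A * T⁻¹
    1-s = trans (+-congʳ (sym T*T⁻¹)) (solve 3 (λ a b t → (a :+ b) :* t :- b :* t := a :* t) refl A B T⁻¹)
    1-s′ : 1# - s′ ≈ C * T⁻¹
    1-s′ = trans (+-congʳ (trans (sym T*T⁻¹) (*-congʳ (quadrilateral (vertex a) (vertex b) (vertex c) (vertex d)))))
      (solve 3 (λ a b t → (a :+ b) :* t :- b :* t := a :* t) refl C D T⁻¹)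
    0<s : 0# < s
    0<s = *-positive 0<B 0<T⁻¹
    0<s′ : 0# < s′
    0<s′ = *-positive 0<D 0<T⁻¹
    s<1 : s < 1#
    s<1 = 0<y-x⇒x<y (<-respʳ (sym 1-s) (*-positive 0<A 0<T⁻¹))
    s′<1 : s′ < 1#
    s′<1 = 0<y-x⇒x<y (<-respʳ (sym 1-s′) (*-positive 0<C 0<T⁻¹))
    x : Plane
    x i = (1# - s) * vertex a i + s * vertex b i
    combine : ∀ u v w y z → 1# - v ≈ u * T⁻¹ → v ≡ w * T⁻¹ → (1# - v) * y + v * z ≈ T⁻¹ * (u * y + w * z)
    combine u v w y z e ≡.refl = trans (+-congʳ (*-congʳ e))
      (solve 5 (λ u w t y z → u :* t :* y :+ w :* t :* z := t :* (u :* y :+ w :* z)) refl u w T⁻¹ y z)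
    other : ∀ i → x i ≈ (1# - s′) * vertex c i + s′ * vertex d i
    other i = begin
      (1# - s) * vertex a i + s * vertex b i ≈⟨ combine A s B _ _ 1-s ≡.refl ⟩
      T⁻¹ * (A * vertex a i + B * vertex b i) ≈⟨ *-congˡ (intersection (vertex a) (vertex b) (vertex c) (vertex d) i) ⟩
      T⁻¹ * (C * vertex c i + D * vertex d i) ≈⟨ combine C s′ D _ _ 1-s′ ≡.refl ⟨
      (1# - s′) * vertex c i + s′ * vertex d i ∎

  crossing-sym : ∀ {d e} → Crossing d e → Crossing e d
  crossing-sym (x , p , q) = x , q , p

  ¬crossing⇒apart : ∀ {d e} → ¬ Crossing d e → Apart d e
  ¬crossing⇒apart ¬c = (λ i → ¬c (interleaved⇒crossing i)) , (λ i → ¬c (crossing-sym (interleaved⇒crossing i)))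

  -- Unless the chords interleave, c and d lie weakly on one side of the line
  -- through a and b; at a crossing their weighted orientations cancel, so that
  -- both lie on the line.
  private
    crossing⇒balanced : ∀ {a b c d} → Crossing (a , b) (c , d) →
      ∃[ s ] 0# < s × 0# < 1# - s × (1# - s) * o a b c + s * o a b d ≈ 0#
    crossing⇒balanced {a} {b} {c} {d} (x , (s , _ , _ , e) , (s′ , 0<s′ , s′<1 , e′)) =
      s′ , 0<s′ , x<y⇒0<y-x s′<1 , (begin
        (1# - s′) * o a b c + s′ * o a b d ≈⟨ orientation-affine p q s′ (vertex c) (vertex d) ⟨
        orientation p q cd ≈⟨ orientation-cong p q cd ab (λ i → trans (sym (e′ i)) (e i)) ⟩
        orientation p q ab ≈⟨ orientation-affine p q s p q ⟩
        (1# - s) * o a b a + s * o a b b ≈⟨ +-cong (*-congˡ (orientation-source p q)) (*-congˡ (orientation-target p q)) ⟩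
        (1# - s) * 0# + s * 0# ≈⟨ +-cong (zeroʳ _) (zeroʳ _) ⟩
        0# + 0# ≈⟨ +-identityʳ 0# ⟩
        0# ∎)
      where
      p q ab cd : Plane
      p = vertex a
      q = vertex b
      ab i = (1# - s) * p i + s * q i
      cd i = (1# - s′) * vertex c i + s′ * vertex d i

    NonZeroUnless : Carrier → Fin N → Fin N → Fin N → Set _
    NonZeroUnless u a b e = 0# ≤ u × (u ≈ 0# → e ≡ a ⊎ e ≡ b)

    outside : ∀ {a b e} → a Fin.< b → e Fin.≤ a ⊎ b Fin.≤ e → NonZeroUnless (o a b e) a b e
    outside {a} {b} {e} a<b p with e Fin.≟ a | e Fin.≟ b
    ... | yes ≡.refl | _ = ≤-reflexive (sym (orientation-source (vertex a) (vertex b))) , λ _ → inj₁ ≡.refl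
    ... | no _ | yes ≡.refl = ≤-reflexive (sym (orientation-target (vertex a) (vertex b))) , λ _ → inj₂ ≡.refl
    outside {a} {b} {e} a<b (inj₁ e≤a) | no e≢a | no _ =
      proj₁ pos , λ z → ⊥-elim (<⇒≉ pos z)
      where
      pos : 0# < o a b e
      pos = <-respʳ (sym (orientation-rotate (vertex a) (vertex b) (vertex e))) (convex (Fin.≤∧≢⇒< e≤a e≢a) a<b)
    outside {a} {b} {e} a<b (inj₂ b≤e) | no _ | no e≢b =
      proj₁ pos , λ z → ⊥-elim (<⇒≉ pos z)
      where
      pos : 0# < o a b e
      pos = convex a<b (Fin.≤∧≢⇒< b≤e (e≢b ∘ ≡.sym))

    inside : ∀ {a b e} → a Fin.≤ e → e Fin.≤ b → NonZeroUnless (- o a b e) a b e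
    inside {a} {b} {e} a≤e e≤b with e Fin.≟ a | e Fin.≟ b
    ... | yes ≡.refl | _ = ≤-reflexive (sym (trans (-‿cong (orientation-source (vertex a) (vertex b))) -0#≈0#)) , λ _ → inj₁ ≡.refl
    ... | no _ | yes ≡.refl = ≤-reflexive (sym (trans (-‿cong (orientation-target (vertex a) (vertex b))) -0#≈0#)) , λ _ → inj₂ ≡.refl
    ... | no e≢a | no e≢b = proj₁ pos , λ z → ⊥-elim (<⇒≉ pos z)
      where
      pos : 0# < - o a b e
      pos = <-respʳ (trans (sym (-‿involutive _)) (-‿cong (sym (orientation-swap (vertex a) (vertex b) (vertex e)))))
        (convex (Fin.≤∧≢⇒< a≤e (e≢a ∘ ≡.sym)) (Fin.≤∧≢⇒< e≤b e≢b))

    common-endpoints : ∀ {a b c d : Fin N} → a Fin.< b → c Fin.< d →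
                       c ≡ a ⊎ c ≡ b → d ≡ a ⊎ d ≡ b → (a , b) ≡ (c , d)
    common-endpoints _   _   (inj₁ ≡.refl) (inj₂ ≡.refl) = ≡.refl
    common-endpoints _   c<d (inj₁ ≡.refl) (inj₁ ≡.refl) = ⊥-elim (ℕ.<-irrefl ≡.refl c<d)
    common-endpoints _   c<d (inj₂ ≡.refl) (inj₂ ≡.refl) = ⊥-elim (ℕ.<-irrefl ≡.refl c<d)
    common-endpoints a<b c<d (inj₂ ≡.refl) (inj₁ ≡.refl) = ⊥-elim (ℕ.<-asym a<b c<d)

    same-side : ∀ {a b c d s u v} → a Fin.< b → c Fin.< d → 0# < s → 0# < 1# - s →
      (1# - s) * u + s * v ≈ 0# → NonZeroUnless u a b c → NonZeroUnless v a b d → (a , b) ≡ (c , d)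
    same-side {s = s} {u} {v} a<b c<d 0<s 0<1-s e (p , p′) (q , q′) = common-endpoints a<b c<d
      (p′ (*≈0⇒ (<⇒≉ 0<1-s) (+≈0⇒ˡ 0≤u 0≤v e)))
      (q′ (*≈0⇒ (<⇒≉ 0<s) (+≈0⇒ʳ 0≤u 0≤v e)))
      where
      0≤u : 0# ≤ (1# - s) * u
      0≤u = *-nonNegative (proj₁ 0<1-s) p
      0≤v : 0# ≤ s * v
      0≤v = *-nonNegative (proj₁ 0<s) q

  apart⇒¬crossing : ∀ {a b c d} → a Fin.< b → c Fin.< d → (a , b) ≢ (c , d) →
                    Apart (a , b) (c , d) → ¬ Crossing (a , b) (c , d)
  apart⇒¬crossing {a} {b} {c} {d} a<b c<d ≢ (¬i , ¬i′) crossing =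
    decide (a Fin.<? c) (c Fin.<? b) (a Fin.<? d) (d Fin.<? b)
    where
    balanced = crossing⇒balanced crossing
    s = proj₁ balanced
    0<s : 0# < s
    0<s = proj₁ (proj₂ balanced)
    0<1-s : 0# < 1# - s
    0<1-s = proj₁ (proj₂ (proj₂ balanced))
    e : (1# - s) * o a b c + s * o a b d ≈ 0#
    e = proj₂ (proj₂ (proj₂ balanced))
    both-inside : a Fin.≤ c → d Fin.≤ b → ⊥
    both-inside a≤c d≤b = ≢ (same-side a<b c<d 0<s 0<1-s
      (trans (solve 3 (λ s u v → (:1 :- s) :* (:- u) :+ s :* (:- v) := :- ((:1 :- s) :* u :+ s :* v)) refl s (o a b c) (o a b d))
             (trans (-‿cong e) -0#≈0#))
      (inside a≤c (ℕ.≤-trans (ℕ.<⇒≤ c<d) d≤b)) (inside (ℕ.≤-trans a≤c (ℕ.<⇒≤ c<d)) d≤b))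
    both-outside : c Fin.≤ a ⊎ b Fin.≤ c → d Fin.≤ a ⊎ b Fin.≤ d → ⊥
    both-outside p q = ≢ (same-side a<b c<d 0<s 0<1-s e (outside a<b p) (outside a<b q))
    not-between : ∀ {x} → Dec (a Fin.< x) → Dec (x Fin.< b) → (a Fin.< x × x Fin.< b) ⊎ (x Fin.≤ a ⊎ b Fin.≤ x)
    not-between (no p)  _       = inj₂ (inj₁ (ℕ.≮⇒≥ p))
    not-between (yes p) (no q)  = inj₂ (inj₂ (ℕ.≮⇒≥ q))
    not-between (yes p) (yes q) = inj₁ (p , q)
    decide : Dec (a Fin.< c) → Dec (c Fin.< b) → Dec (a Fin.< d) → Dec (d Fin.< b) → ⊥
    decide p q p′ q′ with not-between p q | not-between p′ q′
    -- One end strictly between a and b forces the other one into the closed interval, since the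
    -- chords are apart.
    ... | inj₁ (a<c , c<b) | _ = both-inside (ℕ.<⇒≤ a<c) (ℕ.≮⇒≥ (λ b<d → ¬i (a<c , c<b , b<d)))
    ... | inj₂ _ | inj₁ (a<d , d<b) = both-inside (ℕ.≮⇒≥ (λ c<a → ¬i′ (c<a , a<d , d<b))) (ℕ.<⇒≤ d<b)
    ... | inj₂ p | inj₂ q = both-outside p q

-- Auxiliary facts on subsets and lists

module _ {n p} {P : Pred (Fin n) p} (P? : Decidable P) where

  comprehension : Subset n
  comprehension = Vec.tabulate (λ i → does (P? i))

  ∈-comprehension⁺ : ∀ {i} → P i → i ∈ˢ comprehension
  ∈-comprehension⁺ {i} p = Vec.lookup⇒[]= i comprehension
    (≡.trans (Vec.lookup∘tabulate _ i) (dec-true (P? i) p))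

  ∈-comprehension⁻ : ∀ {i} → i ∈ˢ comprehension → P i
  ∈-comprehension⁻ {i} i∈ with P? i in eq
  ... | yes p = p
  ... | no ¬p = case ≡.trans (≡.sym (≡.trans (Vec.lookup∘tabulate _ i) (≡.cong does eq))) (Vec.[]=⇒lookup i∈) of λ ()

module _ {a} {A : Set a} {ℓ} {R : A → A → Set ℓ} where

  allPairs-lookup : ∀ {xs} → AllPairs R xs → ∀ {i j} → toℕ i ℕ.< toℕ j → R (lookup xs i) (lookup xs j)
  allPairs-lookup (p ∷ _) {zero}  {suc j} _          = All.lookup p (∈-lookup j)
  allPairs-lookup (_ ∷ q) {suc i} {suc j} (ℕ.s≤s i<j) = allPairs-lookup q i<j

-- Cliques of the graph of allowable diagonals

module DiagonalGraph {c ℓ₁ ℓ₂} (𝕂 : OrderedField c ℓ₁ ℓ₂) (r g : ℕ)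
  (P : Geometry.ConvexPolygon 𝕂 (Geometry.size 𝕂 (suc (suc (suc r))) (suc g))) {h : ℕ}
  (δ : Geometry.Enumeration 𝕂 (suc (suc (suc r))) (suc g) P h) where

  open Geometry 𝕂 hiding (μ)
  open Polygon P
  open Enumeration δ
  open Complexes P δ using (I)
  open CrossingChords 𝕂 P using (¬crossing⇒apart; apart⇒¬crossing; crossing-sym)

  private
    k m N : ℕ
    k = suc (suc (suc r))
    m = suc g
    N = size k m

  open Dissection {N} r

  I-sym : ∀ {u v} → I u v → I v u
  I-sym (u≢v , ¬c) = u≢v ∘ ≡.sym , ¬c ∘ crossing-sym

  I-irrefl : ∀ {u} → ¬ I u u
  I-irrefl (u≢u , _) = u≢u ≡.refl

  Enumerates : (Fin g → Fin h) → List (Chord N) → Set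
  Enumerates d ds = ∀ c → (∃[ i ] diagonal (d i) ≡ c) ⇔ c List.∈ ds

  record Dissecting (d : Fin g → Fin h) : Set ℓ where
    field
      chords      : List (Chord N)
      dissection  : IsDissection k m chords
      enumerates  : Enumerates d chords
      adjacent    : ∀ {i j} → i ≢ j → I (d i) (d j)

  -- By `count`, m polygons arise from g = m - 1 cuts, and the chords of a dissection are pairwise
  -- distinct; positions in the list therefore give an injective family indexed by `Fin g`.
  dissecting : ∀ {ds} → (dis : IsDissection k m ds) → Σ[ d ∈ (Fin g → Fin h) ] Dissecting d × Enumerates d ds
  dissecting {ds} dis@(noncrossing , Qs , D , length-Qs , small) = d , record
    { chords = ds
    ; dissection = dis
    ; enumerates = enum
    ; adjacent = adj
    } , enum
    where
    length-ds : g ≡ length ds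
    length-ds = ℕ.suc-injective (≡.trans (≡.sym length-Qs) (count D))
    pos : Fin g → Fin (length ds)
    pos = Fin.cast length-ds
    v : ∀ i → ∃[ v ] diagonal v ≡ lookup ds (pos i)
    v i = complete (ds , dis , ∈-lookup (pos i))
    d : Fin g → Fin h
    d i = proj₁ (v i)
    distinct : ∀ {i j : Fin (length ds)} → i ≢ j → lookup ds i ≢ lookup ds j
    distinct {i} {j} i≢j with Fin.<-cmp i j
    ... | tri< i<j _ _ = proj₂ (allPairs-lookup (proj₂ (dissects⇒admissible allFin-path D small)) i<j)
    ... | tri≈ _ i≡j _ = ⊥-elim (i≢j i≡j)
    ... | tri> _ _ j<i = proj₂ (allPairs-lookup (proj₂ (dissects⇒admissible allFin-path D small)) j<i) ∘ ≡.sym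
    pos-injective : ∀ {i j} → pos i ≡ pos j → i ≡ j
    pos-injective {i} {j} e = Fin.toℕ-injective
      (≡.trans (≡.sym (Fin.toℕ-cast length-ds i)) (≡.trans (≡.cong toℕ e) (Fin.toℕ-cast length-ds j)))
    distinct-d : ∀ {i j} → i ≢ j → diagonal (d i) ≢ diagonal (d j)
    distinct-d {i} {j} i≢j e = distinct (i≢j ∘ pos-injective)
      (≡.trans (≡.sym (proj₂ (v i))) (≡.trans e (proj₂ (v j))))
    inj : Injective _≡_ _≡_ d
    inj {i} {j} e with i Fin.≟ j
    ... | yes p = p
    ... | no ¬p = ⊥-elim (distinct-d ¬p (≡.cong diagonal e))
    member : ∀ i → diagonal (d i) List.∈ ds
    member i = ≡.subst (List._∈ ds) (≡.sym (proj₂ (v i))) (∈-lookup (pos i))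
    adj : ∀ {i j} → i ≢ j → I (d i) (d j)
    adj {i} {j} i≢j = i≢j ∘ inj , noncrossing (member i) (member j) (distinct-d i≢j)
    enum : Enumerates d ds
    enum c = mk⇔ (λ { (i , ≡.refl) → member i }) index
      where
      index : c List.∈ ds → ∃[ i ] diagonal (d i) ≡ c
      index c∈ = i , ≡.trans (proj₂ (v i)) (≡.trans (≡.cong (lookup ds) back) (≡.sym (Any.lookup-index c∈)))
        where
        i = Fin.cast (≡.sym length-ds) (Any.index c∈)
        back : pos i ≡ Any.index c∈
        back = Fin.toℕ-injective (≡.trans (Fin.toℕ-cast length-ds i) (Fin.toℕ-cast (≡.sym length-ds) _))

  admissible : ∀ v → Admissible (allFin N) (diagonal v)
  admissible v with allowable v
  ... | ds , (_ , Qs , D , _ , small) , v∈ =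
    All.lookup (proj₁ (dissects⇒admissible allFin-path D small)) v∈

  Clique : Subset h → Set ℓ
  Clique τ = ∀ {u v} → u ∈ˢ τ → v ∈ˢ τ → u ≢ v → I u v

  -- The hypotheses of `Extension` hold for the chords of τ: allowability supplies the congruence of
  -- the ends, and the absence of crossings makes them apart.
  clique-extends : ∀ {τ} → Clique τ →
    Σ[ d ∈ (Fin g → Fin h) ] Dissecting d × (∀ {v} → v ∈ˢ τ → ∃[ i ] d i ≡ v)
  clique-extends {τ} clique = proj₁ result , proj₁ (proj₂ result) , λ {v} v∈ →
    let i , e = Equivalence.from (proj₂ (proj₂ result) (diagonal v)) (contains v∈) in i , injective e
    where
    chords : List (Chord N)
    chords = map diagonal (filter (_∈?ˢ τ) (allFin h))
    from : ∀ {c} → c List.∈ chords → ∃[ v ] v ∈ˢ τ × c ≡ diagonal v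
    from c∈ with ∈-map⁻ diagonal c∈
    ... | v , v∈ , e = v , proj₂ (∈-filter⁻ (_∈?ˢ τ) {xs = allFin h} v∈) , e
    steps : ∀ {c} → c List.∈ chords → Step (proj₁ c) (proj₂ c)
    steps c∈ with from c∈
    ... | v , _ , ≡.refl = proj₂ (admissible v)
    apart : ∀ {c e} → c List.∈ chords → e List.∈ chords → Apart c e
    apart c∈ e∈ with from c∈ | from e∈
    ... | u , u∈ , ≡.refl | v , v∈ , ≡.refl with u Fin.≟ v
    ... | yes ≡.refl = apart-refl {N} {diagonal u}
    ... | no u≢v = ¬crossing⇒apart (proj₂ (clique u∈ v∈ u≢v))
    open Extension chords steps apart
    length-allFin : length (allFin N) ≡ suc g ℕ.* suc r ℕ.+ 2
    length-allFin = length-tabulate (λ i → i)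
    extension : Extends (allFin N)
    extension = extend g (<-wellFounded g) (allFin N) allFin-path length-allFin
    ds = proj₁ extension
    Qs = proj₁ (proj₂ extension)
    D  = proj₁ (proj₂ (proj₂ extension))
    small = proj₁ (proj₂ (proj₂ (proj₂ extension)))
    -- The extension does not record how many polygons it produces; the number of vertices
    -- determines it after k - 2 = r + 1 is cancelled.
    length-Qs : length Qs ≡ m
    length-Qs = ℕ.*-cancelʳ-≡ _ _ (suc r) (ℕ.+-cancelʳ-≡ 2 _ _ (≡.trans (≡.sym (length-dissected D small)) length-allFin))
    contains : ∀ {v} → v ∈ˢ τ → diagonal v List.∈ ds
    contains {v} v∈ = proj₂ (proj₂ (proj₂ (proj₂ extension)))
      (∈-map⁺ diagonal (∈-filter⁺ (_∈?ˢ τ) (∈-allFin v) v∈)) (proj₁ (admissible v))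
    adm = dissects⇒admissible allFin-path D small
    noncrossing : ∀ {c e} → c List.∈ ds → e List.∈ ds → c ≢ e → ¬ Crossing c e
    noncrossing c∈ e∈ c≢e = apart⇒¬crossing (ordered (proj₁ (All.lookup (proj₁ adm) c∈)))
      (ordered (proj₁ (All.lookup (proj₁ adm) e∈))) c≢e (either c≢e (∈-AllPairs₂ (proj₂ adm) c∈ e∈))
      where
      either : ∀ {c e : Chord N} → c ≢ e →
        c ≡ e ⊎ (Apart c e × c ≢ e) ⊎ (Apart e c × e ≢ c) → Apart c e
      either c≢e (inj₁ c≡e) = ⊥-elim (c≢e c≡e)
      either c≢e (inj₂ (inj₁ (a , _))) = a
      either c≢e (inj₂ (inj₂ (a , _))) = apart-sym a
    isDissection : IsDissection k m ds
    isDissection = noncrossing , Qs , D , length-Qs , small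
    result = dissecting isDissection

  -- The clique is contained in the g-element family of some dissection, which gives an injection of
  -- its indices into `Fin g`.
  clique-bound : ∀ {n} (f : Fin n → Fin h) → (∀ {i j} → i ≢ j → I (f i) (f j)) → n ℕ.≤ g
  clique-bound {n} f adj = bound (clique-extends clique)
    where
    in-range? : ∀ v → Dec (∃[ i ] f i ≡ v)
    in-range? v = Fin.any? (λ i → f i Fin.≟ v)
    f-injective : ∀ {i j} → f i ≡ f j → i ≡ j
    f-injective {i} {j} e with i Fin.≟ j
    ... | yes p = p
    ... | no i≢j = ⊥-elim (proj₁ (adj i≢j) e)
    clique : Clique (comprehension in-range?)
    clique {u} {v} u∈ v∈ u≢v = related (∈-comprehension⁻ in-range? u∈) (∈-comprehension⁻ in-range? v∈)
      where
      related : ∃[ i ] f i ≡ u → ∃[ j ] f j ≡ v → I u v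
      related (i , ≡.refl) (j , ≡.refl) = adj (λ { ≡.refl → u≢v ≡.refl })
    bound : (Σ[ d ∈ (Fin g → Fin h) ] Dissecting d ×
              (∀ {v} → v ∈ˢ comprehension in-range? → ∃[ i ] d i ≡ v)) → n ℕ.≤ g
    bound (d , _ , covers) = Fin.injective⇒≤ {f = λ i → proj₁ (index i)} λ {i} {j} e →
      f-injective (≡.trans (≡.sym (proj₂ (index i))) (≡.trans (≡.cong d e) (proj₂ (index j))))
      where
      index : ∀ i → ∃[ j ] d j ≡ f i
      index i = covers (∈-comprehension⁺ in-range? (i , ≡.refl))

-- Convex hulls in coordinates

module Convexity {c ℓ₁ ℓ₂} (𝕂 : OrderedField c ℓ₁ ℓ₂) where

  open Geometry 𝕂
  open OrderedFieldProperties 𝕂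
  open Solver using (solve; _:=_; _:*_)
  open SetoidReasoning setoid

  -- conv A is Cone A 1#.
  Cone : ∀ {I a} → Pred (Point I) a → Carrier → Point I → Set (ℓ ⊔ a)
  Cone A w x = ∃[ n ] Σ[ v ∈ (Fin n → Point _) ] Σ[ t ∈ (Fin n → Carrier) ]
    (∀ j → v j ∈ A) × (∀ j → 0# ≤ t j) × sum t ≈ w × x ≋ combination t v

  module _ {I : Set} {a} {A : Pred (Point I) a} where

    cone-resp : ∀ {w w′ x x′} → w ≈ w′ → x ≋ x′ → Cone A w x → Cone A w′ x′
    cone-resp e e′ (n , v , t , v∈ , t≥ , s , p) =
      n , v , t , v∈ , t≥ , trans s e , λ i → trans (sym (e′ i)) (p i)

    cone-zero : ∀ {w x} → w ≈ 0# → (∀ i → x i ≈ 0#) → Cone A w x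
    cone-zero e p = 0 , (λ ()) , (λ ()) , (λ ()) , (λ ()) , sym e , p

    cone-generator : ∀ {w v x} → 0# ≤ w → v ∈ A → (∀ i → x i ≈ w * v i) → Cone A w x
    cone-generator {w} {v} w≥ v∈ e = 1 , (λ _ → v) , (λ _ → w) , (λ _ → v∈) , (λ _ → w≥) ,
      +-identityʳ w , λ i → trans (e i) (sym (+-identityʳ _))

    cone-+ : ∀ {w w′ x x′} → Cone A w x → Cone A w′ x′ → Cone A (w + w′) (λ i → x i + x′ i)
    cone-+ {w′ = w′} {x′ = x′} (n , v , t , v∈ , t≥ , s , p) C′ =
      cone-resp (+-congʳ s) (λ i → +-congʳ (sym (p i))) (extend n v t v∈ t≥)
      where
      extend : ∀ n (v : Fin n → Point I) (t : Fin n → Carrier) → (∀ j → v j ∈ A) → (∀ j → 0# ≤ t j) →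
        Cone A (sum t + w′) (λ i → combination t v i + x′ i)
      extend zero v t _ _ = cone-resp (sym (+-identityˡ _)) (λ i → sym (+-identityˡ _)) C′
      extend (suc n) v t v∈ t≥ with extend n (v ∘ suc) (t ∘ suc) (v∈ ∘ suc) (t≥ ∘ suc)
      ... | n″ , v″ , t″ , v″∈ , t″≥ , s″ , p″ =
        suc n″ , v zero ◂ v″ , t zero ◂ t″ ,
        (λ { zero → v∈ zero ; (suc j) → v″∈ j }) ,
        (λ { zero → t≥ zero ; (suc j) → t″≥ j }) ,
        trans (+-congˡ s″) (sym (+-assoc _ _ _)) ,
        λ i → trans (+-assoc _ _ _) (+-congˡ (p″ i))

    cone-scale : ∀ {w x} s → 0# ≤ s → Cone A w x → Cone A (s * w) (λ i → s * x i)
    cone-scale s s≥ (n , v , t , v∈ , t≥ , e , p) =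
      n , v , (λ j → s * t j) , v∈ , (λ j → *-nonNegative s≥ (t≥ j)) ,
      trans (sym (*-distribˡ-sum s t)) (*-congˡ e) ,
      λ i → trans (*-congˡ (p i)) (trans (*-distribˡ-sum s (λ j → t j * v j i)) (sum-cong (λ j → sym (*-assoc s (t j) (v j i)))))

    -- A point of a hull can be assembled from pieces whose masses only have to add up to 1; pieces
    -- of mass 0 are allowed, so none of them is ever normalised.
    cone-∑ : ∀ {n} {w : Fin n → Carrier} {x : Fin n → Point I} → (∀ j → Cone A (w j) (x j)) →
             Cone A (sum w) (λ i → sum (λ j → x j i))
    cone-∑ {zero}  _ = cone-zero refl (λ _ → refl)
    cone-∑ {suc n} C = cone-+ (C zero) (cone-∑ (C ∘ suc))

    conv-⊇ : A ⊆ conv A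
    conv-⊇ x∈ = cone-generator (proj₁ 0<1) x∈ (λ i → sym (*-identityˡ _))

    conv-resp : ∀ {x x′} → x ≋ x′ → x ∈ conv A → x′ ∈ conv A
    conv-resp = cone-resp {1#} refl

    conv-combination : ∀ {n} {t : Fin n → Carrier} {v : Fin n → Point I} →
      (∀ j → 0# ≤ t j) → sum t ≈ 1# → (∀ j → v j ∈ conv A) → combination t v ∈ conv A
    conv-combination {t = t} t≥ s v∈ = cone-resp
      (trans (sum-cong (λ j → *-identityʳ (t j))) s) (λ _ → refl)
      (cone-∑ (λ j → cone-scale (t j) (t≥ j) (v∈ j)))

  module _ {I : Set} {a b} {A : Pred (Point I) a} {B : Pred (Point I) b} where

    conv-least : A ⊆ conv B → conv A ⊆ conv B
    conv-least A⊆B (n , v , t , v∈ , t≥ , s , p) =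
      conv-resp {A = B} (λ i → sym (p i)) (conv-combination {A = B} t≥ s (λ j → A⊆B (v∈ j)))

    conv-mono : A ⊆ B → conv A ⊆ conv B
    conv-mono A⊆B = conv-least (λ x∈ → conv-⊇ {A = B} (A⊆B x∈))

  weighted-nonNegative : ∀ {n} {t f : Fin n → Carrier} →
    (∀ j → 0# ≤ t j) → (∀ j → 0# ≤ f j) → 0# ≤ sum (λ j → t j * f j)
  weighted-nonNegative t≥ f≥ = sum-nonNegative (λ j → *-nonNegative (t≥ j) (f≥ j))

  weighted-zero : ∀ {n} {t f : Fin n → Carrier} → (∀ j → f j ≈ 0#) → sum (λ j → t j * f j) ≈ 0#
  weighted-zero f≈ = sum-zero (λ j → trans (*-congˡ (f≈ j)) (zeroʳ _))

  weighted-constant : ∀ {n} {t f : Fin n → Carrier} {b} →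
    sum t ≈ 1# → (∀ j → f j ≈ b) → sum (λ j → t j * f j) ≈ b
  weighted-constant {t = t} {f} {b} s e = begin
    sum (λ j → t j * f j) ≈⟨ sum-cong (λ j → *-congˡ (e j)) ⟩
    sum (λ j → t j * b) ≈⟨ *-distribʳ-sum b t ⟨
    sum t * b ≈⟨ *-congʳ s ⟩
    1# * b ≈⟨ *-identityˡ b ⟩
    b ∎

  module _ {I : Set} where

    sum-combination : ∀ {n m} (t : Fin n → Carrier) (v : Fin n → Point I) (f : Fin m → I) →
      sum (λ l → combination t v (f l)) ≈ sum (λ j → t j * sum (λ l → v j (f l)))
    sum-combination t v f = trans (∑-comm (λ l j → t j * v j (f l)))
      (sum-cong (λ j → sym (*-distribˡ-sum (t j) (λ l → v j (f l)))))

  ∙-combination : ∀ {n m} (u : Fin m → Carrier) (t : Fin n → Carrier) (v : Fin n → Point (Fin m)) →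
    u ∙ combination t v ≈ sum (λ j → t j * (u ∙ v j))
  ∙-combination u t v = begin
    sum (λ i → u i * sum (λ j → t j * v j i)) ≈⟨ sum-cong (λ i → *-distribˡ-sum (u i) (λ j → t j * v j i)) ⟩
    sum (λ i → sum (λ j → u i * (t j * v j i))) ≈⟨ ∑-comm (λ i j → u i * (t j * v j i)) ⟩
    sum (λ j → sum (λ i → u i * (t j * v j i))) ≈⟨ sum-cong (λ j → trans (sum-cong (λ i → solve 3 (λ u t v → u :* (t :* v) := t :* (u :* v)) refl (u i) (t j) (v j i)))
                                                                     (sym (*-distribˡ-sum (t j) (λ i → u i * v j i)))) ⟩
    sum (λ j → t j * (u ∙ v j)) ∎

  ∙-congˡ : ∀ {n} (u : Fin n → Carrier) {x y : Point (Fin n)} → x ≋ y → u ∙ x ≈ u ∙ y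
  ∙-congˡ u e = sum-cong (λ i → *-congˡ (e i))

  module _ {h : ℕ} where

    basis-same : ∀ (v : Fin h) → basis v v ≈ 1#
    basis-same v with v Fin.≟ v
    ... | yes _ = refl
    ... | no v≢v = ⊥-elim (v≢v ≡.refl)

    basis-other : ∀ {v w : Fin h} → v ≢ w → basis v w ≈ 0#
    basis-other {v} {w} v≢w with v Fin.≟ w
    ... | yes v≡w = ⊥-elim (v≢w v≡w)
    ... | no _ = refl

    basis-nonNegative : ∀ (v w : Fin h) → 0# ≤ basis v w
    basis-nonNegative v w with v Fin.≟ w
    ... | yes _ = proj₁ 0<1
    ... | no _ = ≤-refl

    sum-basis : ∀ (v : Fin h) → sum (basis v) ≈ 1#
    sum-basis v = trans (sum-single v (λ w w≢v → basis-other (w≢v ∘ ≡.sym))) (basis-same v)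

    ∙-basis : ∀ (u : Fin h → Carrier) v → u ∙ basis v ≈ u v
    ∙-basis u v = trans (sum-single v (λ w w≢v → trans (*-congˡ (basis-other (w≢v ∘ ≡.sym))) (zeroʳ _)))
      (trans (*-congˡ (basis-same v)) (*-identityʳ _))

    basis-expansion : ∀ (x : Point (Fin h)) → (λ w → sum (λ v → x v * basis v w)) ≋ x
    basis-expansion x w = trans (sum-single w (λ v v≢w → trans (*-congˡ (basis-other v≢w)) (zeroʳ _)))
      (trans (*-congˡ (basis-same w)) (*-identityʳ _))

    Vertices : Subset h → Pred (Point (Fin h)) ℓ₁
    Vertices σ x = ∃[ v ] v ∈ˢ σ × x ≋ basis v

    record Simplicial (σ : Subset h) (x : Point (Fin h)) : Set ℓ where
      field
        nonNegative : ∀ v → 0# ≤ x v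
        support     : ∀ v → v ∉ˢ σ → x v ≈ 0#
        total-mass  : sum x ≈ 1#

    -- For the converse inclusion the coordinates of x are themselves the weights of the vertices.
    simplex≐ : ∀ σ → simplex σ ≐ Simplicial σ
    simplex≐ σ = to , from
      where
      to : simplex σ ⊆ Simplicial σ
      to (n , v , t , v∈ , t≥ , s , p) = record
        { nonNegative = λ w → ≤-respʳ (sym (p w)) (weighted-nonNegative t≥
            (λ j → ≤-respʳ (sym (proj₂ (proj₂ (v∈ j)) w)) (basis-nonNegative (proj₁ (v∈ j)) w)))
        ; support = λ w w∉ → trans (p w) (weighted-zero λ j → trans (proj₂ (proj₂ (v∈ j)) w)
            (basis-other λ e → w∉ (≡.subst (_∈ˢ σ) e (proj₁ (proj₂ (v∈ j))))))
        ; total-mass = trans (sum-cong p) (trans (sum-combination t v (λ i → i))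
            (weighted-constant s (λ j → trans (sum-cong (proj₂ (proj₂ (v∈ j)))) (sum-basis (proj₁ (v∈ j))))))
        }
      from : Simplicial σ ⊆ simplex σ
      from {x} X = cone-resp {A = Vertices σ} total-mass (basis-expansion x) (cone-∑ {A = Vertices σ} part)
        where
        open Simplicial X
        part : ∀ v → Cone (Vertices σ) (x v) (λ w → x v * basis v w)
        part v with v ∈?ˢ σ
        ... | yes v∈ = cone-generator {A = Vertices σ} (nonNegative v) (v , v∈ , λ _ → refl) (λ _ → refl)
        ... | no v∉ = cone-zero {A = Vertices σ} (support v v∉) (λ w → trans (*-congʳ (support v v∉)) (zeroˡ _))

    basis∈simplex : ∀ {σ : Subset h} {v} → v ∈ˢ σ → basis v ∈ simplex σ
    basis∈simplex v∈ = conv-⊇ {A = Vertices _} (_ , v∈ , λ _ → refl)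

  -- The index stands for g > 0. Arguments about a single block have one at hand, so g = 0 needs no
  -- separate treatment there.
  g*1/g : ∀ {g} → Fin g → (g · 1#) * 1/ g ≈ 1#
  g*1/g {suc g} _ = *-inverseʳ _ (<⇒≉ (·1-positive g))

  1/g-positive : ∀ {g} → Fin g → 0# < 1/ g
  1/g-positive {suc g} _ = ⁻¹-positive (·1-positive g)

  sum-constant : ∀ g b → sum {g} (λ _ → b) ≈ (g · 1#) * b
  sum-constant zero    b = sym (zeroˡ b)
  sum-constant (suc g) b = trans (+-cong (sym (*-identityˡ b)) (sum-constant g b)) (sym (distribʳ b 1# _))

  -- Joins and products as sets of matrices, and the slice through a join

  module _ {g h : ℕ} where

    μ-same : ∀ (i : Fin g) (x : Point (Fin h)) v → μ i x (i , v) ≈ x v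
    μ-same i x v with i Fin.≟ i
    ... | yes _ = refl
    ... | no i≢i = ⊥-elim (i≢i ≡.refl)

    μ-other : ∀ {i j : Fin g} (x : Point (Fin h)) v → i ≢ j → μ i x (j , v) ≈ 0#
    μ-other {i} {j} x v i≢j with i Fin.≟ j
    ... | yes i≡j = ⊥-elim (i≢j i≡j)
    ... | no _ = refl

    sum-μ : ∀ (x : Fin g → Point (Fin h)) i v → sum (λ j → μ j (x j) (i , v)) ≈ x i v
    sum-μ x i v = trans (sum-single i (λ j j≢i → μ-other (x j) v j≢i)) (μ-same i (x i) v)

    -- ⋆ σ as a polyhedron of g × h matrices with a column of row sums.
    record Join (σ : Fin g → Subset h) (z : Point (Big g h)) : Set ℓ where
      field
        nonNegative : ∀ i v → 0# ≤ z (inj₁ (i , v))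
        support     : ∀ i v → v ∉ˢ σ i → z (inj₁ (i , v)) ≈ 0#
        row         : ∀ i → sum (λ v → z (inj₁ (i , v))) ≈ z (inj₂ i)
        total-mass  : sum (λ i → z (inj₂ i)) ≈ 1#

    private
      Generator : (σ : Fin g → Subset h) → Pred (Point (Big g h)) ℓ
      Generator σ z = ∃[ i ] Σ[ x ∈ Point (Fin _) ] x ∈ simplex (σ i) × z ≋ [ μ i x , basis i ]′

      generator⊆Join : ∀ σ → Generator σ ⊆ Join σ
      generator⊆Join σ {z} (i , x , x∈ , e) = record
        { nonNegative = λ j v → ≤-respʳ (sym (e (inj₁ (j , v)))) (nn j v)
        ; support = λ j v v∉ → trans (e (inj₁ (j , v))) (sp j v v∉)
        ; row = λ j → trans (sum-cong (λ v → e (inj₁ (j , v)))) (trans (rw j) (sym (e (inj₂ j))))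
        ; total-mass = trans (sum-cong (λ j → e (inj₂ j))) (sum-basis i)
        }
        where
        open Simplicial (proj₁ (simplex≐ (σ i)) x∈)
        nn : ∀ j v → 0# ≤ μ i x (j , v)
        nn j v with i Fin.≟ j
        ... | yes _ = nonNegative v
        ... | no _ = ≤-refl
        sp : ∀ j v → v ∉ˢ σ j → μ i x (j , v) ≈ 0#
        sp j v v∉ with i Fin.≟ j
        ... | yes ≡.refl = support v v∉
        ... | no _ = refl
        rw : ∀ j → sum (λ v → μ i x (j , v)) ≈ basis i j
        rw j with i Fin.≟ j
        ... | yes _ = total-mass
        ... | no _ = sum-zero {h} (λ _ → refl)

    -- The matrix entry at (i , v) serves as the weight of the vertex v of block i; `row` ensures
    -- that these weights reproduce the last g coordinates too.
    ⋆≐ : ∀ σ → ⋆ σ ≐ Join σ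
    ⋆≐ σ = to , from
      where
      to : ⋆ σ ⊆ Join σ
      to {z} (n , v , t , v∈ , t≥ , s , p) = record
        { nonNegative = λ i w → ≤-respʳ (sym (p (inj₁ (i , w)))) (weighted-nonNegative t≥ (λ j → Join.nonNegative (V j) i w))
        ; support = λ i w w∉ → trans (p (inj₁ (i , w))) (weighted-zero (λ j → Join.support (V j) i w w∉))
        ; row = λ i → trans (sum-cong (λ w → p (inj₁ (i , w)))) (trans (sum-combination t v (λ w → inj₁ (i , w)))
            (trans (sum-cong (λ j → *-congˡ (Join.row (V j) i))) (sym (p (inj₂ i)))))
        ; total-mass = trans (sum-cong (λ i → p (inj₂ i))) (trans (sum-combination t v inj₂)
            (weighted-constant s (λ j → Join.total-mass (V j))))
        }
        where
        V : ∀ j → Join σ (v j)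
        V j = generator⊆Join σ (v∈ j)
      from : Join σ ⊆ ⋆ σ
      from {z} Z = cone-resp {A = Generator σ} (trans (sum-cong row) total-mass) expansion (cone-∑ {A = Generator σ} λ i → cone-∑ {A = Generator σ} (part i))
        where
        open Join Z
        gen : ∀ i v → Point (Big g h)
        gen i v = [ μ i (basis v) , basis i ]′
        part : ∀ i v → Cone (Generator σ) (z (inj₁ (i , v))) (λ k → z (inj₁ (i , v)) * gen i v k)
        part i v with v ∈?ˢ σ i
        ... | yes v∈ = cone-generator {A = Generator σ} (nonNegative i v) (i , basis v , basis∈simplex v∈ , λ _ → refl) (λ _ → refl)
        ... | no v∉ = cone-zero {A = Generator σ} (support i v v∉) (λ k → trans (*-congʳ (support i v v∉)) (zeroˡ _))
        expansion : (λ k → sum (λ i → sum (λ v → z (inj₁ (i , v)) * gen i v k))) ≋ z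
        expansion (inj₁ (i , w)) = trans
          (sum-single i (λ j j≢i → sum-zero (λ v → trans (*-congˡ (μ-other (basis v) w j≢i)) (zeroʳ _))))
          (trans (sum-cong (λ v → *-congˡ (μ-same i (basis v) w))) (basis-expansion (λ v → z (inj₁ (i , v))) w))
        expansion (inj₂ i) = begin
          sum (λ j → sum (λ v → z (inj₁ (j , v)) * basis j i)) ≈⟨ sum-cong (λ j → sym (*-distribʳ-sum (basis j i) (λ v → z (inj₁ (j , v))))) ⟩
          sum (λ j → sum (λ v → z (inj₁ (j , v))) * basis j i) ≈⟨ sum-cong (λ j → *-congʳ (row j)) ⟩
          sum (λ j → z (inj₂ j) * basis j i) ≈⟨ basis-expansion (λ j → z (inj₂ j)) i ⟩
          z (inj₂ i) ∎

    record Product (σ : Fin g → Subset h) (z : Point (Big g h)) : Set ℓ where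
      field
        nonNegative : ∀ i v → 0# ≤ z (inj₁ (i , v))
        support     : ∀ i v → v ∉ˢ σ i → z (inj₁ (i , v)) ≈ 0#
        row         : ∀ i → sum (λ v → z (inj₁ (i , v))) ≈ 1/ g
        centred     : ∀ i → z (inj₂ i) ≈ 1/ g

    ⨉≐ : ∀ σ → ⨉ σ ≐ Product σ
    ⨉≐ σ = to , from
      where
      to : ⨉ σ ⊆ Product σ
      to {z} (x , x∈ , p) = record
        { nonNegative = λ i v → ≤-respʳ (sym (entry i v)) (*-nonNegative (proj₁ (1/g-positive i)) (Simplicial.nonNegative (X i) v))
        ; support = λ i v v∉ → trans (entry i v) (trans (*-congˡ (Simplicial.support (X i) v v∉)) (zeroʳ _))
        ; row = λ i → trans (sum-cong (entry i)) (trans (sym (*-distribˡ-sum (1/ g) (x i)))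
            (trans (*-congˡ (Simplicial.total-mass (X i))) (*-identityʳ _)))
        ; centred = λ i → p (inj₂ i)
        }
        where
        X : ∀ i → Simplicial (σ i) (x i)
        X i = proj₁ (simplex≐ (σ i)) (x∈ i)
        entry : ∀ i v → z (inj₁ (i , v)) ≈ 1/ g * x i v
        entry i v = trans (p (inj₁ (i , v))) (*-congˡ (sum-μ x i v))
      from : Product σ ⊆ ⨉ σ
      from {z} Z = x , (λ i → proj₂ (simplex≐ (σ i)) (X i)) ,
        λ { (inj₁ (i , v)) → trans (entry i v) (*-congˡ (sym (sum-μ x i v))) ; (inj₂ i) → centred i }
        where
        open Product Z
        x : Fin g → Point (Fin h)
        x i v = (g · 1#) * z (inj₁ (i , v))
        X : ∀ i → Simplicial (σ i) (x i)
        X i = record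
          { nonNegative = λ v → *-nonNegative (·1-nonNegative g) (nonNegative i v)
          ; support = λ v v∉ → trans (*-congˡ (support i v v∉)) (zeroʳ _)
          ; total-mass = trans (sym (*-distribˡ-sum (g · 1#) (λ v → z (inj₁ (i , v))))) (trans (*-congˡ (row i)) (g*1/g i))
          }
        entry : ∀ i v → z (inj₁ (i , v)) ≈ 1/ g * x i v
        entry i v = begin
          z (inj₁ (i , v)) ≈⟨ *-identityˡ _ ⟨
          1# * z (inj₁ (i , v)) ≈⟨ *-congʳ (g*1/g i) ⟨
          (g · 1#) * 1/ g * z (inj₁ (i , v)) ≈⟨ solve 3 (λ a b c → a :* b :* c := b :* (a :* c)) refl (g · 1#) (1/ g) _ ⟩
          1/ g * x i v ∎

    -- The Cayley trick.
    slice≐ : Fin g → ∀ σ → (λ z → ∃[ x ] x ∈ image π (⨉ σ) × z ≋ [ x , (λ _ → 1/ g) ]′)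
                           ≐ (image π□ (⋆ σ) ∩ Slice g h)
    slice≐ i₀ σ = to , from
      where
      to : ∀ {z} → ∃[ x ] x ∈ image π (⨉ σ) × z ≋ [ x , (λ _ → 1/ g) ]′ → z ∈ (image π□ (⋆ σ) ∩ Slice g h)
      to {z} (x , (y , y∈ , e) , p) = (y , proj₂ (⋆≐ σ) Y , e′) , (λ i → p (inj₂ i))
        where
        open Product (proj₁ (⨉≐ σ) y∈)
        Y : Join σ y
        Y = record
          { nonNegative = nonNegative
          ; support = support
          ; row = λ i → trans (row i) (sym (centred i))
          -- For g = 0 the sum would be empty and could not be 1; `i₀` excludes this case.
          ; total-mass = trans (sum-cong centred) (trans (sum-constant g (1/ g)) (g*1/g i₀))
          }
        e′ : π□ y ≋ z
        e′ (inj₁ v) = trans (e v) (sym (p (inj₁ v)))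
        e′ (inj₂ i) = trans (centred i) (sym (p (inj₂ i)))
      from : ∀ {z} → z ∈ (image π□ (⋆ σ) ∩ Slice g h) → ∃[ x ] x ∈ image π (⨉ σ) × z ≋ [ x , (λ _ → 1/ g) ]′
      from {z} ((y , y∈ , e) , s) = z ∘ inj₁ , (y , proj₂ (⨉≐ σ) Y , (λ v → e (inj₁ v))) ,
        λ { (inj₁ v) → refl ; (inj₂ i) → s i }
        where
        open Join (proj₁ (⋆≐ σ) y∈)
        centred : ∀ i → y (inj₂ i) ≈ 1/ g
        centred i = trans (e (inj₂ i)) (s i)
        Y : Product σ y
        Y = record
          { nonNegative = nonNegative
          ; support = support
          ; row = λ i → trans (row i) (centred i)
          ; centred = centred
          }

    -- On the slice every row has the nonzero sum 1/g, hence a nonzero entry, which must lie in its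
    -- block.
    slice-transversal : ∀ {σ} → Satisfiable (image π□ (⋆ σ) ∩ Slice g h) → Transversal σ
    slice-transversal {σ} (z , (y , y∈ , e) , s) i = found (sum≉0⇒ _ λ e₀ →
      <⇒≉ (1/g-positive i) (trans (sym (trans (row i) (trans (e (inj₂ i)) (s i)))) e₀))
      where
      open Join (proj₁ (⋆≐ σ) y∈)
      found : ∃[ v ] ¬ y (inj₁ (i , v)) ≈ 0# → Subset.Nonempty (σ i)
      found (v , y≉0) with v ∈?ˢ σ i
      ... | yes v∈ = v , v∈
      ... | no v∉ = ⊥-elim (y≉0 (support i v v∉))

-- Pigeonhole principle, numbering of subsets, unions

-- A missed value k could be put in front of f, which would inject n + 1 elements into n.
injective⇒surjective : ∀ {n} {f : Fin n → Fin n} → Injective _≡_ _≡_ f → ∀ k → ∃[ i ] f i ≡ k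
injective⇒surjective {n} {f} inj k with Fin.any? (λ i → f i Fin.≟ k)
... | yes p = p
... | no ¬p = ⊥-elim (ℕ.1+n≰n (Fin.injective⇒≤ {f = k ◂ f} extended))
  where
  extended : Injective _≡_ _≡_ (k ◂ f)
  extended {zero}  {zero}  _ = ≡.refl
  extended {zero}  {suc j} e = ⊥-elim (¬p (j , ≡.sym e))
  extended {suc i} {zero}  e = ⊥-elim (¬p (i , e))
  extended {suc i} {suc j} e = ≡.cong suc (inj e)

-- Binary digits number the subsets; `finite` requires the cells to be listed by some `Fin s`.
decode : ∀ {h} → Fin (2 ℕ.^ h) → Subset h
decode i = comprehension (λ v → Fin.finToFun i v Fin.≟ suc zero)

encode : ∀ {h} → Subset h → Fin (2 ℕ.^ h)
encode σ = Fin.funToFin (λ v → if does (v ∈?ˢ σ) then suc zero else zero)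

decode-encode : ∀ {h} (σ : Subset h) → decode (encode σ) ≡ σ
decode-encode σ = Subset.⊆-antisym to from
  where
  bit : ∀ v → Fin.finToFun (encode σ) v ≡ (if does (v ∈?ˢ σ) then suc zero else zero)
  bit = Fin.finToFun-funToFin _
  to : decode (encode σ) ⊆ˢ σ
  to {v} v∈ with v ∈?ˢ σ | bit v
  ... | yes p | _ = p
  ... | no _  | e = case ≡.trans (≡.sym e) (∈-comprehension⁻ (λ v → Fin.finToFun (encode σ) v Fin.≟ suc zero) v∈) of λ ()
  from : σ ⊆ˢ decode (encode σ)
  from {v} v∈ = ∈-comprehension⁺ (λ v → Fin.finToFun (encode σ) v Fin.≟ suc zero)
    (≡.trans (bit v) (≡.cong (if_then suc zero else zero) (dec-true (v ∈?ˢ σ) v∈)))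

module _ {n h : ℕ} (σ : Fin n → Subset h) where

  private
    covered? : ∀ v → Dec (∃[ i ] v ∈ˢ σ i)
    covered? v = Fin.any? (λ i → v ∈?ˢ σ i)

  Union : Subset h
  Union = comprehension covered?

  ∈-Union⁺ : ∀ {i v} → v ∈ˢ σ i → v ∈ˢ Union
  ∈-Union⁺ v∈ = ∈-comprehension⁺ covered? (_ , v∈)

  ∈-Union⁻ : ∀ {v} → v ∈ˢ Union → ∃[ i ] v ∈ˢ σ i
  ∈-Union⁻ = ∈-comprehension⁻ covered?

  Disjoint : Set
  Disjoint = ∀ {i j v} → v ∈ˢ σ i → v ∈ˢ σ j → i ≡ j

-- Projected cells and their corners

module Cells {c ℓ₁ ℓ₂} (𝕂 : OrderedField c ℓ₁ ℓ₂) where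

  open Geometry 𝕂
  open OrderedFieldProperties 𝕂
  open Convexity 𝕂
  open Solver using (solve; _:=_; _:*_)
  open SetoidReasoning setoid

  module _ {h : ℕ} where

    indicator : Subset h → Fin h → Carrier
    indicator σ v = if does (v ∈?ˢ σ) then 1# else 0#

    indicator-∈ : ∀ {σ v} → v ∈ˢ σ → indicator σ v ≈ 1#
    indicator-∈ {σ} {v} v∈ with v ∈?ˢ σ
    ... | yes _ = refl
    ... | no v∉ = ⊥-elim (v∉ v∈)

    indicator-∉ : ∀ {σ v} → v ∉ˢ σ → indicator σ v ≈ 0#
    indicator-∉ {σ} {v} v∉ with v ∈?ˢ σ
    ... | yes v∈ = ⊥-elim (v∉ v∈)
    ... | no _ = refl

    indicator-nonNegative : ∀ σ v → 0# ≤ indicator σ v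
    indicator-nonNegative σ v with v ∈?ˢ σ
    ... | yes _ = proj₁ 0<1
    ... | no _ = ≤-refl

    SupportedIn : Subset h → Pred (Point (Fin h)) ℓ₁
    SupportedIn W x = ∀ v → v ∉ˢ W → x v ≈ 0#

    -- π (⨉ σ) when the σ i are disjoint.
    record Cell {g} (σ : Fin g → Subset h) (x : Point (Fin h)) : Set ℓ where
      field
        nonNegative : ∀ v → 0# ≤ x v
        support     : SupportedIn (Union σ) x
        block-mass  : ∀ i → indicator (σ i) ∙ x ≈ 1/ g

    cell-cong : ∀ {g} {σ τ : Fin g → Subset h} → (∀ i → σ i ≡ τ i) → Cell σ ⊆ Cell τ
    cell-cong {σ = σ} {τ} e X = record
      { nonNegative = nonNegative
      ; support = λ v v∉ → support v λ v∈ → let i , p = ∈-Union⁻ σ v∈ in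
          v∉ (∈-Union⁺ τ (≡.subst (v ∈ˢ_) (e i) p))
      ; block-mass = λ i → trans (reflexive (≡.cong (λ ρ → indicator ρ ∙ _) (≡.sym (e i)))) (block-mass i)
      }
      where open Cell X

    Block : ∀ {g} → (Fin g → Subset h) → Point (Fin h) → Fin g → Fin h → Carrier
    Block σ x i v = indicator (σ i) v * x v

    module _ {g} {σ : Fin g → Subset h} (disjoint : Disjoint σ) where

      sum-block : ∀ {x} → SupportedIn (Union σ) x → ∀ v → sum (λ i → Block σ x i v) ≈ x v
      sum-block {x} supp v with v ∈?ˢ Union σ
      ... | no v∉ = trans (sum-zero {g} (λ i → trans (*-congˡ (supp v v∉)) (zeroʳ _))) (sym (supp v v∉))
      ... | yes v∈ = covered (∈-Union⁻ σ v∈)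
        where
        covered : ∃[ i ] v ∈ˢ σ i → sum (λ i → Block σ x i v) ≈ x v
        covered (i , v∈i) = trans
          (sum-single i (λ j j≢i → trans (*-congʳ (indicator-∉ λ v∈j → j≢i (disjoint v∈j v∈i))) (zeroˡ _)))
          (trans (*-congʳ (indicator-∈ v∈i)) (*-identityˡ _))

      -- Disjoint blocks leave at most one possibly nonzero entry in every column, so the column
      -- sums determine the matrix: the projection π forgets nothing on such cells.
      block-unique : ∀ (z : Fin g → Fin h → Carrier) {x : Point (Fin h)} → (∀ i v → v ∉ˢ σ i → z i v ≈ 0#) →
        (∀ v → sum (λ i → z i v) ≈ x v) → ∀ i v → Block σ x i v ≈ z i v
      block-unique z {x} supp col i v with v ∈?ˢ σ i
      ... | no v∉ = trans (zeroˡ _) (sym (supp i v v∉))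
      ... | yes v∈ = trans (*-identityˡ _) (trans (sym (col v))
        (sum-single i λ j j≢i → supp j v λ v∈j → j≢i (disjoint v∈j v∈)))

      image-⨉ : image π (⨉ σ) ≐ Cell σ
      image-⨉ = to , from
        where
        to : image π (⨉ σ) ⊆ Cell σ
        to {x} (z , z∈ , e) = record
          { nonNegative = λ v → ≤-respʳ (e v) (sum-nonNegative (λ i → nonNegative i v))
          ; support = λ v v∉ → trans (sym (e v)) (sum-zero (λ i → support i v λ v∈ → v∉ (∈-Union⁺ σ v∈)))
          ; block-mass = λ i → trans (sum-cong (block-unique (λ i v → z (inj₁ (i , v))) support e i)) (row i)
          }
          where open Product (proj₁ (⨉≐ σ) z∈)
        from : Cell σ ⊆ image π (⨉ σ)
        from {x} X = [ (λ (i , v) → Block σ x i v) , (λ _ → 1/ g) ]′ , proj₂ (⨉≐ σ) (record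
          { nonNegative = λ i v → *-nonNegative (indicator-nonNegative (σ i) v) (nonNegative v)
          ; support = λ i v v∉ → trans (*-congʳ (indicator-∉ v∉)) (zeroˡ _)
          ; row = block-mass
          ; centred = λ _ → refl
          }) , sum-block support
          where open Cell X

      image-⋆ : image π (⋆ σ) ≐ simplex (Union σ)
      image-⋆ = (λ p → proj₂ (simplex≐ (Union σ)) (to p)) , λ p → from (proj₁ (simplex≐ (Union σ)) p)
        where
        to : image π (⋆ σ) ⊆ Simplicial (Union σ)
        to {x} (z , z∈ , e) = record
          { nonNegative = λ v → ≤-respʳ (e v) (sum-nonNegative (λ i → nonNegative i v))
          ; support = λ v v∉ → trans (sym (e v)) (sum-zero (λ i → support i v λ v∈ → v∉ (∈-Union⁺ σ v∈)))
          ; total-mass = begin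
              sum x ≈⟨ sum-cong (λ v → sym (e v)) ⟩
              sum (λ v → sum (λ i → z (inj₁ (i , v)))) ≈⟨ ∑-comm (λ v i → z (inj₁ (i , v))) ⟩
              sum (λ i → sum (λ v → z (inj₁ (i , v)))) ≈⟨ sum-cong row ⟩
              sum (λ i → z (inj₂ i)) ≈⟨ total-mass ⟩
              1# ∎
          }
          where open Join (proj₁ (⋆≐ σ) z∈)
        from : Simplicial (Union σ) ⊆ image π (⋆ σ)
        from {x} X = [ (λ (i , v) → Block σ x i v) , (λ i → indicator (σ i) ∙ x) ]′ , proj₂ (⋆≐ σ) (record
          { nonNegative = λ i v → *-nonNegative (indicator-nonNegative (σ i) v) (nonNegative v)
          ; support = λ i v v∉ → trans (*-congʳ (indicator-∉ v∉)) (zeroˡ _)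
          ; row = λ _ → refl
          ; total-mass = trans (∑-comm (λ i v → Block σ x i v)) (trans (sum-cong (sum-block support)) total-mass)
          }) , sum-block support
          where open Simplicial X

    combination∈Cell : ∀ {g} {σ : Fin g → Subset h} {n} {t : Fin n → Carrier} {v : Fin n → Point (Fin h)} →
      (∀ j → 0# ≤ t j) → sum t ≈ 1# → (∀ j → v j ∈ Cell σ) → combination t v ∈ Cell σ
    combination∈Cell {σ = σ} {t = t} {v} t≥ s v∈ = record
      { nonNegative = λ w → weighted-nonNegative t≥ (λ j → Cell.nonNegative (v∈ j) w)
      ; support = λ w w∉ → weighted-zero (λ j → Cell.support (v∈ j) w w∉)
      ; block-mass = λ i → trans (∙-combination (indicator (σ i)) t v)
          (weighted-constant s (λ j → Cell.block-mass (v∈ j) i))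
      }

    cell-resp : ∀ {g} {σ : Fin g → Subset h} {x y} → x ≋ y → x ∈ Cell σ → y ∈ Cell σ
    cell-resp {σ = σ} e X = record
      { nonNegative = λ v → ≤-respʳ (e v) (nonNegative v)
      ; support = λ v v∉ → trans (sym (e v)) (support v v∉)
      ; block-mass = λ i → trans (∙-congˡ (indicator (σ i)) (λ v → sym (e v))) (block-mass i)
      }
      where open Cell X

    -- The vertex of π Hom that corresponds to {s₁} × … × {s_g}.
    corner : ∀ {g} → (Fin g → Fin h) → Point (Fin h)
    corner {g} s v = sum (λ i → 1/ g * basis (s i) v)

    corner-∈ : ∀ {g} {s : Fin g → Fin h} → Injective _≡_ _≡_ s → ∀ i → corner s (s i) ≈ 1/ g
    corner-∈ {s = s} inj i = trans
      (sum-single i (λ j j≢i → trans (*-congˡ (basis-other (λ e → j≢i (inj e)))) (zeroʳ _)))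
      (trans (*-congˡ (basis-same (s i))) (*-identityʳ _))

    corner-∉ : ∀ {g} {s : Fin g → Fin h} {v} → (∀ i → s i ≢ v) → corner s v ≈ 0#
    corner-∉ v∉ = sum-zero (λ i → trans (*-congˡ (basis-other (v∉ i))) (zeroʳ _))

    Selection : ∀ {g} → (Fin g → Subset h) → (Fin g → Fin h) → Set
    Selection σ s = ∀ i → s i ∈ˢ σ i

    selection-injective : ∀ {g} {σ : Fin g → Subset h} {s} → Disjoint σ → Selection σ s → Injective _≡_ _≡_ s
    selection-injective {σ = σ} disjoint s∈ {i} {j} e = disjoint (s∈ i) (≡.subst (_∈ˢ σ j) (≡.sym e) (s∈ j))

    module _ {g} {σ : Fin g → Subset h} (disjoint : Disjoint σ) where

      corner∈Cell : ∀ {s} → Selection σ s → corner s ∈ Cell σ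
      corner∈Cell {s} s∈ = record
        { nonNegative = λ v → sum-nonNegative (λ i → *-nonNegative (proj₁ (1/g-positive i)) (basis-nonNegative (s i) v))
        ; support = λ v v∉ → corner-∉ (λ i e → v∉ (∈-Union⁺ σ (≡.subst (_∈ˢ σ i) e (s∈ i))))
        ; block-mass = λ i → trans
            (sum-single (s i) (λ v v≢ → trans (off i v v≢) refl))
            (trans (*-cong (indicator-∈ (s∈ i)) (corner-∈ (selection-injective disjoint s∈) i)) (*-identityˡ _))
        }
        where
        off : ∀ i v → v ≢ s i → indicator (σ i) v * corner s v ≈ 0#
        off i v v≢ with v ∈?ˢ σ i
        ... | no _ = zeroˡ _
        ... | yes v∈ = trans (*-congˡ (corner-∉ (λ j e →
          v≢ (≡.trans (≡.sym e) (≡.cong s (disjoint (≡.subst (_∈ˢ σ j) e (s∈ j)) v∈)))))) (zeroʳ _)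

      -- In block i only the coordinate at `s i` can be nonzero, so it carries the whole mass 1/g.
      -- In this sense corners have minimal support.
      supported⇒corner : ∀ {x s} → x ∈ Cell σ → Selection σ s → (∀ v → (∀ i → s i ≢ v) → x v ≈ 0#) → x ≋ corner s
      supported⇒corner {x} {s} X s∈ supp v with Fin.any? (λ i → s i Fin.≟ v)
      ... | no v∉ = trans (supp v (λ i e → v∉ (i , e))) (sym (corner-∉ (λ i e → v∉ (i , e))))
      ... | yes (i , ≡.refl) = begin
        x (s i) ≈⟨ *-identityˡ _ ⟨
        1# * x (s i) ≈⟨ *-congʳ (indicator-∈ (s∈ i)) ⟨
        indicator (σ i) (s i) * x (s i) ≈⟨ sum-single (s i) off ⟨
        indicator (σ i) ∙ x ≈⟨ Cell.block-mass X i ⟩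
        1/ g ≈⟨ corner-∈ (selection-injective disjoint s∈) i ⟨
        corner s (s i) ∎
        where
        off : ∀ v → v ≢ s i → indicator (σ i) v * x v ≈ 0#
        off v v≢ with v ∈?ˢ σ i
        ... | no _ = zeroˡ _
        ... | yes v∈ = trans (*-congˡ (supp v (λ j e →
          v≢ (≡.trans (≡.sym e) (≡.cong s (disjoint (≡.subst (_∈ˢ σ j) e (s∈ j)) v∈)))))) (zeroʳ _)

    Shifted : ∀ {a} → Pred (Point (Fin h)) a → Point (Fin h) → Pred (Point (Fin h)) _
    Shifted A q z = Σ[ y ∈ Point (Fin h) ] y ∈ A × z ≋ (λ v → y v + q v)

    conv-shifted : ∀ {a} {A : Pred (Point (Fin h)) a} {p} q → p ∈ conv A → (λ v → p v + q v) ∈ conv (Shifted A q)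
    conv-shifted {p = p} q (n , v , t , v∈ , t≥ , s , e) =
      n , (λ j w → v j w + q w) , t , (λ j → v j , v∈ j , λ _ → refl) , t≥ , s , λ w → begin
        p w + q w ≈⟨ +-cong (e w) (sym (weighted-constant {n} {t} {λ _ → q w} s (λ _ → refl))) ⟩
        sum (λ j → t j * v j w) + sum (λ j → t j * q w) ≈⟨ ∑-distrib-+ (λ j → t j * v j w) (λ j → t j * q w) ⟨
        sum (λ j → t j * v j w + t j * q w) ≈⟨ sum-cong (λ j → sym (distribˡ (t j) (v j w) (q w))) ⟩
        sum (λ j → t j * (v j w + q w)) ∎

    Sums : ∀ {n a} → (Fin n → Pred (Point (Fin h)) a) → Pred (Point (Fin h)) _
    Sums {n} A z = Σ[ y ∈ (Fin n → Point (Fin h)) ] (∀ i → y i ∈ A i) × z ≋ (λ v → sum (λ i → y i v))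

    -- A hull translated by q is the hull of the translated points. With the other summands held
    -- fixed, one summand after the other can thus be replaced by points of its generating set.
    minkowski : ∀ {n a} (A : Fin n → Pred (Point (Fin h)) a) {x : Fin n → Point (Fin h)} → (∀ i → x i ∈ conv (A i)) →
      (λ v → sum (λ i → x i v)) ∈ conv (Sums A)
    minkowski {zero} A _ = conv-⊇ {A = Sums A} ((λ ()) , (λ ()) , λ _ → refl)
    minkowski {suc n} A {x} x∈ = conv-least {A = Shifted (A zero) rest} {B = Sums A} fixed-first
      (conv-shifted {A = A zero} rest (x∈ zero))
      where
      rest : Point (Fin h)
      rest v = sum (λ i → x (suc i) v)
      fixed-first : Shifted (A zero) rest ⊆ conv (Sums A)
      fixed-first {z} (y , y∈ , e) = conv-resp {A = Sums A} (λ v → trans (+-comm _ _) (sym (e v)))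
        (conv-mono {A = Shifted (Sums (A ∘ suc)) y} {B = Sums A} prepend
          (conv-shifted {A = Sums (A ∘ suc)} y (minkowski (A ∘ suc) (x∈ ∘ suc))))
        where
        prepend : Shifted (Sums (A ∘ suc)) y ⊆ Sums A
        prepend {z} (y′ , (ys , ys∈ , e′) , e) = y ◂ ys , (λ { zero → y∈ ; (suc i) → ys∈ i }) ,
          λ v → trans (e v) (trans (+-comm _ _) (+-congˡ (e′ v)))

    Corners : ∀ {g} → (Fin g → Subset h) → Pred (Point (Fin h)) ℓ₁
    Corners {g} σ z = Σ[ s ∈ (Fin g → Fin h) ] Selection σ s × z ≋ corner s

    -- A point is the sum of its blocks, and each block is a convex combination of basis vectors
    -- scaled by 1/g. Choosing one such vector per block gives a corner, so `minkowski` applies.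
    cell⊆conv-corners : ∀ {g} {σ : Fin g → Subset h} → Disjoint σ → Cell σ ⊆ conv (Corners σ)
    cell⊆conv-corners {g} {σ} disjoint {x} X = conv-mono {A = Sums A} {B = Corners σ} corners
      (conv-resp {A = Sums A} (sum-block disjoint support) (minkowski A block))
      where
      open Cell X
      A : Fin g → Pred (Point (Fin h)) _
      A i z = ∃[ u ] u ∈ˢ σ i × z ≋ (λ w → 1/ g * basis u w)
      block : ∀ i → Block σ x i ∈ conv (A i)
      block i = cone-resp {A = A i}
        (trans (sym (*-distribˡ-sum (g · 1#) (Block σ x i))) (trans (*-congˡ (block-mass i)) (g*1/g i)))
        (basis-expansion (Block σ x i)) (cone-∑ {A = A i} part)
        where
        -- The generators carry the factor 1/g, so the weights are g times the coordinates and add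
        -- up to 1 on the block.
        part : ∀ u → Cone (A i) ((g · 1#) * Block σ x i u) (λ w → Block σ x i u * basis u w)
        part u with u ∈?ˢ σ i
        ... | no u∉ = cone-zero {A = A i} (trans (*-congˡ (zeroˡ _)) (zeroʳ _)) (λ w → trans (*-congʳ (zeroˡ _)) (zeroˡ _))
        ... | yes u∈ = cone-generator {A = A i} (*-nonNegative (·1-nonNegative g) (*-nonNegative (proj₁ 0<1) (nonNegative u))) (u , u∈ , λ _ → refl)
          λ w → begin
            1# * x u * basis u w ≈⟨ *-identityˡ _ ⟨
            1# * (1# * x u * basis u w) ≈⟨ *-congʳ (g*1/g i) ⟨
            (g · 1#) * 1/ g * (1# * x u * basis u w) ≈⟨ solve 4 (λ n r y b → n :* r :* (y :* b) := n :* y :* (r :* b)) refl (g · 1#) (1/ g) (1# * x u) (basis u w) ⟩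
            (g · 1#) * (1# * x u) * (1/ g * basis u w) ∎
      corners : Sums A ⊆ Corners σ
      corners {z} (y , y∈ , e) = (λ i → proj₁ (y∈ i)) , (λ i → proj₁ (proj₂ (y∈ i))) ,
        λ w → trans (e w) (sum-cong λ i → proj₂ (proj₂ (y∈ i)) w)

    conv⊆cell : ∀ {g a} {σ : Fin g → Subset h} {A : Pred (Point (Fin h)) a} → A ⊆ Cell σ → conv A ⊆ Cell σ
    conv⊆cell A⊆ (n , w , t , w∈ , t≥ , s , e) =
      cell-resp (λ u → sym (e u)) (combination∈Cell t≥ s (λ j → A⊆ (w∈ j)))

    cell-isPolytope : ∀ {g} {σ : Fin g → Subset h} → Disjoint σ → Transversal σ →
      Σ[ n ∈ ℕ ] Σ[ v ∈ (Fin n → Point (Fin h)) ] Cell σ ≐ conv (range v)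
    cell-isPolytope {g} {σ} disjoint transversal = h ℕ.^ g , v ,
      (λ X → conv-mono {A = Corners σ} {B = range v} corners⊆range (cell⊆conv-corners disjoint X)) ,
      conv⊆cell {A = range v} λ (k , e) →
        cell-resp (λ u → sym (e u)) (corner∈Cell disjoint (select∈ (Fin.finToFun k)))
      where
      -- The spanning points are indexed by all h to the power g functions; a value outside its
      -- block is replaced by a fixed element of the block, so that only corners occur.
      select : (Fin g → Fin h) → Fin g → Fin h
      select s i = if does (s i ∈?ˢ σ i) then s i else proj₁ (transversal i)
      select∈ : ∀ s → Selection σ (select s)
      select∈ s i with s i ∈?ˢ σ i
      ... | yes p = p
      ... | no _ = proj₂ (transversal i)
      select-selection : ∀ {s} → Selection σ s → ∀ i → select s i ≡ s i
      select-selection {s} s∈ i with s i ∈?ˢ σ i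
      ... | yes _ = ≡.refl
      ... | no s∉ = ⊥-elim (s∉ (s∈ i))
      v : Fin (h ℕ.^ g) → Point (Fin h)
      v k = corner (select (Fin.finToFun k))
      corners⊆range : Corners σ ⊆ range v
      corners⊆range {z} (s , s∈ , e) = Fin.funToFin s , λ w → trans (e w) (sum-cong λ i →
        *-congˡ (reflexive (≡.cong (λ u → basis u w) (selected i))))
        where
        selected : ∀ i → s i ≡ select (Fin.finToFun (Fin.funToFin s)) i
        selected i = ≡.sym (≡.trans
          (≡.cong (λ u → if does (u ∈?ˢ σ i) then u else proj₁ (transversal i)) (Fin.finToFun-funToFin s i))
          (select-selection s∈ i))

record Listing {h} (σ : Subset h) (n : ℕ) : Set where
  field
    element   : Fin n → Fin h
    injective : Injective _≡_ _≡_ element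
    member    : ∀ j → element j ∈ˢ σ
    index     : ∀ {v} → v ∈ˢ σ → ∃[ j ] element j ≡ v

listing : ∀ {h} (σ : Subset h) → ∃[ n ] Listing σ n
listing [] = 0 , record { element = λ () ; injective = λ { {()} } ; member = λ () ; index = λ () }
listing (Subset.outside ∷ σ) with listing σ
... | n , L = n , record
  { element   = suc ∘ element
  ; injective = λ e → injective (Fin.suc-injective e)
  ; member    = λ j → there (member j)
  ; index     = λ { (there v∈) → let j , e = index v∈ in j , ≡.cong suc e }
  }
  where open Listing L
listing (Subset.inside ∷ σ) with listing σ
... | n , L = suc n , record
  { element   = zero ◂ (suc ∘ element)
  ; injective = inj
  ; member    = λ { zero → here ; (suc j) → there (member j) }
  ; index     = λ { here → zero , ≡.refl ; (there v∈) → let j , e = index v∈ in suc j , ≡.cong suc e }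
  }
  where
  open Listing L
  inj : Injective _≡_ _≡_ (zero ◂ (suc ∘ element))
  inj {zero}  {zero}  _ = ≡.refl
  inj {suc i} {suc j} e = ≡.cong suc (injective (Fin.suc-injective e))

-- Faces of simplices and cells, and counting of extreme points

module Faces {c ℓ₁ ℓ₂} (𝕂 : OrderedField c ℓ₁ ℓ₂) where

  open Geometry 𝕂
  open OrderedFieldProperties 𝕂
  open Convexity 𝕂
  open Cells 𝕂
  open Solver using (solve; _:=_; _:+_; _:*_; _:-_; :-_; :0; :1)
  open SetoidReasoning setoid

  argmax : ∀ {n p} {P : Pred (Fin n) p} → Decidable P → (u : Fin n → Carrier) → ∃ P →
           ∃[ v ] P v × (∀ w → P w → u w ≤ u v)
  argmax {suc n} {P = P} P? u (w₀ , p₀) = compare (Fin.any? (λ v → P? (suc v))) (P? zero)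
    where
    Maximum = ∃[ v ] P v × (∀ w → P w → u w ≤ u v)
    compare : Dec (∃[ v ] P (suc v)) → Dec (P zero) → Maximum
    compare (no ¬p) (yes p) = zero , p , λ { zero _ → ≤-refl ; (suc w) q → ⊥-elim (¬p (w , q)) }
    compare (no ¬p) (no ¬q) = ⊥-elim (impossible w₀ p₀)
      where
      impossible : ∀ w → P w → ⊥
      impossible zero    = ¬q
      impossible (suc w) p = ¬p (w , p)
    compare (yes p) q? = best (argmax (P? ∘ suc) (u ∘ suc) p) q?
      where
      best : (∃[ v ] P (suc v) × (∀ w → P (suc w) → u (suc w) ≤ u (suc v))) → Dec (P zero) → Maximum
      best (v , p , max) (no ¬q) = suc v , p , λ { zero q → ⊥-elim (¬q q) ; (suc w) → max w }
      best (v , p , max) (yes q) with total (u zero) (u (suc v))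
      ... | inj₁ z≤v = suc v , p , λ { zero _ → z≤v ; (suc w) → max w }
      ... | inj₂ v≤z = zero , q , λ { zero _ → ≤-refl ; (suc w) r → ≤-trans (max w r) v≤z }

  module _ {h : ℕ} where

    isSimplex-resp : ∀ {C C′ : Region (Fin h)} {d} → C ≐ C′ → IsSimplex d C′ → IsSimplex d C
    isSimplex-resp e (n , v , d , ai , e′) = n , v , d , ai , ≐-trans e e′

    isFace-resp : ∀ {F F′ C C′ : Region (Fin h)} → F ≐ F′ → C ≐ C′ → IsFace F′ C′ → IsFace F C
    isFace-resp (F⊆ , ⊆F) (C⊆ , ⊆C) (u , b , bound , F′⊆ , ⊆F′) =
      u , b , (λ x∈ → bound (C⊆ x∈)) ,
      (λ x∈ → let x∈C′ , e = F′⊆ (F⊆ x∈) in ⊆C x∈C′ , e) ,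
      (λ (x∈ , e) → ⊆F (⊆F′ (C⊆ x∈ , e)))

    ∙-linear : ∀ (q u : Fin h → Carrier) x → (λ v → q v - u v) ∙ x ≈ q ∙ x - u ∙ x
    ∙-linear q u x = begin
      sum (λ v → (q v - u v) * x v) ≈⟨ sum-cong (λ v → solve 3 (λ q u x → (q :- u) :* x := q :* x :+ (:- :1) :* (u :* x)) refl (q v) (u v) (x v)) ⟩
      sum (λ v → q v * x v + - 1# * (u v * x v)) ≈⟨ ∑-distrib-+ (λ v → q v * x v) (λ v → - 1# * (u v * x v)) ⟩
      q ∙ x + sum (λ v → - 1# * (u v * x v)) ≈⟨ +-congˡ (sym (*-distribˡ-sum (- 1#) (λ v → u v * x v))) ⟩
      q ∙ x + - 1# * (u ∙ x) ≈⟨ solve 2 (λ q u → q :+ (:- :1) :* u := q :- u) refl (q ∙ x) (u ∙ x) ⟩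
      q ∙ x - u ∙ x ∎

    -- The functional is minus the mass outside W. On non-negative points it is at most 0, with
    -- equality exactly if every coordinate outside W vanishes.
    supported-face : ∀ {C F : Region (Fin h)} → (∀ {x} → x ∈ C → ∀ v → 0# ≤ x v) →
      ∀ W → F ≐ (C ∩ SupportedIn W) → IsFace F C
    supported-face {C} {F} C≥0 W (F⊆ , ⊆F) = u , 0# , bound , to , from
      where
      q u : Fin h → Carrier
      q v = 1# - indicator W v
      u v = 0# - q v
      q≥0 : ∀ v → 0# ≤ q v
      q≥0 v with v ∈?ˢ W
      ... | yes _ = ≤-reflexive (sym (-‿inverseʳ 1#))
      ... | no _ = ≤-respʳ (solve 0 (:1 := :1 :- :0) refl) (proj₁ 0<1)
      q-∈ : ∀ {v} → v ∈ˢ W → q v ≈ 0#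
      q-∈ v∈ = trans (+-congˡ (-‿cong (indicator-∈ v∈))) (-‿inverseʳ 1#)
      q-∉ : ∀ {v} → v ∉ˢ W → q v ≈ 1#
      q-∉ v∉ = trans (+-congˡ (-‿cong (indicator-∉ v∉))) (solve 0 (:1 :- :0 := :1) refl)
      u∙ : ∀ x → u ∙ x ≈ - (q ∙ x)
      u∙ x = trans (∙-linear (λ _ → 0#) q x) (trans (+-congʳ (sum-zero {h} (λ v → zeroˡ _))) (+-identityˡ _))
      bound : ∀ {x} → x ∈ C → u ∙ x ≤ 0#
      bound {x} x∈ = 0≤y-x⇒x≤y (≤-respʳ (trans (solve 1 (λ a → a := :0 :- (:- a)) refl (q ∙ x)) (+-congˡ (-‿cong (sym (u∙ x)))))
        (weighted-nonNegative q≥0 (C≥0 x∈)))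
      to : F ⊆ (C ∩ λ x → u ∙ x ≈ 0#)
      to {x} x∈ = proj₁ (F⊆ x∈) , trans (u∙ x) (trans (-‿cong (sum-zero vanish)) -0#≈0#)
        where
        vanish : ∀ v → q v * x v ≈ 0#
        vanish v with v ∈?ˢ W
        ... | yes v∈ = trans (*-congʳ (-‿inverseʳ 1#)) (zeroˡ _)
        ... | no v∉ = trans (*-congˡ (proj₂ (F⊆ x∈) v v∉)) (zeroʳ _)
      from : (C ∩ λ x → u ∙ x ≈ 0#) ⊆ F
      from {x} (x∈ , e) = ⊆F (x∈ , λ v v∉ → trans (sym (*-identityˡ _)) (trans (*-congʳ (sym (q-∉ v∉)))
        (sum≈0⇒ (λ v → *-nonNegative (q≥0 v) (C≥0 x∈ v)) q∙x≈0 v)))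
        where
        q∙x≈0 : q ∙ x ≈ 0#
        q∙x≈0 = trans (sym (-‿involutive _)) (trans (-‿cong (trans (sym (u∙ x)) e)) -0#≈0#)

    simplex-supported : ∀ {σ τ : Subset h} → τ ⊆ˢ σ → simplex τ ≐ (simplex σ ∩ SupportedIn τ)
    simplex-supported {σ} {τ} τ⊆σ = to , from
      where
      to : simplex τ ⊆ (simplex σ ∩ SupportedIn τ)
      to x∈ = proj₂ (simplex≐ σ) (record
        { nonNegative = nonNegative ; support = λ v v∉ → support v (λ v∈ → v∉ (τ⊆σ v∈)) ; total-mass = total-mass }) , support
        where open Simplicial (proj₁ (simplex≐ τ) x∈)
      from : (simplex σ ∩ SupportedIn τ) ⊆ simplex τ
      from (x∈ , supp) = proj₂ (simplex≐ τ) (record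
        { nonNegative = nonNegative ; support = supp ; total-mass = total-mass })
        where open Simplicial (proj₁ (simplex≐ σ) x∈)

    simplex-nonNegative : ∀ {σ : Subset h} {x} → x ∈ simplex σ → ∀ v → 0# ≤ x v
    simplex-nonNegative {σ} x∈ = Simplicial.nonNegative (proj₁ (simplex≐ σ) x∈)

    simplex-isFace : ∀ {σ τ : Subset h} → τ ⊆ˢ σ → IsFace (simplex τ) (simplex σ)
    simplex-isFace {σ} {τ} τ⊆σ = supported-face (λ {x} → simplex-nonNegative {σ} {x}) τ (simplex-supported τ⊆σ)

    simplex-∩ : ∀ σ τ → (simplex {h} σ ∩ simplex τ) ≐ simplex (σ Subset.∩ τ)
    simplex-∩ σ τ = to , from
      where
      to : (simplex σ ∩ simplex τ) ⊆ simplex (σ Subset.∩ τ)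
      to {x} (x∈σ , x∈τ) = proj₂ (simplex-supported (Subset.p∩q⊆p σ τ)) (x∈σ , supp)
        where
        supp : SupportedIn (σ Subset.∩ τ) x
        supp v v∉ with v ∈?ˢ σ
        ... | no v∉σ = Simplicial.support (proj₁ (simplex≐ σ) x∈σ) v v∉σ
        ... | yes v∈σ = Simplicial.support (proj₁ (simplex≐ τ) x∈τ) v (λ v∈τ → v∉ (Subset.x∈p∩q⁺ (v∈σ , v∈τ)))
      from : simplex (σ Subset.∩ τ) ⊆ (simplex σ ∩ simplex τ)
      from x∈ = proj₁ (proj₁ (simplex-supported (Subset.p∩q⊆p σ τ)) x∈) , proj₁ (proj₁ (simplex-supported (Subset.p∩q⊆q σ τ)) x∈)

    -- Since the total mass is 1, b minus u at x is the sum of the slacks b - u v weighted by x.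
    -- These are non-negative on σ, so equality confines x to the vertices where u equals b; there
    -- may be none of them.
    face-of-simplex : ∀ {F} (σ : Subset h) → IsFace F (simplex σ) → Σ[ τ ∈ Subset h ] τ ⊆ˢ σ × F ≐ simplex τ
    face-of-simplex {F} σ (u , b , bound , F⊆ , ⊆F) = τ , τ⊆σ , to , from
      where
      tight? : ∀ v → Dec (v ∈ˢ σ × u v ≈ b)
      tight? v = (v ∈?ˢ σ) ×-dec (u v ≟ b)
      τ = comprehension tight?
      τ⊆σ : τ ⊆ˢ σ
      τ⊆σ v∈ = proj₁ (∈-comprehension⁻ tight? v∈)
      u≤b : ∀ {v} → v ∈ˢ σ → u v ≤ b
      u≤b {v} v∈ = ≤-respˡ (∙-basis u v) (bound (basis∈simplex v∈))
      slack : ∀ {x} → x ∈ simplex σ → (λ v → b - u v) ∙ x ≈ b - u ∙ x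
      slack {x} x∈ = trans (∙-linear (λ _ → b) u x) (+-congʳ (trans (sym (*-distribˡ-sum b x))
        (trans (*-congˡ (Simplicial.total-mass (proj₁ (simplex≐ σ) x∈))) (*-identityʳ b))))
      to : F ⊆ simplex τ
      to {x} x∈F = proj₂ (simplex-supported τ⊆σ) (x∈ , supp)
        where
        x∈ = proj₁ (F⊆ x∈F)
        open Simplicial (proj₁ (simplex≐ σ) x∈)
        terms≥0 : ∀ v → 0# ≤ (b - u v) * x v
        terms≥0 v with v ∈?ˢ σ
        ... | yes v∈ = *-nonNegative (x≤y⇒0≤y-x (u≤b v∈)) (nonNegative v)
        ... | no v∉ = ≤-reflexive (sym (trans (*-congˡ (support v v∉)) (zeroʳ _)))
        total≈0 : (λ v → b - u v) ∙ x ≈ 0#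
        total≈0 = trans (slack x∈) (trans (+-congˡ (-‿cong (proj₂ (F⊆ x∈F)))) (-‿inverseʳ b))
        supp : SupportedIn τ x
        supp v v∉ with v ∈?ˢ σ
        ... | no v∉σ = support v v∉σ
        ... | yes v∈σ = *≈0⇒ (λ e → v∉ (∈-comprehension⁺ tight? (v∈σ , sym (x-y≈0⇒x≈y e)))) (sum≈0⇒ terms≥0 total≈0 v)
      from : simplex τ ⊆ F
      from {x} x∈τ = ⊆F (x∈ , sym (x-y≈0⇒x≈y (trans (sym (slack x∈)) (sum-zero vanish))))
        where
        x∈ = proj₁ (proj₁ (simplex-supported τ⊆σ) x∈τ)
        vanish : ∀ v → (b - u v) * x v ≈ 0#
        vanish v with v ∈?ˢ τ
        ... | no v∉ = trans (*-congˡ (Simplicial.support (proj₁ (simplex≐ τ) x∈τ) v v∉)) (zeroʳ _)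
        ... | yes v∈ = trans (*-congʳ (trans (+-congˡ (-‿cong (proj₂ (∈-comprehension⁻ tight? v∈)))) (-‿inverseʳ b))) (zeroˡ _)

    affine-basis : ∀ {n} {e : Fin n → Fin h} → Injective _≡_ _≡_ e → AffinelyIndependent (basis ∘ e)
    affine-basis {e = e} inj t _ p j = trans (sym coordinate) (p (e j))
      where
      coordinate : combination t (basis ∘ e) (e j) ≈ t j
      coordinate = trans (sum-single j (λ k k≢j → trans (*-congˡ (basis-other (λ q → k≢j (inj q)))) (zeroʳ _)))
        (trans (*-congˡ (basis-same (e j))) (*-identityʳ _))

    simplex-isSimplex : ∀ {σ : Subset h} {n} → Listing σ n → IsSimplex (n ⊖ 1) (simplex σ)
    simplex-isSimplex {σ} {n} L = n , basis ∘ element , ≡.refl , affine-basis injective ,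
      conv-mono {A = Vertices σ} {B = range (basis ∘ element)} to , conv-mono {A = range (basis ∘ element)} {B = Vertices σ} from
      where
      open Listing L
      to : Vertices σ ⊆ range (basis ∘ element)
      to (v , v∈ , e) = let j , p = index v∈ in
        j , λ w → trans (e w) (reflexive (≡.cong (λ v → basis v w) (≡.sym p)))
      from : range (basis ∘ element) ⊆ Vertices σ
      from (j , e) = element j , member j , e

    -- Among the finitely many points that span C, every point of minimal
    -- support has to occur.
    extreme-bound : ∀ {C : Region (Fin h)} {n l} {v : Fin n → Point (Fin h)} → C ≐ conv (range v) →
      (∀ {x} → x ∈ C → ∀ i → 0# ≤ x i) →
      (p : Fin l → Point (Fin h)) → (∀ a → p a ∈ C) →
      (∀ a {x} → x ∈ C → (∀ i → p a i ≈ 0# → x i ≈ 0#) → x ≋ p a) →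
      (∀ {a b} → p a ≋ p b → a ≡ b) → l ℕ.≤ n
    extreme-bound {C} {n} {l} {v} (C⊆ , ⊆C) C≥0 p p∈ minimal distinct =
      Fin.injective⇒≤ {f = λ a → proj₁ (occurs a)} λ {a} {b} e → distinct λ i →
        trans (sym (proj₂ (occurs a) i)) (trans (reflexive (≡.cong (λ k → v k i) e)) (proj₂ (occurs b) i))
      where
      v∈ : ∀ k → v k ∈ C
      v∈ k = ⊆C (conv-⊇ {A = range v} (k , λ _ → refl))
      occurs′ : ∀ a → p a ∈ conv (range v) → ∃[ k ] v k ≋ p a
      occurs′ a (N , w , t , w∈ , t≥ , s , e) = k , minimal a (v∈ k) vanish
        where
        -- All summands being non-negative, a spanning point with nonzero weight vanishes wherever
        -- `p a` does; minimality then identifies it with `p a`.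
        nonzero : ∃[ j ] ¬ t j ≈ 0#
        nonzero = sum≉0⇒ t (λ z → 0≉1 (trans (sym z) s))
        j = proj₁ nonzero
        k = proj₁ (w∈ j)
        w≥0 : ∀ j i → 0# ≤ w j i
        w≥0 j i = ≤-respʳ (sym (proj₂ (w∈ j) i)) (C≥0 (v∈ (proj₁ (w∈ j))) i)
        vanish : ∀ i → p a i ≈ 0# → v k i ≈ 0#
        vanish i z = trans (sym (proj₂ (w∈ j) i)) (*≈0⇒ (proj₂ nonzero)
          (sum≈0⇒ (λ j → *-nonNegative (t≥ j) (w≥0 j i)) (trans (sym (e i)) z) j))
      occurs : ∀ a → ∃[ k ] v k ≋ p a
      occurs a = occurs′ a (C⊆ (p∈ a))

    simplex-bound : ∀ {σ : Subset h} {n l} {v : Fin n → Point (Fin h)} → simplex σ ≐ conv (range v) →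
      (f : Fin l → Fin h) → Injective _≡_ _≡_ f → (∀ a → f a ∈ˢ σ) → l ℕ.≤ n
    simplex-bound {σ} e f inj f∈ = extreme-bound {C = simplex σ} e (λ {x} → simplex-nonNegative {σ} {x})
      (basis ∘ f) (λ a → basis∈simplex (f∈ a)) minimal distinct
      where
      distinct : ∀ {a b} → basis (f a) ≋ basis (f b) → a ≡ b
      distinct {a} {b} p with f a Fin.≟ f b
      ... | yes q = inj q
      ... | no q = ⊥-elim (0≉1 (trans (sym (basis-other (q ∘ ≡.sym))) (trans (sym (p (f a))) (basis-same (f a)))))
      minimal : ∀ a {x} → x ∈ simplex σ → (∀ i → basis (f a) i ≈ 0# → x i ≈ 0#) → x ≋ basis (f a)
      minimal a {x} x∈ supp i with f a Fin.≟ i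
      ... | no q = supp i (basis-other q)
      ... | yes ≡.refl = trans (sym (sum-single (f a) (λ j j≢ → supp j (basis-other (j≢ ∘ ≡.sym)))))
        (Simplicial.total-mass (proj₁ (simplex≐ σ) x∈))

    mass-agree : ∀ {α β : Subset h} {x : Point (Fin h)} →
      (∀ v → x v ≈ 0# ⊎ (v ∈ˢ α ⇔ v ∈ˢ β)) → indicator α ∙ x ≈ indicator β ∙ x
    mass-agree {α} {β} {x} agree = sum-cong λ v → term v (agree v)
      where
      term : ∀ v → x v ≈ 0# ⊎ (v ∈ˢ α ⇔ v ∈ˢ β) → indicator α v * x v ≈ indicator β v * x v
      term v (inj₁ z) = trans (trans (*-congˡ z) (zeroʳ _)) (sym (trans (*-congˡ z) (zeroʳ _)))
      term v (inj₂ α⇔β) with v ∈?ˢ β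
      ... | yes v∈ = *-congʳ (indicator-∈ (Equivalence.from α⇔β v∈))
      ... | no v∉ = *-congʳ (indicator-∉ (λ v∈ → v∉ (Equivalence.to α⇔β v∈)))

    module _ {g} {σ τ : Fin g → Subset h} (disjoint : Disjoint σ) {W : Subset h}
             (τ⇔ : ∀ i v → v ∈ˢ τ i ⇔ (v ∈ˢ σ i × v ∈ˢ W)) where

      -- Deleting elements at which x vanishes does not change the mass of a block. Disjointness
      -- ensures that an element of `σ i` covered by some block of τ is covered by `τ i`.
      subcell : Cell τ ≐ (Cell σ ∩ SupportedIn W)
      subcell = to , from
        where
        τ⊆σ : ∀ {i v} → v ∈ˢ τ i → v ∈ˢ σ i
        τ⊆σ v∈ = proj₁ (Equivalence.to (τ⇔ _ _) v∈)
        to : Cell τ ⊆ (Cell σ ∩ SupportedIn W)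
        to {x} X = record
          { nonNegative = nonNegative
          ; support = λ v v∉ → support v λ v∈ → let i , p = ∈-Union⁻ τ v∈ in v∉ (∈-Union⁺ σ (τ⊆σ p))
          ; block-mass = λ i → trans (mass-agree (agree i)) (block-mass i)
          } , λ v v∉ → support v λ v∈ → let i , p = ∈-Union⁻ τ v∈ in v∉ (proj₂ (Equivalence.to (τ⇔ i v) p))
          where
          open Cell X
          agree : ∀ i v → x v ≈ 0# ⊎ (v ∈ˢ σ i ⇔ v ∈ˢ τ i)
          agree i v with v ∈?ˢ Union τ
          ... | no v∉ = inj₁ (support v v∉)
          ... | yes v∈ = inj₂ (mk⇔ down τ⊆σ)
            where
            down : v ∈ˢ σ i → v ∈ˢ τ i
            down p = let j , q = ∈-Union⁻ τ v∈ in ≡.subst (λ k → v ∈ˢ τ k) (disjoint (τ⊆σ q) p) q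
        from : (Cell σ ∩ SupportedIn W) ⊆ Cell τ
        from {x} (X , supp) = record
          { nonNegative = nonNegative
          ; support = support′
          ; block-mass = λ i → trans (mass-agree (agree i)) (block-mass i)
          }
          where
          open Cell X
          support′ : SupportedIn (Union τ) x
          support′ v v∉ with v ∈?ˢ W | v ∈?ˢ Union σ
          ... | no v∉W | _ = supp v v∉W
          ... | yes _ | no v∉σ = support v v∉σ
          ... | yes v∈W | yes v∈σ = let i , p = ∈-Union⁻ σ v∈σ in
            ⊥-elim (v∉ (∈-Union⁺ τ (Equivalence.from (τ⇔ i v) (p , v∈W))))
          agree : ∀ i v → x v ≈ 0# ⊎ (v ∈ˢ τ i ⇔ v ∈ˢ σ i)
          agree i v with v ∈?ˢ W
          ... | no v∉ = inj₁ (supp v v∉)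
          ... | yes v∈ = inj₂ (mk⇔ τ⊆σ (λ p → Equivalence.from (τ⇔ i v) (p , v∈)))

    module _ {g} {σ : Fin g → Subset h} (disjoint : Disjoint σ) (transversal : Transversal σ) where

      -- A functional is maximised on every block separately, because the mass of each block is
      -- fixed at 1/g. So M is the sum of the block maxima divided by g, and it is attained exactly
      -- by the points supported on the maximisers W. As F is nonempty, its bound b must be M.
      face-of-cell : ∀ {F : Region (Fin h)} (u : Fin h → Carrier) b → (∀ {x} → x ∈ Cell σ → u ∙ x ≤ b) →
        F ≐ (Cell σ ∩ λ x → u ∙ x ≈ b) → Satisfiable F →
        Σ[ τ ∈ (Fin g → Subset h) ] Transversal τ × (∀ i → τ i ⊆ˢ σ i) × F ≐ Cell τ
      face-of-cell {F} u b bound (F⊆ , ⊆F) (x₀ , x₀∈) =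
        τ , (λ i → s i , ∈-τ⁺ (s∈ i) (∈-comprehension⁺ tight? (sym (q-∈ (s∈ i))))) , (λ i v∈ → proj₁ (∈-τ⁻ v∈)) ,
        (λ x∈ → proj₂ (subcell disjoint τ⇔) (F⇒ x∈)) , (λ x∈ → ⇒F (proj₁ (subcell disjoint τ⇔) x∈))
        where
        maximum : ∀ i → ∃[ v ] v ∈ˢ σ i × (∀ w → w ∈ˢ σ i → u w ≤ u v)
        maximum i = argmax (_∈?ˢ σ i) u (transversal i)
        s : Fin g → Fin h
        s i = proj₁ (maximum i)
        s∈ : Selection σ s
        s∈ i = proj₁ (proj₂ (maximum i))
        -- The maximum of u on the block of v.
        q : Fin h → Carrier
        q v = sum (λ i → u (s i) * indicator (σ i) v)
        q-∈ : ∀ {i v} → v ∈ˢ σ i → q v ≈ u (s i)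
        q-∈ {i} {v} v∈ = trans
          (sum-single i (λ j j≢i → trans (*-congˡ (indicator-∉ (λ v∈j → j≢i (disjoint v∈j v∈)))) (zeroʳ _)))
          (trans (*-congˡ (indicator-∈ v∈)) (*-identityʳ _))
        tight? : ∀ v → Dec (u v ≈ q v)
        tight? v = u v ≟ q v
        W = comprehension tight?
        τ : Fin g → Subset h
        τ i = σ i Subset.∩ W
        ∈-τ⁺ : ∀ {i v} → v ∈ˢ σ i → v ∈ˢ W → v ∈ˢ τ i
        ∈-τ⁺ p q = Subset.x∈p∩q⁺ (p , q)
        ∈-τ⁻ : ∀ {i v} → v ∈ˢ τ i → v ∈ˢ σ i × v ∈ˢ W
        ∈-τ⁻ {i} = Subset.x∈p∩q⁻ (σ i) W
        τ⇔ : ∀ i v → v ∈ˢ τ i ⇔ (v ∈ˢ σ i × v ∈ˢ W)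
        τ⇔ i v = mk⇔ ∈-τ⁻ (λ (p , q) → ∈-τ⁺ p q)
        M : Carrier
        M = sum (λ i → u (s i) * 1/ g)
        q∙ : ∀ {x} → x ∈ Cell σ → q ∙ x ≈ M
        q∙ {x} X = begin
          sum (λ v → sum (λ i → u (s i) * indicator (σ i) v) * x v) ≈⟨ sum-cong (λ v → *-distribʳ-sum (x v) (λ i → u (s i) * indicator (σ i) v)) ⟩
          sum (λ v → sum (λ i → u (s i) * indicator (σ i) v * x v)) ≈⟨ ∑-comm (λ v i → u (s i) * indicator (σ i) v * x v) ⟩
          sum (λ i → sum (λ v → u (s i) * indicator (σ i) v * x v)) ≈⟨ sum-cong (λ i → trans (sum-cong (λ v → *-assoc (u (s i)) (indicator (σ i) v) (x v)))
                                                                                           (sym (*-distribˡ-sum (u (s i)) (λ v → indicator (σ i) v * x v)))) ⟩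
          sum (λ i → u (s i) * (indicator (σ i) ∙ x)) ≈⟨ sum-cong (λ i → *-congˡ (Cell.block-mass X i)) ⟩
          M ∎
        slack : ∀ {x} → x ∈ Cell σ → (λ v → q v - u v) ∙ x ≈ M - u ∙ x
        slack {x} X = trans (∙-linear q u x) (+-congʳ (q∙ X))
        terms≥0 : ∀ {x} → x ∈ Cell σ → ∀ v → 0# ≤ (q v - u v) * x v
        terms≥0 {x} X v with v ∈?ˢ Union σ
        ... | no v∉ = ≤-reflexive (sym (trans (*-congˡ (Cell.support X v v∉)) (zeroʳ _)))
        ... | yes v∈ = let i , p = ∈-Union⁻ σ v∈ in
          *-nonNegative (x≤y⇒0≤y-x (≤-respʳ (sym (q-∈ p)) (proj₂ (proj₂ (maximum i)) v p))) (Cell.nonNegative X v)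
        u≤M : ∀ {x} → x ∈ Cell σ → u ∙ x ≤ M
        u≤M X = 0≤y-x⇒x≤y (≤-respʳ (slack X) (sum-nonNegative (terms≥0 X)))
        tight⇒ : ∀ {x} → x ∈ Cell σ → SupportedIn W x → u ∙ x ≈ M
        tight⇒ {x} X supp = sym (x-y≈0⇒x≈y (trans (sym (slack X)) (sum-zero vanish)))
          where
          vanish : ∀ v → (q v - u v) * x v ≈ 0#
          vanish v with v ∈?ˢ W
          ... | no v∉ = trans (*-congˡ (supp v v∉)) (zeroʳ _)
          ... | yes v∈ = trans (*-congʳ (trans (+-congˡ (-‿cong (∈-comprehension⁻ tight? v∈))) (-‿inverseʳ _))) (zeroˡ _)
        corner-supported : SupportedIn W (corner s)
        corner-supported v v∉ = corner-∉ λ i e →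
          v∉ (≡.subst (_∈ˢ W) e (∈-comprehension⁺ tight? (sym (q-∈ (s∈ i)))))
        -- A point of F gives b ≤ M, and the corner at the chosen maximisers gives M ≤ b.
        b≈M : b ≈ M
        b≈M = antisym
          (≤-respˡ (proj₂ (F⊆ x₀∈)) (u≤M (proj₁ (F⊆ x₀∈))))
          (≤-respˡ (tight⇒ (corner∈Cell disjoint s∈) corner-supported) (bound (corner∈Cell disjoint s∈)))
        F⇒ : F ⊆ (Cell σ ∩ SupportedIn W)
        F⇒ {x} x∈ = X , λ v v∉ → *≈0⇒ (λ e → v∉ (∈-comprehension⁺ tight? (sym (x-y≈0⇒x≈y e)))) (sum≈0⇒ (terms≥0 X) total≈0 v)
          where
          X = proj₁ (F⊆ x∈)
          total≈0 : (λ v → q v - u v) ∙ x ≈ 0#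
          total≈0 = trans (slack X) (trans (+-congˡ (-‿cong (trans (proj₂ (F⊆ x∈)) b≈M))) (-‿inverseʳ M))
        ⇒F : (Cell σ ∩ SupportedIn W) ⊆ F
        ⇒F (X , supp) = ⊆F (X , trans (tight⇒ X supp) (sym b≈M))

-- Changing one value of a family, removing one element of a subset

module _ {a} {A : Set a} {n : ℕ} where

  infixl 6 _[_≔_]
  _[_≔_] : (Fin n → A) → Fin n → A → Fin n → A
  s [ i ≔ u ] = updateAt s i (λ _ → u)

  ≔-same : ∀ s i {u} → (s [ i ≔ u ]) i ≡ u
  ≔-same s i = updateAt-updates i s

  ≔-other : ∀ s {i j u} → j ≢ i → (s [ i ≔ u ]) j ≡ s j
  ≔-other s {i} {j} j≢i = updateAt-minimal j i s j≢i

x∉p-x : ∀ {n} (p : Subset n) x → x ∉ˢ p Subset.- x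
x∉p-x (_ ∷ p) zero    ()
x∉p-x (_ ∷ p) (suc x) (there x∈) = x∉p-x p x x∈

x∈p-y⇒ : ∀ {n} {p : Subset n} {x y} → x ∈ˢ p Subset.- y → x ∈ˢ p × x ≢ y
x∈p-y⇒ {p = p} {x} {y} x∈ = Subset.p─q⊆p p ⁅ y ⁆ x∈ , λ { ≡.refl → x∉p-x p x x∈ }

-- Graphs without cliques of more than g elements: intersections of cells

module CliqueComplexes {c ℓ₁ ℓ₂} (𝕂 : OrderedField c ℓ₁ ℓ₂) {h g : ℕ}
  (_~_ : Rel (Fin h) (Geometry.ℓ 𝕂))
  (~-sym : ∀ {u v} → u ~ v → v ~ u)
  (~-irrefl : ∀ {u} → ¬ u ~ u)
  (bound : ∀ {n} (f : Fin n → Fin h) → (∀ {i j} → i ≢ j → f i ~ f j) → n ℕ.≤ g) where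

  open Geometry 𝕂
  open OrderedFieldProperties 𝕂
  open Convexity 𝕂
  open Cells 𝕂
  open Faces 𝕂
  open SetoidReasoning setoid

  private
    Choice : Set
    Choice = Fin g → Fin h

    Sets : Set
    Sets = Fin g → Subset h

    Compat : Sets → Set ℓ
    Compat = Compatible _~_ g

  compatible⇒disjoint : ∀ {σ : Sets} → Compat σ → Disjoint σ
  compatible⇒disjoint {σ} compat {i} {j} v∈i v∈j with i Fin.≟ j
  ... | yes p = p
  ... | no i≢j = ⊥-elim (~-irrefl (compat i≢j v∈i v∈j))

  compatible-⊆ : ∀ {σ τ : Sets} → (∀ i → τ i ⊆ˢ σ i) → Compat σ → Compat τ
  compatible-⊆ τ⊆σ compat i≢j u∈ v∈ = compat i≢j (τ⊆σ _ u∈) (τ⊆σ _ v∈)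

  ≔-selection : ∀ {σ : Sets} {s} i {u} → Selection σ s → u ∈ˢ σ i → Selection σ (s [ i ≔ u ])
  ≔-selection {σ} {s} i {u} s∈ u∈ j with j Fin.≟ i
  ... | yes ≡.refl = ≡.subst (_∈ˢ σ i) (≡.sym (≔-same s i)) u∈
  ... | no j≢i = ≡.subst (_∈ˢ σ j) (≡.sym (≔-other s j≢i)) (s∈ j)

  -- If u and v were adjacent, these would be g + 1 pairwise adjacent elements.
  enlarged : ∀ {σ : Sets} → Transversal σ → ∀ {i u} → u ∈ˢ σ i → Fin h → Fin (suc g) → Fin h
  enlarged transversal {i} {u} _ v = v ◂ ((λ j → proj₁ (transversal j)) [ i ≔ u ])

  module _ {σ : Sets} (transversal : Transversal σ) (compat : Compat σ) {i u v}
           (u∈ : u ∈ˢ σ i) (v∈ : v ∈ˢ σ i) where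

    private
      s₀ s : Choice
      s₀ j = proj₁ (transversal j)
      s = s₀ [ i ≔ u ]
      s∈ : Selection σ s
      s∈ = ≔-selection {σ} {s₀} i (λ j → proj₂ (transversal j)) u∈

    block-nonadjacent : ¬ v ~ u
    block-nonadjacent v~u = ℕ.1+n≰n (bound (enlarged transversal u∈ v) adjacent)
      where
      new : ∀ j → v ~ s j
      new j with j Fin.≟ i
      ... | yes ≡.refl = ≡.subst (v ~_) (≡.sym (≔-same s₀ i)) v~u
      ... | no j≢i = compat (j≢i ∘ ≡.sym) v∈ (s∈ j)
      adjacent : ∀ {j k} → j ≢ k → (v ◂ s) j ~ (v ◂ s) k
      adjacent {zero}  {zero}  z≢z = ⊥-elim (z≢z ≡.refl)
      adjacent {zero}  {suc k} _ = new k
      adjacent {suc j} {zero}  _ = ~-sym (new j)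
      adjacent {suc j} {suc k} j≢k = compat (j≢k ∘ ≡.cong suc) (s∈ j) (s∈ k)

    -- Two elements of one block give g + 1 distinct elements of the union. A union with only g
    -- elements therefore has singletons as blocks, which settles the dimension count for
    -- transversal simplices.
    enlarged-injective : u ≢ v → Injective _≡_ _≡_ (enlarged transversal u∈ v)
    enlarged-injective u≢v {zero}  {zero}  _ = ≡.refl
    enlarged-injective u≢v {zero}  {suc k} e = ⊥-elim (new k e)
      where
      new : ∀ j → v ≢ s j
      new j e with j Fin.≟ i
      ... | yes ≡.refl = u≢v (≡.sym (≡.trans e (≔-same s₀ i)))
      ... | no j≢i = j≢i (compatible⇒disjoint compat (≡.subst (_∈ˢ σ j) (≡.sym e) (s∈ j)) v∈)
    enlarged-injective u≢v {suc j} {zero}  e = ≡.sym (enlarged-injective u≢v {zero} {suc j} (≡.sym e))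
    enlarged-injective u≢v {suc j} {suc k} e = ≡.cong suc (selection-injective (compatible⇒disjoint compat) s∈ e)

    enlarged∈Union : ∀ j → enlarged transversal u∈ v j ∈ˢ Union σ
    enlarged∈Union zero    = ∈-Union⁺ σ v∈
    enlarged∈Union (suc j) = ∈-Union⁺ σ (s∈ j)

  -- By the clique bound the blocks of σ are the classes of non-adjacency on
  -- their union, so two cells induce the same partition where they overlap.
  cells-intersection : ∀ {σ τ : Sets} → Transversal σ → Compat σ → Transversal τ → Compat τ →
    (Cell σ ∩ Cell τ) ≐ (Cell σ ∩ SupportedIn (Union τ))
  cells-intersection {σ} {τ} tσ cσ tτ cτ = (λ (X , Y) → X , Cell.support Y) , λ (X , supp) → X , transfer X supp
    where
    same-block : ∀ {σ τ : Sets} → Transversal σ → Compat σ → Compat τ → ∀ {i k l v w} →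
      v ∈ˢ σ i → w ∈ˢ σ i → w ∈ˢ τ k → v ∈ˢ τ l → v ∈ˢ τ k
    same-block {τ = τ} tσ cσ cτ {k = k} {l} {v} v∈σ w∈σ w∈τ v∈τ = ≡.subst (λ k → v ∈ˢ τ k)
      (≡.sym (decidable-stable (k Fin.≟ l) λ k≢l → block-nonadjacent tσ cσ v∈σ w∈σ (cτ k≢l w∈τ v∈τ))) v∈τ
    -- The elements `w i` come from different blocks of σ and are pairwise adjacent, so no two of
    -- them share a block of τ. Hence the g indices `ρ i` are distinct and exhaust the blocks of τ.
    every-block : (w : Fin g → Fin h) (ρ : Fin g → Fin g) → (∀ i → w i ∈ˢ σ i) → (∀ i → w i ∈ˢ τ (ρ i)) →
      ∀ k → ∃[ i ] w i ∈ˢ τ k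
    every-block w ρ w∈σ w∈τ k = let i , e = injective⇒surjective ρ-injective k in
      i , ≡.subst (λ k → w i ∈ˢ τ k) e (w∈τ i)
      where
      ρ-injective : Injective _≡_ _≡_ ρ
      ρ-injective {i} {j} e = decidable-stable (i Fin.≟ j) λ i≢j →
        block-nonadjacent tτ cτ (w∈τ i) (≡.subst (λ k → w j ∈ˢ τ k) (≡.sym e) (w∈τ j))
          (~-sym (cσ i≢j (w∈σ i) (w∈σ j)))
    module _ {x} (X : x ∈ Cell σ) (supp : SupportedIn (Union τ) x) where
      open Cell X
      -- Such a v exists for every i: block i carries the positive mass 1/g, while x vanishes
      -- outside `Union τ`.
      Heavy : Fin g → Fin h → Set
      Heavy i v = v ∈ˢ σ i × (∃[ k ] v ∈ˢ τ k)
      heavy : ∀ i → ∃ (Heavy i)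
      heavy i = found (sum≉0⇒ (λ v → indicator (σ i) v * x v) (λ e → <⇒≉ (1/g-positive i) (trans (sym (block-mass i)) e)))
        where
        found : ∃[ v ] ¬ indicator (σ i) v * x v ≈ 0# → ∃ (Heavy i)
        found (v , ≉0) = v ,
          decidable-stable (v ∈?ˢ σ i) (λ p → ≉0 (trans (*-congʳ (indicator-∉ p)) (zeroˡ _))) ,
          ∈-Union⁻ τ (decidable-stable (v ∈?ˢ Union τ) (λ q → ≉0 (trans (*-congˡ (supp v q)) (zeroʳ _))))
      agree : ∀ {i k w} → w ∈ˢ σ i → w ∈ˢ τ k → ∀ v → Dec (v ∈ˢ Union σ) → Dec (v ∈ˢ Union τ) →
        x v ≈ 0# ⊎ (v ∈ˢ τ k ⇔ v ∈ˢ σ i)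
      agree _ _ v (no p) _ = inj₁ (support v p)
      agree _ _ v (yes _) (no q) = inj₁ (supp v q)
      agree w∈i w∈k v (yes p) (yes q) = inj₂ (mk⇔
        (λ v∈τ → same-block tτ cτ cσ v∈τ w∈k w∈i (proj₂ (∈-Union⁻ σ p)))
        (λ v∈σ → same-block tσ cσ cτ v∈σ w∈i w∈k (proj₂ (∈-Union⁻ τ q))))
      masses : (∀ k → ∃[ i ] ∃[ w ] w ∈ˢ σ i × w ∈ˢ τ k) → ∀ k → indicator (τ k) ∙ x ≈ 1/ g
      masses hit k = with-witness (hit k)
        where
        with-witness : ∃[ i ] ∃[ w ] w ∈ˢ σ i × w ∈ˢ τ k → indicator (τ k) ∙ x ≈ 1/ g
        with-witness (i , w , w∈i , w∈k) = trans
          (mass-agree (λ v → agree w∈i w∈k v (v ∈?ˢ Union σ) (v ∈?ˢ Union τ))) (block-mass i)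
      witnesses : (∀ i → ∃ (Heavy i)) → ∀ k → ∃[ i ] ∃[ w ] w ∈ˢ σ i × w ∈ˢ τ k
      witnesses H k = let i , w∈k = every-block (λ i → proj₁ (H i)) (λ i → proj₁ (proj₂ (proj₂ (H i))))
                            (λ i → proj₁ (proj₂ (H i))) (λ i → proj₂ (proj₂ (proj₂ (H i)))) k
                      in i , proj₁ (H i) , proj₁ (proj₂ (H i)) , w∈k
      transfer : x ∈ Cell τ
      transfer = record
        { nonNegative = nonNegative
        ; support = supp
        ; block-mass = masses (witnesses heavy)
        }

  cell-nonNegative : ∀ {σ : Sets} {x} → x ∈ Cell σ → ∀ v → 0# ≤ x v
  cell-nonNegative X = Cell.nonNegative X

  cells-meet : ∀ {σ τ : Sets} {C D : Region (Fin h)} → C ≐ Cell σ → D ≐ Cell τ →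
    Transversal σ → Compat σ → Transversal τ → Compat τ → IsFace (C ∩ D) C
  cells-meet {σ} {τ} {C} {D} (C⊆ , ⊆C) (D⊆ , ⊆D) tσ cσ tτ cτ =
    supported-face {C = C} {F = C ∩ D} (λ x∈ → cell-nonNegative {σ} (C⊆ x∈)) (Union τ)
      ((λ (x∈C , x∈D) → x∈C , proj₂ (proj₁ common (C⊆ x∈C , D⊆ x∈D))) ,
       (λ (x∈C , supp) → x∈C , ⊆D (proj₂ (proj₂ common (C⊆ x∈C , supp)))))
    where common = cells-intersection tσ cσ tτ cτ

  -- The projected families as polytopal and simplicial complexes

  HomImage Hom₊Image Hom₊ᵗImage : Family (Fin h) (lsuc ℓ)
  HomImage   = images π (Hom _~_ g)
  Hom₊Image  = images π (Hom₊ _~_ g)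
  Hom₊ᵗImage = images π (Hom₊ᵗ _~_ g)

  image-≐ : ∀ {I J} (f : Point I → Point J) {C D : Region I} → C ≐ D → image f C ≐ image f D
  image-≐ f (C⊆ , ⊆C) = (λ (x , x∈ , e) → x , C⊆ x∈ , e) , (λ (x , x∈ , e) → x , ⊆C x∈ , e)

  IsCell : Region (Fin h) → Set ℓ
  IsCell C = Σ[ σ ∈ Sets ] Transversal σ × Compat σ × C ≐ Cell σ

  HomImage⇒ : ∀ {C} → C ∈ HomImage → IsCell C
  HomImage⇒ (C₀ , (σ , t , c , e) , e′) =
    σ , t , c , ≐-trans e′ (≐-trans (image-≐ π e) (image-⨉ (compatible⇒disjoint c)))

  ⇒HomImage : ∀ {C} → IsCell C → C ∈ HomImage
  ⇒HomImage (σ , t , c , e) = ⨉ σ , (σ , t , c , ≐-refl) , ≐-trans e (≐-sym (image-⨉ (compatible⇒disjoint c)))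

  isCell-≗ : ∀ {C : Region (Fin h)} {σ τ : Sets} → Compat σ → C ≐ Cell σ → (∀ i → σ i ≡ τ i) → C ≐ image π (⨉ τ)
  isCell-≗ {σ = σ} {τ} c e σ≗τ = ≐-trans e (≐-trans (cell-cong σ≗τ , cell-cong (≡.sym ∘ σ≗τ)) (≐-sym (image-⨉ disjoint)))
    where
    disjoint : Disjoint τ
    disjoint {i} {j} {v} v∈i v∈j = compatible⇒disjoint c
      (≡.subst (v ∈ˢ_) (≡.sym (σ≗τ i)) v∈i) (≡.subst (v ∈ˢ_) (≡.sym (σ≗τ j)) v∈j)

  isCell-isPolytope : ∀ {C} → IsCell C → IsPolytope C
  isCell-isPolytope {C} (σ , t , c , e) = from-cell (cell-isPolytope (compatible⇒disjoint c) t)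
    where
    from-cell : Σ[ n ∈ ℕ ] Σ[ v ∈ (Fin n → Point (Fin h)) ] Cell σ ≐ conv (range v) → IsPolytope C
    from-cell (n , v , e′) = n , v , ≐-trans e e′

  isCell-face : ∀ {C F} → IsCell C → IsFace F C → Satisfiable F → IsCell F
  isCell-face {C} {F} (σ , t , c , C⊆ , ⊆C) (u , b , u≤b , F⊆ , ⊆F) sat = as-cell
    (face-of-cell (compatible⇒disjoint c) t u b (λ x∈ → u≤b (⊆C x∈))
      ((λ x∈ → C⊆ (proj₁ (F⊆ x∈)) , proj₂ (F⊆ x∈)) , (λ (x∈ , p) → ⊆F (⊆C x∈ , p))) sat)
    where
    as-cell : Σ[ τ ∈ Sets ] Transversal τ × (∀ i → τ i ⊆ˢ σ i) × F ≐ Cell τ → IsCell F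
    as-cell (τ , t′ , τ⊆σ , e′) = τ , t′ , compatible-⊆ τ⊆σ c , e′

  isCell-meet : ∀ {C D} → IsCell C → IsCell D → IsFace (C ∩ D) C × IsFace (C ∩ D) D
  isCell-meet {C} {D} (σ , tσ , cσ , eσ) (τ , tτ , cτ , eτ) =
    cells-meet eσ eτ tσ cσ tτ cτ ,
    isFace-resp {F = C ∩ D} {F′ = D ∩ C} {C = D} {C′ = D} ((λ (p , q) → q , p) , (λ (p , q) → q , p)) ≐-refl (cells-meet eτ eσ tτ cτ tσ cσ)

  decode-all : Fin ((2 ℕ.^ h) ℕ.^ g) → Sets
  decode-all k i = decode (Fin.finToFun k i)

  encode-all : ∀ (σ : Sets) → ∃[ k ] (∀ i → σ i ≡ decode-all k i)
  encode-all σ = Fin.funToFin (λ i → encode (σ i)) , λ i →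
    ≡.sym (≡.trans (≡.cong decode (Fin.finToFun-funToFin (λ i → encode (σ i)) i)) (decode-encode (σ i)))

  homImage-isPolytopalComplex : IsPolytopalComplex HomImage
  homImage-isPolytopalComplex = record
    { finite = (2 ℕ.^ h) ℕ.^ g , (λ k → image π (⨉ (decode-all k))) , λ C∈ → listed (HomImage⇒ C∈)
    ; polytopes = λ C∈ → isCell-isPolytope (HomImage⇒ C∈)
    ; faces = λ C∈ isFace sat → ⇒HomImage (isCell-face (HomImage⇒ C∈) isFace sat)
    ; meets = λ C∈ D∈ → isCell-meet (HomImage⇒ C∈) (HomImage⇒ D∈)
    }
    where
    listed : ∀ {C} → IsCell C → ∃[ k ] C ≐ image π (⨉ (decode-all k))
    listed {C} (σ , _ , c , e) = let k , σ≗ = encode-all σ in k , isCell-≗ {C} {σ} {decode-all k} c e σ≗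

  -- Faces of coordinate simplices are spanned by subsets of their vertices, and two of them meet in
  -- the simplex on the common vertices. What remains to be checked for a given family is closure
  -- under subsets.
  simplicial : ∀ {l} {𝓒 : Family (Fin h) l} (IsMember : Subset h → Set ℓ) →
    (∀ {C} → C ∈ 𝓒 → ∃[ σ ] IsMember σ × C ≐ simplex σ) →
    (∀ {C σ} → IsMember σ → C ≐ simplex σ → C ∈ 𝓒) →
    (∀ {σ τ} → τ ⊆ˢ σ → IsMember σ → IsMember τ) → IsSimplicialComplex 𝓒
  simplicial {𝓒 = 𝓒} IsMember to from down = record
    { isPolytopalComplex = record
      { finite = 2 ℕ.^ h , (λ k → simplex (decode k)) , λ C∈ → let σ , _ , e = to C∈ in
          encode σ , ≐-trans e (simplex-≡ (≡.sym (decode-encode σ)))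
      ; polytopes = λ C∈ → let σ , _ , e = to C∈ ; n , v , _ , _ , e′ = simplex-isSimplex (proj₂ (listing σ)) in
          n , v , ≐-trans e e′
      ; faces = λ C∈ isFace _ → let σ , m , e = to C∈
                                    τ , τ⊆σ , e′ = face-of-simplex σ (isFace-resp ≐-refl (≐-sym e) isFace)
                                in from (down τ⊆σ m) e′
      ; meets = λ C∈ D∈ → meet (to C∈) (to D∈)
      }
    ; simplices = λ C∈ → let σ , _ , e = to C∈ in _ , isSimplex-resp e (simplex-isSimplex (proj₂ (listing σ)))
    }
    where
    simplex-≡ : ∀ {σ τ : Subset h} → σ ≡ τ → simplex σ ≐ simplex τ
    simplex-≡ ≡.refl = ≐-refl
    meet : ∀ {C D : Region (Fin h)} → ∃[ σ ] IsMember σ × C ≐ simplex σ → ∃[ τ ] IsMember τ × D ≐ simplex τ →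
           IsFace (C ∩ D) C × IsFace (C ∩ D) D
    meet {C} {D} (σ , _ , eσ) (τ , _ , eτ) =
      isFace-resp meet≐ eσ (simplex-isFace (Subset.p∩q⊆p σ τ)) ,
      isFace-resp meet≐ eτ (simplex-isFace (Subset.p∩q⊆q σ τ))
      where
      meet≐ : (C ∩ D) ≐ simplex (σ Subset.∩ τ)
      meet≐ = ≐-trans ((λ (p , q) → proj₁ eσ p , proj₁ eτ q) , (λ (p , q) → proj₂ eσ p , proj₂ eτ q)) (simplex-∩ σ τ)

  image-⋆-compatible : ∀ {σ : Sets} → Compat σ → image π (⋆ σ) ≐ simplex (Union σ)
  image-⋆-compatible c = image-⋆ (compatible⇒disjoint c)

  private
    restrict : Sets → Subset h → Sets
    restrict σ τ i = σ i Subset.∩ τ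

    restrict-⊆ : ∀ σ τ i → restrict σ τ i ⊆ˢ σ i
    restrict-⊆ σ τ i = Subset.p∩q⊆p (σ i) τ

    Union-restrict : ∀ (σ : Sets) {τ} → τ ⊆ˢ Union σ → Union (restrict σ τ) ≡ τ
    Union-restrict σ {τ} τ⊆ = Subset.⊆-antisym
      (λ v∈ → let i , p = ∈-Union⁻ (restrict σ τ) v∈ in Subset.p∩q⊆q (σ i) τ p)
      (λ v∈ → let i , p = ∈-Union⁻ σ (τ⊆ v∈) in ∈-Union⁺ (restrict σ τ) (Subset.x∈p∩q⁺ (p , v∈)))

  hom₊Image-isSimplicialComplex : IsSimplicialComplex Hom₊Image
  hom₊Image-isSimplicialComplex = simplicial (λ U → Σ[ σ ∈ Sets ] Compat σ × Union σ ≡ U)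
    (λ { (C₀ , (σ , c , e) , e′) → Union σ , (σ , c , ≡.refl) , ≐-trans e′ (≐-trans (image-≐ π e) (image-⋆-compatible c)) })
    (λ { (σ , c , ≡.refl) e → ⋆ σ , (σ , c , ≐-refl) , ≐-trans e (≐-sym (image-⋆-compatible c)) })
    (λ { {τ = τ} τ⊆ (σ , c , ≡.refl) → restrict σ τ , compatible-⊆ (restrict-⊆ σ τ) c , Union-restrict σ τ⊆ })

  hom₊ᵗImage-isSimplicialComplex : IsSimplicialComplex Hom₊ᵗImage
  hom₊ᵗImage-isSimplicialComplex = simplicial
    (λ U → Σ[ τ ∈ Sets ] Σ[ σ ∈ Sets ] Transversal σ × Compat σ × (∀ i → τ i ⊆ˢ σ i) × Union τ ≡ U)
    (λ { (C₀ , (τ , σ , t , c , τ⊆σ , e) , e′) → Union τ , (τ , σ , t , c , τ⊆σ , ≡.refl) ,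
         ≐-trans e′ (≐-trans (image-≐ π e) (image-⋆-compatible (compatible-⊆ τ⊆σ c))) })
    (λ { (τ , σ , t , c , τ⊆σ , ≡.refl) e → ⋆ τ , (τ , σ , t , c , τ⊆σ , ≐-refl) ,
         ≐-trans e (≐-sym (image-⋆-compatible (compatible-⊆ τ⊆σ c))) })
    (λ { {τ = τ′} τ′⊆ (τ , σ , t , c , τ⊆σ , ≡.refl) → restrict τ τ′ , σ , t , c ,
         (λ i v∈ → τ⊆σ i (restrict-⊆ τ τ′ i v∈)) , Union-restrict τ τ′⊆ })

  -- Linear sections

  module _ (i₀ : Fin g) where

    private
      Lifted : Region (Fin h) → Pred (Point (Small g h)) _
      Lifted C z = ∃[ x ] x ∈ C × z ≋ [ x , (λ _ → 1/ g) ]′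

      lifted-≐ : ∀ {C D : Region (Fin h)} → C ≐ D → Lifted C ≐ Lifted D
      lifted-≐ (C⊆ , ⊆C) = (λ (x , x∈ , e) → x , C⊆ x∈ , e) , (λ (x , x∈ , e) → x , ⊆C x∈ , e)

      ∩-≐ : ∀ {C D : Region (Small g h)} → C ≐ D → (C ∩ Slice g h) ≐ (D ∩ Slice g h)
      ∩-≐ (C⊆ , ⊆C) = (λ (p , q) → C⊆ p , q) , (λ (p , q) → ⊆C p , q)

      satisfiable : ∀ {σ : Sets} → Transversal σ → Compat σ → ∀ {D : Region (Small g h)} →
        D ≐ Lifted (image π (⨉ σ)) → Satisfiable D
      satisfiable t c (_ , ⊆D) = _ , ⊆D (corner (λ i → proj₁ (t i)) ,
        proj₂ (image-⨉ (compatible⇒disjoint c)) (corner∈Cell (compatible⇒disjoint c) (λ i → proj₂ (t i))) , λ _ → refl)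

    -- The slice meets `⋆ σ` only if σ is transversal. All families between the transversal
    -- simplices and the compatible joins thus have the same section, which covers `Hom₊` and
    -- `Hom₊ᵗ` together.
    section-of : ∀ {l} (𝓒 : Family (Big g h) l) →
      (∀ {σ} → Transversal σ → Compat σ → ⋆ σ ∈ 𝓒) →
      (∀ {C} → C ∈ 𝓒 → Σ[ σ ∈ Sets ] Compat σ × C ≐ ⋆ σ) →
      (HomImage ×𝟏/ g) ≐ section (Slice g h) (images π□ 𝓒)
    section-of 𝓒 contains members = to , from
      where
      to : (HomImage ×𝟏/ g) ⊆ section (Slice g h) (images π□ 𝓒)
      to {D} (C , (C₀ , (σ , t , c , e) , e′) , e″) =
        image π□ (⋆ σ) , (⋆ σ , contains t c , ≐-refl) , ≐-trans lifted (slice≐ i₀ σ) , satisfiable t c lifted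
        where
        lifted : D ≐ Lifted (image π (⨉ σ))
        lifted = ≐-trans e″ (lifted-≐ (≐-trans e′ (image-≐ π e)))
      from : section (Slice g h) (images π□ 𝓒) ⊆ (HomImage ×𝟏/ g)
      from {D} (C , (C₀ , C₀∈ , e) , e′ , z , z∈) = let σ , c , e″ = members C₀∈ in finish σ c e″
        where
        finish : ∀ σ → Compat σ → C₀ ≐ ⋆ σ → D ∈ (HomImage ×𝟏/ g)
        finish σ c e″ = image π (⨉ σ) , (⨉ σ , (σ , slice-transversal {σ = σ} (z , proj₁ sliced z∈) , c , ≐-refl) , ≐-refl) ,
          ≐-trans sliced (≐-sym (slice≐ i₀ σ))
          where
          sliced : D ≐ (image π□ (⋆ σ) ∩ Slice g h)
          sliced = ≐-trans e′ (∩-≐ (≐-trans e (image-≐ π□ e″)))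

    section-Hom₊ : (HomImage ×𝟏/ g) ≐ section (Slice g h) (images π□ (Hom₊ _~_ g))
    section-Hom₊ = section-of (Hom₊ _~_ g) (λ {σ} _ c → σ , c , ≐-refl) (λ p → p)

    section-Hom₊ᵗ : (HomImage ×𝟏/ g) ≐ section (Slice g h) (images π□ (Hom₊ᵗ _~_ g))
    section-Hom₊ᵗ = section-of (Hom₊ᵗ _~_ g) (λ {σ} t c → σ , σ , t , c , (λ _ v∈ → v∈) , ≐-refl)
      (λ (τ , σ , t , c , τ⊆σ , e) → τ , compatible-⊆ τ⊆σ c , e)

  -- Cliques with g elements and the vertices of the projected complex

  Adj : Choice → Set ℓ
  Adj d = ∀ {i j} → i ≢ j → d i ~ d j

  Enumerates : Subset h → Choice → Set
  Enumerates S d = ∀ v → v ∈ˢ S ⇔ (∃[ i ] d i ≡ v)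

  adj⇒injective : ∀ {d} → Adj d → Injective _≡_ _≡_ d
  adj⇒injective {d} adj {i} {j} e = decidable-stable (i Fin.≟ j) λ i≢j →
    ~-irrefl (≡.subst (_~ d j) e (adj i≢j))

  adj⇒clique : ∀ {S d} → Adj d → Enumerates S d → ∀ {u v} → u ∈ˢ S → v ∈ˢ S → u ≢ v → u ~ v
  adj⇒clique {S} {d} adj enum {u} {v} u∈ v∈ = related (Equivalence.to (enum u) u∈) (Equivalence.to (enum v) v∈)
    where
    related : ∃[ i ] d i ≡ u → ∃[ j ] d j ≡ v → u ≢ v → u ~ v
    related (i , ≡.refl) (j , ≡.refl) u≢v = adj (λ { ≡.refl → u≢v ≡.refl })

  -- The family d has g indices and reaches the g distinct values of d₀, so it is injective as well;
  -- distinct elements of S are adjacent by way of d₀. This is needed because `Corresponds` admits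
  -- an arbitrary enumeration of a dissection.
  adj-reenumerate : ∀ {S d₀ d} → Adj d₀ → Enumerates S d₀ → Enumerates S d → Adj d
  adj-reenumerate {S} {d₀} {d} adj enum₀ enum {i} {j} i≢j = adj⇒clique adj enum₀
    (Equivalence.from (enum (d i)) (i , ≡.refl)) (Equivalence.from (enum (d j)) (j , ≡.refl)) (λ e → i≢j (d-injective e))
    where
    ρ : ∀ i → ∃[ j ] d j ≡ d₀ i
    ρ i = Equivalence.to (enum (d₀ i)) (Equivalence.from (enum₀ (d₀ i)) (i , ≡.refl))
    via : (ρ : ∀ i → ∃[ j ] d j ≡ d₀ i) → ∀ {i j} → d i ≡ d j → i ≡ j
    via ρ {i} {j} e = go (onto i) (onto j)
      where
      onto : ∀ k → ∃[ i ] proj₁ (ρ i) ≡ k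
      onto = injective⇒surjective λ {i} {j} e → adj⇒injective adj
        (≡.trans (≡.sym (proj₂ (ρ i))) (≡.trans (≡.cong d e) (proj₂ (ρ j))))
      go : ∃[ a ] proj₁ (ρ a) ≡ i → ∃[ b ] proj₁ (ρ b) ≡ j → i ≡ j
      go (a , p) (b , q) = ≡.trans (≡.sym p) (≡.trans (≡.cong (λ a → proj₁ (ρ a)) a≡b) q)
        where
        a≡b : a ≡ b
        a≡b = adj⇒injective adj (≡.trans (≡.sym (proj₂ (ρ a)))
          (≡.trans (≡.cong d p) (≡.trans e (≡.trans (≡.cong d (≡.sym q)) (proj₂ (ρ b))))))
    d-injective : ∀ {i j} → d i ≡ d j → i ≡ j
    d-injective = via ρ

  singles : Choice → Sets
  singles d i = ⁅ d i ⁆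

  singles-transversal : ∀ d → Transversal (singles d)
  singles-transversal d i = d i , Subset.x∈⁅x⁆ (d i)

  singles-selection : ∀ d → Selection (singles d) d
  singles-selection d i = Subset.x∈⁅x⁆ (d i)

  singles-compatible : ∀ {d} → Adj d → Compat (singles d)
  singles-compatible {d} adj {i} {j} i≢j u∈ v∈ =
    ≡.subst₂ _~_ (≡.sym (Subset.x∈⁅y⁆⇒x≡y (d i) u∈)) (≡.sym (Subset.x∈⁅y⁆⇒x≡y (d j) v∈)) (adj i≢j)

  Union-singles⁻ : ∀ {d v} → v ∈ˢ Union (singles d) → ∃[ i ] d i ≡ v
  Union-singles⁻ {d} v∈ = let i , p = ∈-Union⁻ (singles d) v∈ in i , ≡.sym (Subset.x∈⁅y⁆⇒x≡y (d i) p)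

  Union-singles⁺ : ∀ {d v} → ∃[ i ] d i ≡ v → v ∈ˢ Union (singles d)
  Union-singles⁺ {d} (i , ≡.refl) = ∈-Union⁺ (singles d) (Subset.x∈⁅x⁆ (d i))

  module _ {d} (adj : Adj d) where

    private
      disjoint : Disjoint (singles d)
      disjoint = compatible⇒disjoint (singles-compatible adj)

    corner∈singles : corner d ∈ Cell (singles d)
    corner∈singles = corner∈Cell disjoint (singles-selection d)

    singles⇒corner : ∀ {x} → x ∈ Cell (singles d) → x ≋ corner d
    singles⇒corner X = supported⇒corner disjoint X (singles-selection d)
      (λ v v∉ → Cell.support X v (λ v∈ → let i , e = Union-singles⁻ v∈ in v∉ i e))

    singles-image : image π (⨉ (singles d)) ≐ Cell (singles d)
    singles-image = image-⨉ disjoint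

    singles-isSimplex : IsSimplex 0ℤ (Cell (singles d))
    singles-isSimplex = 1 , (λ _ → corner d) , ≡.refl ,
      (λ { t s _ zero → trans (sym (+-identityʳ _)) s }) ,
      (λ X → conv-resp {A = range {n = 1} (λ _ → corner d)} (λ v → sym (singles⇒corner X v))
        (conv-⊇ {A = range {n = 1} (λ _ → corner d)} (zero , λ _ → refl))) ,
      conv⊆cell {A = range {n = 1} (λ _ → corner d)} (λ (_ , e) → cell-resp (λ v → sym (e v)) corner∈singles)

  -- A corner is nonzero exactly on the image of its family, so the point remembers the set.
  corner-image : ∀ {d d′ : Choice} → Injective _≡_ _≡_ d → corner d ≋ corner d′ → ∀ i → ∃[ j ] d′ j ≡ d i
  corner-image {d} {d′} inj e i = decidable-stable (Fin.any? (λ j → d′ j Fin.≟ d i)) λ none →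
    <⇒≉ (1/g-positive i) (trans (sym (corner-∈ inj i)) (trans (e (d i)) (corner-∉ (λ j q → none (j , q)))))

  corner-≋ : ∀ {d d′ : Choice} → Injective _≡_ _≡_ d → Injective _≡_ _≡_ d′ →
    (∀ i → ∃[ j ] d′ j ≡ d i) → (∀ j → ∃[ i ] d i ≡ d′ j) → corner d ≋ corner d′
  corner-≋ {d} {d′} inj inj′ to from v = go (Fin.any? (λ i → d i Fin.≟ v))
    where
    go : Dec (∃[ i ] d i ≡ v) → corner d v ≈ corner d′ v
    go (yes (i , ≡.refl)) = trans (corner-∈ inj i) (sym (at (to i)))
      where
      at : ∃[ j ] d′ j ≡ d i → corner d′ (d i) ≈ 1/ g
      at (j , e) = trans (reflexive (≡.cong (corner d′) (≡.sym e))) (corner-∈ inj′ j)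
    go (no none) = trans (corner-∉ (λ i e → none (i , e)))
      (sym (corner-∉ (λ j e → none (let i , p = from j in i , ≡.trans p e))))

  enumerates-corner : ∀ {S d d′} → Adj d → Adj d′ → Enumerates S d → Enumerates S d′ → corner d ≋ corner d′
  enumerates-corner {S} {d} {d′} adj adj′ enum enum′ = corner-≋ (adj⇒injective adj) (adj⇒injective adj′)
    (λ i → Equivalence.to (enum′ (d i)) (Equivalence.from (enum (d i)) (i , ≡.refl)))
    (λ j → Equivalence.to (enum (d′ j)) (Equivalence.from (enum′ (d′ j)) (j , ≡.refl)))

  corner-enumerates : ∀ {S S′ d d′} → Adj d → Adj d′ → Enumerates S d → Enumerates S′ d′ → corner d ≋ corner d′ → S ≡ S′
  corner-enumerates adj adj′ enum enum′ e = Subset.⊆-antisym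
    (included adj enum enum′ e) (included adj′ enum′ enum (λ v → sym (e v)))
    where
    included : ∀ {S S′ d d′} → Adj d → Enumerates S d → Enumerates S′ d′ → corner d ≋ corner d′ → S ⊆ˢ S′
    included {S} {S′} {d} {d′} adj enum enum′ e {v} v∈ = go (Equivalence.to (enum v) v∈)
      where
      go : ∃[ i ] d i ≡ v → v ∈ˢ S′
      go (i , ≡.refl) = Equivalence.from (enum′ (d i)) (corner-image (adj⇒injective adj) e i)

  same-point : ∀ {C C′ : Region (Fin h)} {d d′} → Adj d → Adj d′ →
    C ≐ Cell (singles d) → C′ ≐ Cell (singles d′) → C ≐ C′ ⇔ corner d ≋ corner d′
  same-point {C} {C′} {d} {d′} adj adj′ (C⊆ , ⊆C) (C′⊆ , ⊆C′) = mk⇔ to from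
    where
    to : C ≐ C′ → corner d ≋ corner d′
    to (C⊆C′ , _) = singles⇒corner adj′ (C′⊆ (C⊆C′ (⊆C (corner∈singles adj))))
    from : corner d ≋ corner d′ → C ≐ C′
    from e =
      (λ x∈ → ⊆C′ (cell-resp (λ v → sym (trans (singles⇒corner adj (C⊆ x∈) v) (e v))) (corner∈singles adj′))) ,
      (λ x∈ → ⊆C (cell-resp (λ v → sym (trans (singles⇒corner adj′ (C′⊆ x∈) v) (sym (e v)))) (corner∈singles adj)))

  same-vertex : ∀ {S S′ d d′} {C C′ : Region (Fin h)} → Adj d → Adj d′ → Enumerates S d → Enumerates S′ d′ →
    C ≐ Cell (singles d) → C′ ≐ Cell (singles d′) → S ≡ S′ ⇔ C ≐ C′
  same-vertex {S} {S′} {C = C} {C′} adj adj′ enum enum′ e e′ = mk⇔ to from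
    where
    to : S ≡ S′ → C ≐ C′
    to ≡.refl = Equivalence.from (same-point adj adj′ e e′) (enumerates-corner adj adj′ enum enum′)
    from : C ≐ C′ → S ≡ S′
    from C≐C′ = corner-enumerates adj adj′ enum enum′ (Equivalence.to (same-point adj adj′ e e′) C≐C′)

  -- Corners have minimal support, and by disjointness different selections have different corners;
  -- `extreme-bound` then finds all of them among any points that span the cell.
  selections-bound : ∀ {σ : Sets} → Disjoint σ → ∀ {C : Region (Fin h)} → C ≐ Cell σ →
    ∀ {n} {v : Fin n → Point (Fin h)} → C ≐ conv (range v) → ∀ {l} (s : Fin l → Fin g → Fin h) →
    (∀ a → Selection σ (s a)) → (∀ {a b} → (∀ i → s a i ≡ s b i) → a ≡ b) → l ℕ.≤ n
  selections-bound {σ} disjoint {C} (C⊆ , ⊆C) e s s∈ distinct = extreme-bound {C = C} e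
    (λ x∈ → Cell.nonNegative (C⊆ x∈)) (λ a → corner (s a)) (λ a → ⊆C (corner∈Cell disjoint (s∈ a)))
    (λ a x∈ supp → supported⇒corner disjoint (C⊆ x∈) (s∈ a) (λ v v∉ → supp v (corner-∉ v∉)))
    (λ {a} {b} p → distinct (agree p))
    where
    agree : ∀ {a b} → corner (s a) ≋ corner (s b) → ∀ i → s a i ≡ s b i
    agree {a} {b} p i = go (corner-image (selection-injective disjoint (s∈ a)) p i)
      where
      go : ∃[ j ] s b j ≡ s a i → s a i ≡ s b i
      go (j , q) = ≡.trans (≡.sym q) (≡.cong (s b) (disjoint (≡.subst (_∈ˢ σ j) q (s∈ b j)) (s∈ a i)))

  ⊖1-injective : ∀ {m n} → m ⊖ 1 ≡ n ⊖ 1 → m ≡ n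
  ⊖1-injective {zero}  {zero}  _ = ≡.refl
  ⊖1-injective {zero}  {suc n} ()
  ⊖1-injective {suc m} {zero}  ()
  ⊖1-injective {suc m} {suc n} e = ≡.cong suc (ℤ.+-injective e)

  -- A second element of a block would produce a second corner, but a simplex of dimension 0 is
  -- spanned by one point.
  point⇒singles : ∀ {C : Region (Fin h)} {σ : Sets} → Transversal σ → Compat σ → C ≐ Cell σ → IsSimplex 0ℤ C →
    Σ[ d ∈ Choice ] Adj d × C ≐ Cell (singles d)
  point⇒singles {C} {σ} t compat e (n , v , dim , _ , e′) =
    d , (λ i≢j → compat i≢j (d∈ _) (d∈ _)) , ≐-trans e (cell-cong σ≡ , cell-cong (λ i → ≡.sym (σ≡ i)))
    where
    d : Choice
    d i = proj₁ (t i)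
    d∈ : Selection σ d
    d∈ i = proj₂ (t i)
    unique : ∀ {i u} → u ∈ˢ σ i → u ≡ d i
    unique {i} {u} u∈ = decidable-stable (u Fin.≟ d i) λ u≢ → ℕ.<⇒≱ (ℕ.s≤s (ℕ.s≤s ℕ.z≤n))
      (≡.subst (2 ℕ.≤_) (≡.sym (⊖1-injective {1} {n} dim)) (two u≢))
      where
      s : Fin 2 → Fin g → Fin h
      s = d ◂ ((d [ i ≔ u ]) ◂ λ ())
      two : u ≢ d i → 2 ℕ.≤ n
      two u≢ = selections-bound (compatible⇒disjoint compat) e e′ s
        (λ { zero → d∈ ; (suc zero) → ≔-selection {σ} {d} i d∈ u∈ })
        (λ { {zero} {zero} _ → ≡.refl ; {suc zero} {suc zero} _ → ≡.refl
           ; {zero} {suc zero} p → ⊥-elim (u≢ (≡.sym (≡.trans (p i) (≔-same d i))))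
           ; {suc zero} {zero} p → ⊥-elim (u≢ (≡.trans (≡.sym (≔-same d i)) (p i))) })
    σ≡ : ∀ i → σ i ≡ ⁅ d i ⁆
    σ≡ i = Subset.⊆-antisym
      (λ u∈ → ≡.subst (_∈ˢ ⁅ d i ⁆) (≡.sym (unique u∈)) (Subset.x∈⁅x⁆ (d i)))
      (λ u∈ → ≡.subst (_∈ˢ σ i) (≡.sym (Subset.x∈⁅y⁆⇒x≡y (d i) u∈)) (d∈ i))

  -- The clique complex and the transversal simplices of dimension g - 1

  Clique : Subset h → Set ℓ
  Clique τ = ∀ {u v} → u ∈ˢ τ → v ∈ˢ τ → u ≢ v → u ~ v

  CliqueComplex : Family (Fin h) ℓ
  CliqueComplex C = ∃[ τ ] Clique τ × C ≐ simplex τ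

  module _ (extends : ∀ {τ} → Clique τ → Σ[ d ∈ Choice ] Adj d × (∀ {v} → v ∈ˢ τ → ∃[ i ] d i ≡ v))
           {dim : ℤ} (dim≡ : dim ≡ g ⊖ 1) where

    private
      Top : Family (Fin h) (lsuc ℓ)
      Top = images π (TransversalSimplices _~_ g) ∩ IsSimplex dim

    -- A clique lies in one with g elements, whose singletons form a transversal simplex with g
    -- vertices. Conversely, dimension g - 1 forces all blocks of a transversal simplex to be
    -- singletons, and the union of compatible singletons is a clique.
    cliqueComplex-induced : CliqueComplex ≐ induced Top
    cliqueComplex-induced = to , from
      where
      to : CliqueComplex ⊆ induced Top
      to {C} (τ , clique , e) = go (extends clique)
        where
        go : Σ[ d ∈ Choice ] Adj d × (∀ {v} → v ∈ˢ τ → ∃[ i ] d i ≡ v) → C ∈ induced Top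
        go (d , adj , covers) = image π (⋆ (singles d)) ,
          ((⋆ (singles d) , (singles d , singles-transversal d , singles-compatible adj , ≐-refl) , ≐-refl) ,
           ≡.subst (λ n → IsSimplex n (image π (⋆ (singles d)))) (≡.sym dim≡) (isSimplex-resp joined (simplex-isSimplex list))) ,
          isFace-resp e joined (simplex-isFace (λ v∈ → Union-singles⁺ (covers v∈)))
          where
          joined : image π (⋆ (singles d)) ≐ simplex (Union (singles d))
          joined = image-⋆-compatible (singles-compatible adj)
          list : Listing (Union (singles d)) g
          list = record
            { element = d
            ; injective = adj⇒injective adj
            ; member = λ j → Union-singles⁺ (j , ≡.refl)
            ; index = Union-singles⁻
            }
      from : induced Top ⊆ CliqueComplex
      from {C} (D , ((D₀ , (σ , t , compat , e₀) , e) , (n , v , dim≡′ , _ , e′)) , isFace) =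
        go (face-of-simplex (Union σ) (isFace-resp ≐-refl (≐-sym joined) isFace))
        where
        joined : D ≐ simplex (Union σ)
        joined = ≐-trans e (≐-trans (image-≐ π e₀) (image-⋆-compatible compat))
        n≡g : n ≡ g
        n≡g = ⊖1-injective (≡.trans (≡.sym dim≡′) dim≡)
        related : ∀ {u v} → u ≢ v → ∃[ i ] u ∈ˢ σ i → ∃[ j ] v ∈ˢ σ j → u ~ v
        related {u} {w} u≢w (i , u∈) (j , w∈) = compat i≢j u∈ w∈
          where
          i≢j : i ≢ j
          -- Two elements of the same block would give g + 1 vertices of a simplex that g points
          -- span.
          i≢j ≡.refl = ℕ.1+n≰n (≡.subst (suc g ℕ.≤_) n≡g
            (simplex-bound (≐-trans (≐-sym joined) e′) (enlarged t u∈ w)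
              (enlarged-injective t compat u∈ w∈ u≢w) (enlarged∈Union t compat u∈ w∈)))
        go : Σ[ τ ∈ Subset h ] τ ⊆ˢ Union σ × C ≐ simplex τ → C ∈ CliqueComplex
        go (τ , τ⊆ , e″) = τ , (λ u∈ v∈ u≢v → related u≢v (∈-Union⁻ σ (τ⊆ u∈)) (∈-Union⁻ σ (τ⊆ v∈))) , e″

  -- Flips and edges

  corner-cong : ∀ {s s′ : Choice} → (∀ i → s i ≡ s′ i) → corner s ≋ corner s′
  corner-cong s≗s′ v = sum-cong (λ i → *-congˡ (reflexive (≡.cong (λ u → basis u v) (s≗s′ i))))

  JoinedByEdge : (C C′ : Region (Fin h)) → Set (lsuc ℓ)
  JoinedByEdge C C′ = ∃[ E ] E ∈ HomImage × IsSimplex 1ℤ E × IsFace C E × IsFace C′ E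

  module Exchange {S S′ : Subset h} {d d′ : Choice} (adj : Adj d) (adj′ : Adj d′)
    (enum : Enumerates S d) (enum′ : Enumerates S′ d′) (i₀ : Fin g) {v′} (v′∈ : v′ ∈ˢ S′)
    (v≢v′ : d i₀ ≢ v′) (same : S Subset.- d i₀ ≡ S′ Subset.- v′) where

    d∈ : ∀ i → d i ∈ˢ S
    d∈ i = Equivalence.from (enum (d i)) (i , ≡.refl)

    S⇒S′ : ∀ {u} → u ∈ˢ S → u ≢ d i₀ → u ∈ˢ S′ × u ≢ v′
    S⇒S′ {u} u∈ u≢ = x∈p-y⇒ (≡.subst (u ∈ˢ_) same (Subset.x∈p∧x≢y⇒x∈p-y u∈ u≢))

    S′⇒S : ∀ {u} → u ∈ˢ S′ → u ≢ v′ → u ∈ˢ S × u ≢ d i₀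
    S′⇒S {u} u∈ u≢ = x∈p-y⇒ (≡.subst (u ∈ˢ_) (≡.sym same) (Subset.x∈p∧x≢y⇒x∈p-y u∈ u≢))

    v∉S′ : d i₀ ∉ˢ S′
    v∉S′ v∈ = proj₂ (S′⇒S v∈ v≢v′) ≡.refl

    v′∉S : v′ ∉ˢ S
    v′∉S v′∈S = proj₂ (S⇒S′ v′∈S (v≢v′ ∘ ≡.sym)) ≡.refl

    d-≢ : ∀ {i} → i ≢ i₀ → d i ≢ d i₀
    d-≢ i≢i₀ e = i≢i₀ (adj⇒injective adj e)

    -- The family d′ may list S′ in any order; d″ lists the same set so that it agrees with d at
    -- every index other than `i₀`.
    d″ : Choice
    d″ = d [ i₀ ≔ v′ ]

    d″-same : d″ i₀ ≡ v′
    d″-same = ≔-same d i₀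

    d″-other : ∀ {i} → i ≢ i₀ → d″ i ≡ d i
    d″-other = ≔-other d

    mixed : ∀ {i j} → i ≢ j → d i ~ d″ j
    mixed {i} {j} i≢j = go (j Fin.≟ i₀)
      where
      go : Dec (j ≡ i₀) → d i ~ d″ j
      go (no j≢) = ≡.subst (d i ~_) (≡.sym (d″-other j≢)) (adj i≢j)
      go (yes ≡.refl) = ≡.subst (d i ~_) (≡.sym d″-same)
        (let p , q = S⇒S′ (d∈ i) (d-≢ i≢j) in adj⇒clique adj′ enum′ p v′∈ q)

    adj″ : Adj d″
    adj″ {i} {j} i≢j = go (i Fin.≟ i₀)
      where
      go : Dec (i ≡ i₀) → d″ i ~ d″ j
      go (no i≢) = ≡.subst (_~ d″ j) (≡.sym (d″-other i≢)) (mixed i≢j)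
      go (yes ≡.refl) = ~-sym (≡.subst (_~ d″ i) (≡.sym (d″-other (i≢j ∘ ≡.sym))) (mixed (i≢j ∘ ≡.sym)))

    enum″ : Enumerates S′ d″
    enum″ u = mk⇔ (λ u∈ → to u∈ (u Fin.≟ v′)) (λ (i , e) → ≡.subst (_∈ˢ S′) e (from i (i Fin.≟ i₀)))
      where
      to : u ∈ˢ S′ → Dec (u ≡ v′) → ∃[ i ] d″ i ≡ u
      to u∈ (yes ≡.refl) = i₀ , d″-same
      to u∈ (no u≢) = go (S′⇒S u∈ u≢)
        where
        go : u ∈ˢ S × u ≢ d i₀ → ∃[ i ] d″ i ≡ u
        go (u∈S , u≢) = let i , e = Equivalence.to (enum u) u∈S in
          i , ≡.trans (d″-other (λ { ≡.refl → u≢ (≡.sym e) })) e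
      from : ∀ i → Dec (i ≡ i₀) → d″ i ∈ˢ S′
      from i (yes ≡.refl) = ≡.subst (_∈ˢ S′) (≡.sym d″-same) v′∈
      from i (no i≢) = ≡.subst (_∈ˢ S′) (≡.sym (d″-other i≢)) (proj₁ (S⇒S′ (d∈ i) (d-≢ i≢)))

    -- A singleton at every index except `i₀`, where it consists of `d i₀` and v′: the cell is the
    -- edge between the two corners.
    σ : Sets
    σ i = ⁅ d i ⁆ Subset.∪ ⁅ d″ i ⁆

    ∈σ⁻ : ∀ {i u} → u ∈ˢ σ i → u ≡ d i ⊎ u ≡ d″ i
    ∈σ⁻ {i} u∈ = [ (λ p → inj₁ (Subset.x∈⁅y⁆⇒x≡y (d i) p)) , (λ p → inj₂ (Subset.x∈⁅y⁆⇒x≡y (d″ i) p)) ]′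
      (Subset.x∈p∪q⁻ ⁅ d i ⁆ ⁅ d″ i ⁆ u∈)

    d∈σ : Selection σ d
    d∈σ i = Subset.x∈p∪q⁺ (inj₁ (Subset.x∈⁅x⁆ (d i)))

    d″∈σ : Selection σ d″
    d″∈σ i = Subset.x∈p∪q⁺ (inj₂ (Subset.x∈⁅x⁆ (d″ i)))

    compatible : Compat σ
    compatible {i} {j} i≢j u∈ w∈ = go (∈σ⁻ u∈) (∈σ⁻ w∈)
      where
      go : ∀ {u w} → u ≡ d i ⊎ u ≡ d″ i → w ≡ d j ⊎ w ≡ d″ j → u ~ w
      go (inj₁ ≡.refl) (inj₁ ≡.refl) = adj i≢j
      go (inj₁ ≡.refl) (inj₂ ≡.refl) = mixed i≢j
      go (inj₂ ≡.refl) (inj₁ ≡.refl) = ~-sym (mixed (i≢j ∘ ≡.sym))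
      go (inj₂ ≡.refl) (inj₂ ≡.refl) = adj″ i≢j

    private
      disjoint : Disjoint σ
      disjoint = compatible⇒disjoint compatible

    E : Region (Fin h)
    E = Cell σ

    E∈ : E ∈ HomImage
    E∈ = ⇒HomImage (σ , (λ i → d i , d∈σ i) , compatible , ≐-refl)

    ends : Fin 2 → Point (Fin h)
    ends = corner d ◂ (corner d″ ◂ λ ())

    E-isSimplex : IsSimplex 1ℤ E
    E-isSimplex = 2 , ends , ≡.refl , independent ,
      (λ X → conv-mono {A = Corners σ} {B = range ends} corners⊆ends (cell⊆conv-corners disjoint X)) ,
      conv⊆cell {A = range ends} ends⊆
      where
      ends⊆ : range ends ⊆ Cell σ
      ends⊆ (zero , e) = cell-resp (λ v → sym (e v)) (corner∈Cell disjoint d∈σ)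
      ends⊆ (suc zero , e) = cell-resp (λ v → sym (e v)) (corner∈Cell disjoint d″∈σ)
      corners⊆ends : Corners σ ⊆ range ends
      corners⊆ends {z} (s , s∈ , e) = go (s i₀ Fin.≟ d i₀)
        where
        other : ∀ {i} → i ≢ i₀ → s i ≡ d i
        other {i} i≢ = [ (λ p → p) , (λ p → ≡.trans p (d″-other i≢)) ]′ (∈σ⁻ (s∈ i))
        go : Dec (s i₀ ≡ d i₀) → z ∈ range ends
        go (yes p) = zero , λ v → trans (e v) (corner-cong s≗ v)
          where
          s≗ : ∀ i → s i ≡ d i
          s≗ i with i Fin.≟ i₀
          ... | yes ≡.refl = p
          ... | no i≢ = other i≢
        go (no ¬p) = suc zero , λ v → trans (e v) (corner-cong s≗ v)
          where
          s≗ : ∀ i → s i ≡ d″ i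
          s≗ i with i Fin.≟ i₀
          ... | yes ≡.refl = [ (λ p → ⊥-elim (¬p p)) , (λ p → p) ]′ (∈σ⁻ (s∈ i₀))
          ... | no i≢ = ≡.trans (other i≢) (≡.sym (d″-other i≢))
      independent : AffinelyIndependent ends
      independent t s p = λ { zero → t₀≈0 ; (suc zero) → t₁≈0 }
        where
        t₀ = t zero
        t₁ = t (suc zero)
        -- At the coordinate `d i₀` only the first corner is nonzero, because `d i₀` does not belong
        -- to S′.
        t₀/g : t₀ * 1/ g ≈ 0#
        t₀/g = begin
          t₀ * 1/ g ≈⟨ *-congˡ (corner-∈ (adj⇒injective adj) i₀) ⟨
          t₀ * corner d (d i₀) ≈⟨ +-identityʳ _ ⟨
          t₀ * corner d (d i₀) + 0# ≈⟨ +-congˡ (trans (+-identityʳ _) (trans (*-congˡ off) (zeroʳ _))) ⟨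
          t₀ * corner d (d i₀) + (t₁ * corner d″ (d i₀) + 0#) ≈⟨ p (d i₀) ⟩
          0# ∎
          where
          off : corner d″ (d i₀) ≈ 0#
          off = corner-∉ (λ i e → v∉S′ (Equivalence.from (enum″ (d i₀)) (i , e)))
        t₀≈0 : t₀ ≈ 0#
        t₀≈0 = *≈0⇒ (<⇒≉ (1/g-positive i₀)) (trans (*-comm _ _) t₀/g)
        t₁≈0 : t₁ ≈ 0#
        t₁≈0 = begin
          t₁ ≈⟨ +-identityʳ _ ⟨
          t₁ + 0# ≈⟨ +-identityˡ _ ⟨
          0# + (t₁ + 0#) ≈⟨ +-congʳ t₀≈0 ⟨
          t₀ + (t₁ + 0#) ≈⟨ s ⟩
          0# ∎

    -- If W meets every block in the single element chosen by e, the points of the edge supported in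
    -- W form just the corner of e. The sets S and S′ themselves serve as W for the two ends.
    vertex-isFace : ∀ {C : Region (Fin h)} {W e} → C ≐ Cell (singles e) → Selection σ e → (∀ i → e i ∈ˢ W) →
      (∀ {i u} → u ∈ˢ σ i → u ∈ˢ W → u ≡ e i) → IsFace C E
    vertex-isFace {C} {W} {e} C≐ e∈σ e∈W unique = supported-face {C = E} {F = C} (λ X → Cell.nonNegative X) W
      (≐-trans C≐ (subcell disjoint τ⇔))
      where
      τ⇔ : ∀ i u → u ∈ˢ singles e i ⇔ (u ∈ˢ σ i × u ∈ˢ W)
      τ⇔ i u = mk⇔ (λ u∈ → forth (Subset.x∈⁅y⁆⇒x≡y (e i) u∈)) (λ (p , q) → back (unique p q))
        where
        forth : u ≡ e i → u ∈ˢ σ i × u ∈ˢ W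
        forth ≡.refl = e∈σ i , e∈W i
        back : u ≡ e i → u ∈ˢ singles e i
        back ≡.refl = Subset.x∈⁅x⁆ (e i)

    source-unique : ∀ {i u} → u ∈ˢ σ i → u ∈ˢ S → u ≡ d i
    source-unique {i} {u} u∈ u∈S = go (∈σ⁻ u∈) (i Fin.≟ i₀)
      where
      go : u ≡ d i ⊎ u ≡ d″ i → Dec (i ≡ i₀) → u ≡ d i
      go (inj₁ p) _ = p
      go (inj₂ p) (no i≢) = ≡.trans p (d″-other i≢)
      go (inj₂ p) (yes ≡.refl) = ⊥-elim (v′∉S (≡.subst (_∈ˢ S) (≡.trans p d″-same) u∈S))

    target-unique : ∀ {i u} → u ∈ˢ σ i → u ∈ˢ S′ → u ≡ d″ i
    target-unique {i} {u} u∈ u∈S′ = go (∈σ⁻ u∈) (i Fin.≟ i₀)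
      where
      go : u ≡ d i ⊎ u ≡ d″ i → Dec (i ≡ i₀) → u ≡ d″ i
      go (inj₂ p) _ = p
      go (inj₁ p) (no i≢) = ≡.trans p (≡.sym (d″-other i≢))
      go (inj₁ p) (yes ≡.refl) = ⊥-elim (v∉S′ (≡.subst (_∈ˢ S′) p u∈S′))

    joined : ∀ {C C′ : Region (Fin h)} → C ≐ Cell (singles d) → C′ ≐ Cell (singles d′) → JoinedByEdge C C′
    joined {C} {C′} e e′ = E , E∈ , E-isSimplex ,
      vertex-isFace {C} {S} {d} e d∈σ d∈ source-unique ,
      vertex-isFace {C′} {S′} {d″} e″ d″∈σ (λ i → Equivalence.from (enum″ (d″ i)) (i , ≡.refl)) target-unique
      where
      e″ : C′ ≐ Cell (singles d″)
      e″ = ≐-trans e′ (Equivalence.from (same-point adj′ adj″ ≐-refl ≐-refl) (enumerates-corner adj′ adj″ enum′ enum″))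

  Flip : Subset h → Subset h → Set
  Flip S S′ = ∃[ v ] ∃[ v′ ] v ∈ˢ S × v′ ∈ˢ S′ × v ≢ v′ × S Subset.- v ≡ S′ Subset.- v′

  flip⇒≢ : ∀ {S S′} → Flip S S′ → S ≢ S′
  flip⇒≢ {S} (v , v′ , v∈ , v′∈ , v≢v′ , same) ≡.refl =
    x∉p-x S v (≡.subst (v ∈ˢ_) (≡.sym same) (Subset.x∈p∧x≢y⇒x∈p-y v∈ v≢v′))

  -- Each block of σ has positive mass and so contains an element of S, the support of the corner.
  -- Taking one for every block is injective by disjointness, hence a reordering of d along the
  -- blocks of σ.
  vertex-selection : ∀ {S d} {σ : Sets} → Disjoint σ → Adj d → Enumerates S d → corner d ∈ Cell σ →
    Σ[ s ∈ Choice ] Selection σ s × Enumerates S s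
  vertex-selection {S} {d} {σ} disjoint adj enum X = collect heavy
    where
    open Cell X
    Heavy : Fin g → Fin g → Set
    Heavy j i = d i ∈ˢ σ j
    heavy : ∀ j → ∃ (Heavy j)
    heavy j = found (sum≉0⇒ (λ v → indicator (σ j) v * corner d v) (λ e → <⇒≉ (1/g-positive j) (trans (sym (block-mass j)) e)))
      where
      found : ∃[ v ] ¬ indicator (σ j) v * corner d v ≈ 0# → ∃ (Heavy j)
      found (v , ≉0) = go (decidable-stable (Fin.any? (λ i → d i Fin.≟ v))
          (λ none → ≉0 (trans (*-congˡ (corner-∉ (λ i e → none (i , e)))) (zeroʳ _))))
        where
        v∈ : v ∈ˢ σ j
        v∈ = decidable-stable (v ∈?ˢ σ j) (λ v∉ → ≉0 (trans (*-congʳ (indicator-∉ v∉)) (zeroˡ _)))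
        go : ∃[ i ] d i ≡ v → ∃ (Heavy j)
        go (i , e) = i , ≡.subst (_∈ˢ σ j) (≡.sym e) v∈
    collect : (∀ j → ∃ (Heavy j)) → Σ[ s ∈ Choice ] Selection σ s × Enumerates S s
    collect H = s , s∈ , λ v → mk⇔ (λ v∈ → to (Equivalence.to (enum v) v∈)) (λ (j , e) → Equivalence.from (enum v) (ρ j , e))
      where
      ρ : Fin g → Fin g
      ρ j = proj₁ (H j)
      s : Choice
      s j = d (ρ j)
      s∈ : Selection σ s
      s∈ j = proj₂ (H j)
      to : ∀ {v} → ∃[ i ] d i ≡ v → ∃[ j ] s j ≡ v
      to (i , e) = let j , p = injective⇒surjective (λ q → selection-injective {σ = σ} disjoint s∈ (≡.cong d q)) i in
        j , ≡.trans (≡.cong d p) e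

  -- If the selections differed at two indices, changing only one of them would give a third corner,
  -- whereas two points span a simplex of dimension 1.
  selections-flip : ∀ {S S′} {σ : Sets} {s s′} → Compat σ → IsSimplex 1ℤ (Cell σ) →
    Selection σ s → Selection σ s′ → Enumerates S s → Enumerates S′ s′ → S ≢ S′ → Flip S S′
  selections-flip {S} {S′} {σ} {s} {s′} compat (n , v , dim , _ , e) s∈ s′∈ enum enum′ S≢S′ =
    go (Fin.¬∀⟶∃¬ g _ (λ i → s i Fin.≟ s′ i) (λ s≗s′ → S≢S′ (Subset.⊆-antisym
      (included enum enum′ s≗s′) (included enum′ enum (≡.sym ∘ s≗s′)))))
    where
    included : ∀ {S S′} {s s′ : Choice} → Enumerates S s → Enumerates S′ s′ → (∀ i → s i ≡ s′ i) → S ⊆ˢ S′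
    included enum enum′ s≗s′ {v} v∈ = let i , p = Equivalence.to (enum v) v∈ in
      Equivalence.from (enum′ v) (i , ≡.trans (≡.sym (s≗s′ i)) p)
    disjoint : Disjoint σ
    disjoint = compatible⇒disjoint compat
    agree : ∀ {i} → s i ≢ s′ i → ∀ {j} → j ≢ i → s j ≡ s′ j
    agree {i} s≢ {j} j≢i = decidable-stable (s j Fin.≟ s′ j) λ s≢ⱼ →
      ℕ.1+n≰n (≡.subst (3 ℕ.≤_) (≡.sym (⊖1-injective {2} {n} dim)) (three s≢ⱼ))
      where
      s₃ : Choice
      s₃ = s [ i ≔ s′ i ]
      three : s j ≢ s′ j → 3 ℕ.≤ n
      three s≢ⱼ = selections-bound disjoint ≐-refl e (s ◂ (s′ ◂ (s₃ ◂ λ ())))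
        (λ { zero → s∈ ; (suc zero) → s′∈ ; (suc (suc zero)) → ≔-selection {σ} {s} i s∈ (s′∈ i) })
        (λ { {zero} {zero} _ → ≡.refl ; {suc zero} {suc zero} _ → ≡.refl ; {suc (suc zero)} {suc (suc zero)} _ → ≡.refl
           ; {zero} {suc zero} p → ⊥-elim (s≢ (p i))
           ; {suc zero} {zero} p → ⊥-elim (s≢ (≡.sym (p i)))
           ; {zero} {suc (suc zero)} p → ⊥-elim (s≢ (≡.trans (p i) (≔-same s i)))
           ; {suc (suc zero)} {zero} p → ⊥-elim (s≢ (≡.trans (≡.sym (p i)) (≔-same s i)))
           ; {suc zero} {suc (suc zero)} p → ⊥-elim (s≢ⱼ (≡.sym (≡.trans (p j) (≔-other s j≢i))))
           ; {suc (suc zero)} {suc zero} p → ⊥-elim (s≢ⱼ (≡.trans (≡.sym (≔-other s j≢i)) (p j))) })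
    go : ∃[ i ] s i ≢ s′ i → Flip S S′
    go (i , s≢) = s i , s′ i , Equivalence.from (enum (s i)) (i , ≡.refl) , Equivalence.from (enum′ (s′ i)) (i , ≡.refl) ,
      s≢ , Subset.⊆-antisym (remaining enum enum′ s′∈ (agree s≢)) (remaining enum′ enum s∈ (λ j≢ → ≡.sym (agree s≢ j≢)))
      where
      remaining : ∀ {S S′} {s s′ : Choice} → Enumerates S s → Enumerates S′ s′ → Selection σ s′ →
        (∀ {j} → j ≢ i → s j ≡ s′ j) → S Subset.- s i ⊆ˢ S′ Subset.- s′ i
      remaining {S} {S′} {s} {s′} enum enum′ s′∈ same {v} v∈ = found (Equivalence.to (enum v) (proj₁ (x∈p-y⇒ v∈))) (proj₂ (x∈p-y⇒ v∈))
        where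
        found : ∃[ j ] s j ≡ v → v ≢ s i → v ∈ˢ S′ Subset.- s′ i
        found (j , ≡.refl) v≢ = Subset.x∈p∧x≢y⇒x∈p-y
          (Equivalence.from (enum′ (s j)) (j , ≡.sym (same j≢i)))
          (λ q → j≢i (selection-injective {σ = σ} disjoint s′∈ (≡.trans (≡.sym (same j≢i)) q)))
          where
          j≢i : j ≢ i
          j≢i ≡.refl = v≢ ≡.refl

  module _ {S S′ d d′} {C C′ : Region (Fin h)} (adj : Adj d) (adj′ : Adj d′)
           (enum : Enumerates S d) (enum′ : Enumerates S′ d′)
           (e : C ≐ Cell (singles d)) (e′ : C′ ≐ Cell (singles d′)) where

    -- For the converse, both corners lie in the cell E, and `vertex-selection` reorders the two
    -- sets along its blocks; only then can they be compared index by index.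
    flip⇔edge : Flip S S′ ⇔ (¬ C ≐ C′ × JoinedByEdge C C′)
    flip⇔edge = mk⇔ to from
      where
      to : Flip S S′ → ¬ C ≐ C′ × JoinedByEdge C C′
      to F@(v , v′ , v∈ , v′∈ , v≢v′ , same) =
        (λ C≐C′ → flip⇒≢ F (Equivalence.from (same-vertex adj adj′ enum enum′ e e′) C≐C′)) ,
        at (Equivalence.to (enum v) v∈)
        where
        at : ∃[ i ] d i ≡ v → JoinedByEdge C C′
        at (i , ≡.refl) = Exchange.joined adj adj′ enum enum′ i v′∈ v≢v′ same e e′
      from : ¬ C ≐ C′ × JoinedByEdge C C′ → Flip S S′
      from (C≢C′ , E , E∈ , E-simplex , (_ , _ , _ , C⊆E , _) , (_ , _ , _ , C′⊆E , _)) = in-cell (HomImage⇒ E∈)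
        where
        in-cell : IsCell E → Flip S S′
        in-cell (σ , t , compat , E⊆ , ⊆E) = select
          (vertex-selection disjoint adj enum (E⊆ (proj₁ (C⊆E (proj₂ e (corner∈singles adj))))))
          (vertex-selection disjoint adj′ enum′ (E⊆ (proj₁ (C′⊆E (proj₂ e′ (corner∈singles adj′))))))
          where
          disjoint : Disjoint σ
          disjoint = compatible⇒disjoint compat
          select : (Σ[ s ∈ Choice ] Selection σ s × Enumerates S s) →
                   (Σ[ s ∈ Choice ] Selection σ s × Enumerates S′ s) → Flip S S′
          select (s , s∈ , enumₛ) (s′ , s′∈ , enumₛ′) = selections-flip compat
            (isSimplex-resp (⊆E , E⊆) E-simplex) s∈ s′∈ enumₛ enumₛ′
            (λ S≡S′ → C≢C′ (Equivalence.to (same-vertex adj adj′ enum enum′ e e′) S≡S′))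

-- The flip graph and the 1-skeleton

module FlipGraph {c ℓ₁ ℓ₂} (𝕂 : OrderedField c ℓ₁ ℓ₂) (r g : ℕ)
  (P : Geometry.ConvexPolygon 𝕂 (Geometry.size 𝕂 (suc (suc (suc r))) (suc g))) {h : ℕ}
  (δ : Geometry.Enumeration 𝕂 (suc (suc (suc r))) (suc g) P h) where

  open Geometry 𝕂 hiding (μ)
  open Polygon P
  open Enumeration δ
  open Complexes P δ hiding (g)
  open DiagonalGraph 𝕂 r g P δ hiding (Clique) renaming (Enumerates to EnumeratesChords)
  open CliqueComplexes 𝕂 I I-sym I-irrefl clique-bound public
  open Cells 𝕂 using (Cell)

  clique-in-dissection : ∀ {τ} → Clique τ → Σ[ d ∈ (Fin g → Fin h) ] Adj d × (∀ {v} → v ∈ˢ τ → ∃[ i ] d i ≡ v)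
  clique-in-dissection clique = let d , D , covers = clique-extends clique in d , Dissecting.adjacent D , covers

  private
    module Flips = Graph flipGraph
    module Edges = Graph (1-skeleton 𝖣)

    diagonals : (x : Flips.Vertex) → Σ[ d ∈ (Fin g → Fin h) ] Adj d × Enumerates (proj₁ x) d
    diagonals (S , ds , dissection , S⇔ds) = go (dissecting dissection)
      where
      go : (Σ[ d ∈ (Fin g → Fin h) ] Dissecting d × EnumeratesChords d ds) →
           Σ[ d ∈ (Fin g → Fin h) ] Adj d × Enumerates S d
      go (d , D , enum) = d , Dissecting.adjacent D , λ v → mk⇔ (to v) (λ (i , e) → ≡.subst (_∈ˢ S) e (from i))
        where
        to : ∀ v → v ∈ˢ S → ∃[ i ] d i ≡ v
        to v v∈ = let i , e = Equivalence.from (enum (diagonal v)) (Equivalence.to (S⇔ds (diagonal v)) (v , v∈ , ≡.refl)) in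
          i , injective e
        from : ∀ i → d i ∈ˢ S
        from i = let v , v∈ , e = Equivalence.from (S⇔ds (diagonal (d i))) (Equivalence.to (enum (diagonal (d i))) (i , ≡.refl)) in
          ≡.subst (_∈ˢ S) (injective e) v∈

    Located : Flips.Vertex → Edges.Vertex → Set _
    Located x y = Σ[ d ∈ (Fin g → Fin h) ] Adj d × Enumerates (proj₁ x) d × proj₁ y ≐ Cell (singles d)

    locate : ∀ {x y} → Corresponds x y → Located x y
    locate {x} {y} (d , enum , e) = d , adj , enum , ≐-trans e (singles-image adj)
      where
      adj : Adj d
      adj = adj-reenumerate (proj₁ (proj₂ (diagonals x))) (proj₂ (proj₂ (diagonals x))) enum

    total : ∀ x → ∃[ y ] Corresponds x y
    total x = go (diagonals x)
      where
      go : (Σ[ d ∈ (Fin g → Fin h) ] Adj d × Enumerates (proj₁ x) d) → ∃[ y ] Corresponds x y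
      go (d , adj , enum) =
        (image π (⨉ (singles d)) ,
         ⇒HomImage (singles d , singles-transversal d , singles-compatible adj , singles-image adj) ,
         Faces.isSimplex-resp 𝕂 (singles-image adj) (singles-isSimplex adj)) ,
        d , enum , ≐-refl

    surjective : ∀ y → ∃[ x ] Corresponds x y
    surjective y@(C , C∈ , isPoint) = at-cell (HomImage⇒ C∈)
      where
      at-point : Σ[ d ∈ (Fin g → Fin h) ] Adj d × C ≐ Cell (singles d) → ∃[ x ] Corresponds x y
      at-point (d , adj , e) = complete-clique (clique-extends clique)
        where
        listed? : ∀ v → Dec (∃[ i ] d i ≡ v)
        listed? v = Fin.any? (λ i → d i Fin.≟ v)
        S : Subset h
        S = comprehension listed?
        enum : Enumerates S d
        enum v = mk⇔ (∈-comprehension⁻ listed?) (∈-comprehension⁺ listed?)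
        clique : Clique S
        clique = adj⇒clique adj enum
        complete-clique : (Σ[ d′ ∈ (Fin g → Fin h) ] Dissecting d′ × (∀ {v} → v ∈ˢ S → ∃[ i ] d′ i ≡ v)) →
          ∃[ x ] Corresponds x y
        complete-clique (d′ , D , covers) =
          (S , chords , dissection , λ c → mk⇔ to (λ c∈ → from (Equivalence.from (enumerates c) c∈))) ,
          d , enum , ≐-trans e (≐-sym (singles-image adj))
          where
          open Dissecting D using (chords; dissection; enumerates)
          to : ∀ {c} → ∃[ v ] v ∈ˢ S × diagonal v ≡ c → c List.∈ chords
          to {c} (v , v∈ , e) = let i , p = covers v∈ in
            Equivalence.to (enumerates c) (i , ≡.trans (≡.cong diagonal p) e)
          ρ : ∀ i → ∃[ j ] d′ j ≡ d i
          ρ i = covers (Equivalence.from (enum (d i)) (i , ≡.refl))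
          -- The g elements of d occur among the g chords of the dissection and thus exhaust them:
          -- the extension has added nothing.
          onto : ∀ j → ∃[ i ] proj₁ (ρ i) ≡ j
          onto = injective⇒surjective λ {i} {j} q → adj⇒injective adj
            (≡.trans (≡.sym (proj₂ (ρ i))) (≡.trans (≡.cong d′ q) (proj₂ (ρ j))))
          from : ∀ {c} → ∃[ j ] diagonal (d′ j) ≡ c → ∃[ v ] v ∈ˢ S × diagonal v ≡ c
          from (j , e) = let i , q = onto j in
            d i , Equivalence.from (enum (d i)) (i , ≡.refl) ,
            ≡.trans (≡.cong diagonal (≡.trans (≡.sym (proj₂ (ρ i))) (≡.cong d′ q))) e
      at-cell : IsCell C → ∃[ x ] Corresponds x y
      at-cell (σ , t , compat , e) = at-point (point⇒singles t compat e isPoint)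

  flipGraph-isomorphism : IsIsomorphism flipGraph (1-skeleton 𝖣) Corresponds
  flipGraph-isomorphism = record
    { total      = total
    ; surjective = surjective
    ; equal      = λ {x} {x′} {y} {y′} p p′ → equal {x} {x′} {y} {y′} (locate {x} {y} p) (locate {x′} {y′} p′)
    ; adjacent   = λ {x} {x′} {y} {y′} p p′ → adjacent {x} {x′} {y} {y′} (locate {x} {y} p) (locate {x′} {y′} p′)
    }
    where
    equal : ∀ {x x′ y y′} → Located x y → Located x′ y′ → Flips.Equal x x′ ⇔ Edges.Equal y y′
    equal (d , adj , enum , e) (d′ , adj′ , enum′ , e′) = same-vertex adj adj′ enum enum′ e e′
    adjacent : ∀ {x x′ y y′} → Located x y → Located x′ y′ → Flips.Adjacent x x′ ⇔ Edges.Adjacent y y′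
    adjacent (d , adj , enum , e) (d′ , adj′ , enum′ , e′) = flip⇔edge adj adj′ enum enum′ e e′

open import Data.Nat.Base using (_≤_)

proposition4p4 : ∀ {c ℓ₁ ℓ₂} (𝕂 : OrderedField c ℓ₁ ℓ₂) →
    let open Geometry 𝕂 in
    (k m : ℕ) → 3 ≤ k → 1 ≤ m →
    (P : ConvexPolygon (size k m)) (h : ℕ) (δ : Enumeration k m P h) →
    let open Complexes P δ in
    -- (a)
    ( IsPolytopalComplex 𝖣
    × IsSimplicialComplex 𝖣₊
    × IsSimplicialComplex 𝖣₊ᵗ
    -- the slice 𝕂^h × 𝟏/g only makes sense for g = m - 1 positive
    × (2 ≤ m → (𝖣 ×𝟏/ g) ≐ section (Slice g h) π□Hom₊)
    × (2 ≤ m → (𝖣 ×𝟏/ g) ≐ section (Slice g h) π□Hom₊ᵗ) )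
    -- (b)
    × 𝖳 ≐ induced (TransversalFaces (m ⊖ 2))
    -- (c)
    × IsIsomorphism flipGraph (1-skeleton 𝖣) Corresponds
-- With k = r + 3 and m = g + 1 both k - 2 and m - 1 compute, and k - 2 is visibly positive.
proposition4p4 𝕂 (suc (suc (suc r))) (suc g) (s≤s (s≤s (s≤s _))) (s≤s _) P h δ =
  ( homImage-isPolytopalComplex
  , hom₊Image-isSimplicialComplex
  , hom₊ᵗImage-isSimplicialComplex
  -- For m at least 2, `Fin g` has the index 0, which witnesses g > 0.
  , (λ 2≤m → section-Hom₊ (Fin.fromℕ< (s≤s⁻¹ 2≤m)))
  , (λ 2≤m → section-Hom₊ᵗ (Fin.fromℕ< (s≤s⁻¹ 2≤m))) )
  -- The dimension m - 2 is g - 1, that of a simplex with one vertex for each chord of a dissection.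
  , cliqueComplex-induced clique-in-dissection (ℤ.[1+m]⊖[1+n]≡m⊖n g 1)
  , flipGraph-isomorphism
  where open FlipGraph 𝕂 r g P δ
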